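{- For every integer $M\ge1$, $$\mathcal{Y}(z;t)\,\mathcal{Y}(w;t^M)=\frac{(w/z;t)_M}{(-w/z;t)_M}\;:\!\mathcal{Y}(z;t)\mathcal{Y}(w;t^M)\!:\,.$$ Equivalently, $$F_{t,t^M}(u)=\prod_{j=0}^{M-1}\frac{1-t^ju}{1+t^ju}=\frac{(u;t)_M}{(-u;t)_M}.$$
   Context: Let $t$ be an indeterminate and let operators act on $\Gamma_{\mathbb{Q}(t)}=\mathbb{Q}(t)[p_1,p_3,p_5,\ldots]$. For odd $n\ge1$, $a_{ -n}$ is multiplication by $p_n$ and $a_n=\frac n2\frac{\partial}{\partial p_n}$. For a parameter $s$ (here $s=t$ or $s=t^M$) set $$A_s(z)=\sum_{n\ge1,\ n\text{ odd}}\frac{2(1-s^n)}{n}a_{ -n}z^n,\qquad B_s(z)=-\sum_{n\ge1,\ n\text{ odd}}\frac{2}{n(1-s^n)}a_nz^{ -n},$$ and $\mathcal{Y}(z;s)=e^{A_s(z)}e^{B_s(z)}$, a formal series in $z^{\pm1}$ with operator coefficients. The normally ordered product is $$:\!\mathcal{Y}(z;t)\mathcal{Y}(w;s)\!:\;=e^{A_t(z)+A_s(w)}e^{B_t(z)+B_s(w)}.$$ Further, $$F_{t,s}(u)=\exp\Big(-2\sum_{n\ge1,\ n\text{ odd}}\frac{1-s^n}{1-t^n}\frac{u^n}{n}\Big),$$ which is the scalar factor in $\mathcal{Y}(z;t)\mathcal{Y}(w;s)=F_{t,s}(w/z):\!\mathcal{Y}(z;t)\mathcal{Y}(w;s)\!:$.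 The Pochhammer symbol is $(a;t)_M=\prod_{j=0}^{M-1}(1-at^j)$. Scalar factors are expanded as formal power series in $w/z$. -}

module Defs where

open import Level using (_⊔_; 0ℓ)
open import Function.Base using (_∘_; id)
open import Algebra.Bundles using (Ring; CommutativeRing)
import Algebra.Properties.Ring as RingProperties
import Algebra.Properties.AbelianGroup as AbelianGroupProperties
import Algebra.Properties.CommutativeSemigroup as CommutativeSemigroupProperties
import Algebra.Properties.Semiring.Sum as SemiringSum
import Algebra.Properties.Monoid.Sum as MonoidSum
import Algebra.Properties.Semiring.Exp as SemiringExp
open import Data.Fin.Base using (Fin; zero; suc; toℕ)
open import Data.Nat.Base as ℕ using (ℕ; zero; suc; z≤n; s≤s; _!)
import Data.Nat.Properties as ℕ
open import Data.Integer.Base as ℤ using (ℤ; +_; -[1+_])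
import Data.Integer.Properties as ℤ
open import Data.Rational.Base as ℚ using (ℚ; 0ℚ; 1ℚ)
import Data.Rational.Properties as ℚ
open import Data.Product.Base using (∃; _,_; proj₁; proj₂)
open import Data.Sum.Base using (_⊎_; inj₁; inj₂)
open import Relation.Nullary using (¬_; Dec; yes; no; contradiction)
open import Relation.Binary.PropositionalEquality as ≡ using (_≡_)

module PowerSeries {c ℓ} (R : Ring c ℓ) where

  open Ring R
  open import Relation.Binary.Reasoning.Setoid setoid

  infix  4 _≈ˢ_
  infixl 6 _+ˢ_
  infixl 7 _*ˢ_
  infix  8 -ˢ_

  Series : Set c
  Series = ℕ → Carrier

  _≈ˢ_ : Series → Series → Set ℓ
  f ≈ˢ g = ∀ n → f n ≈ g n

  _+ˢ_ : Series → Series → Series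
  (f +ˢ g) n = f n + g n

  -- The Cauchy product (f * g) n = ∑_{i + j = n} f i * g j, by recursion on n.
  _*ˢ_ : Series → Series → Series
  (f *ˢ g) zero    = f 0 * g 0
  (f *ˢ g) (suc n) = f 0 * g (suc n) + ((f ∘ suc) *ˢ g) n

  -ˢ_ : Series → Series
  (-ˢ f) n = - f n

  constant : Carrier → Series
  constant a zero    = a
  constant a (suc n) = 0#

  indeterminate : Series
  indeterminate zero          = 0#
  indeterminate (suc zero)    = 1#
  indeterminate (suc (suc n)) = 0#

  private
    module +CS = CommutativeSemigroupProperties +-commutativeSemigroup

    *ˢ-cong : ∀ {f f′ g g′} → f ≈ˢ f′ → g ≈ˢ g′ → (f *ˢ g) ≈ˢ (f′ *ˢ g′)
    *ˢ-cong p q zero    = *-cong (p 0) (q 0)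
    *ˢ-cong p q (suc n) =
      +-cong (*-cong (p 0) (q (suc n))) (*ˢ-cong (p ∘ suc) q n)

    zeroˢ : ∀ f g → (∀ n → f n ≈ 0#) → ∀ n → (f *ˢ g) n ≈ 0#
    zeroˢ f g p zero    = trans (*-congʳ (p 0)) (zeroˡ _)
    zeroˢ f g p (suc n) =
      trans (+-cong (trans (*-congʳ (p 0)) (zeroˡ _)) (zeroˢ (f ∘ suc) g (p ∘ suc) n))
            (+-identityˡ 0#)

    distribʳˢ : ∀ h f g → ((f +ˢ g) *ˢ h) ≈ˢ ((f *ˢ h) +ˢ (g *ˢ h))
    distribʳˢ h f g zero    = distribʳ _ _ _
    distribʳˢ h f g (suc n) =
      trans (+-cong (distribʳ _ _ _) (distribʳˢ h (f ∘ suc) (g ∘ suc) n))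
            (+CS.interchange _ _ _ _)

    distribˡˢ : ∀ h f g → (h *ˢ (f +ˢ g)) ≈ˢ ((h *ˢ f) +ˢ (h *ˢ g))
    distribˡˢ h f g zero    = distribˡ _ _ _
    distribˡˢ h f g (suc n) =
      trans (+-cong (distribˡ _ _ _) (distribˡˢ (h ∘ suc) f g n))
            (+CS.interchange _ _ _ _)

    scaleˢ : ∀ a f g n → ((λ i → a * f i) *ˢ g) n ≈ a * (f *ˢ g) n
    scaleˢ a f g zero    = *-assoc _ _ _
    scaleˢ a f g (suc n) =
      trans (+-cong (*-assoc _ _ _) (scaleˢ a (f ∘ suc) g n)) (sym (distribˡ _ _ _))

    *ˢ-assoc : ∀ f g h → ((f *ˢ g) *ˢ h) ≈ˢ (f *ˢ (g *ˢ h))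
    *ˢ-assoc f g h zero    = *-assoc _ _ _
    *ˢ-assoc f g h (suc n) = begin
      (f 0 * g 0) * h (suc n) + (((λ i → f 0 * g (suc i)) +ˢ ((f ∘ suc) *ˢ g)) *ˢ h) n
        ≈⟨ +-cong (*-assoc _ _ _)
             (trans (distribʳˢ h (λ i → f 0 * g (suc i)) ((f ∘ suc) *ˢ g) n)
                    (+-cong (scaleˢ (f 0) (g ∘ suc) h n) (*ˢ-assoc (f ∘ suc) g h n))) ⟩
      f 0 * (g 0 * h (suc n)) + (f 0 * ((g ∘ suc) *ˢ h) n + ((f ∘ suc) *ˢ (g *ˢ h)) n)
        ≈⟨ +-assoc _ _ _ ⟨
      (f 0 * (g 0 * h (suc n)) + f 0 * ((g ∘ suc) *ˢ h) n) + ((f ∘ suc) *ˢ (g *ˢ h)) n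
        ≈⟨ +-congʳ (distribˡ _ _ _) ⟨
      f 0 * (g *ˢ h) (suc n) + ((f ∘ suc) *ˢ (g *ˢ h)) n ∎

    *ˢ-identityˡ : ∀ f → (constant 1# *ˢ f) ≈ˢ f
    *ˢ-identityˡ f zero    = *-identityˡ _
    *ˢ-identityˡ f (suc n) =
      trans (+-cong (*-identityˡ _) (zeroˢ _ f (λ _ → refl) n)) (+-identityʳ _)

  -- (f * g) (suc n), with the last summand of the Cauchy product split off.
  *ˢ-last : ∀ f g n → (f *ˢ g) (suc n) ≈ (f *ˢ (g ∘ suc)) n + f (suc n) * g 0
  *ˢ-last f g zero    = refl
  *ˢ-last f g (suc n) =
    trans (+-congˡ (*ˢ-last (f ∘ suc) g n)) (sym (+-assoc _ _ _))

  private
    *ˢ-identityʳ : ∀ f → (f *ˢ constant 1#) ≈ˢ f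
    *ˢ-identityʳ f zero    = *-identityʳ _
    *ˢ-identityʳ f (suc n) = begin
      f 0 * 0# + ((f ∘ suc) *ˢ constant 1#) n
        ≈⟨ +-cong (zeroʳ _) (*ˢ-identityʳ (f ∘ suc) n) ⟩
      0# + f (suc n) ≈⟨ +-identityˡ _ ⟩
      f (suc n) ∎

  seriesRing : Ring c ℓ
  seriesRing = record
    { Carrier = Series
    ; _≈_     = _≈ˢ_
    ; _+_     = _+ˢ_
    ; _*_     = _*ˢ_
    ; -_      = -ˢ_
    ; 0#      = λ _ → 0#
    ; 1#      = constant 1#
    ; isRing  = record
      { +-isAbelianGroup = record
        { isGroup = record
          { isMonoid = record
            { isSemigroup = record
              { isMagma = record
                { isEquivalence = record
                  { refl  = λ _ → refl
                  ; sym   = λ p n → sym (p n)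
                  ; trans = λ p q n → trans (p n) (q n) }
                ; ∙-cong = λ p q n → +-cong (p n) (q n) }
              ; assoc = λ f g h n → +-assoc (f n) (g n) (h n) }
            ; identity = (λ f n → +-identityˡ (f n)) , (λ f n → +-identityʳ (f n)) }
          ; inverse = (λ f n → -‿inverseˡ (f n)) , (λ f n → -‿inverseʳ (f n))
          ; ⁻¹-cong = λ p n → -‿cong (p n) }
        ; comm = λ f g n → +-comm (f n) (g n) }
      ; *-cong     = *ˢ-cong
      ; *-assoc    = *ˢ-assoc
      ; *-identity = *ˢ-identityˡ , *ˢ-identityʳ
      ; distrib    = distribˡˢ , distribʳˢ } }

module CommutativePowerSeries {c ℓ} (R : CommutativeRing c ℓ) where

  open CommutativeRing R
  open PowerSeries ring public

  *ˢ-comm : ∀ f g → (f *ˢ g) ≈ˢ (g *ˢ f)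
  *ˢ-comm f g zero    = *-comm _ _
  *ˢ-comm f g (suc n) =
    trans (+-cong (*-comm _ _) (*ˢ-comm (f ∘ suc) g n))
          (trans (+-comm _ _) (sym (*ˢ-last g f n)))

  seriesCommutativeRing : CommutativeRing c ℓ
  seriesCommutativeRing = record
    { isCommutativeRing = record
      { isRing = Ring.isRing seriesRing
      ; *-comm = *ˢ-comm } }

  private module S = CommutativeRing seriesCommutativeRing
  open SemiringExp S.semiring using (_^_)
  open SemiringSum S.semiring using (sum⁺-syntax)

  infix 8 1/_

  -- 1 / f = ∑_k (1 - f)^k for a series f with constant term 1.  As (1 - f)^k
  -- has no terms of degree below k, only k ≤ n contribute in degree n.
  1/_ : Series → Series
  (1/ f) n = (∑[ k ≤ n ] ((S.1# S.- f) ^ toℕ k)) n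

-- Exponentials of formal power series over a ring R, which need not be
-- commutative; ι is the structure map of R as an algebra over ℚ.

module Exponential {c ℓ} (R : Ring c ℓ) (ι : ℚ → Ring.Carrier R) where

  1/!_ : ℕ → ℚ
  1/! k = ((+ 1) ℚ./ (k !)) {{k ℕ.!≢0}}

  module Truncated {c ℓ} (S : Ring c ℓ) (κ : ℚ → Ring.Carrier S) where
    open Ring S
    open SemiringExp semiring using (_^_)
    open SemiringSum semiring using (sum⁺-syntax)

    exp≤ : ℕ → Carrier → Carrier
    exp≤ N x = ∑[ k ≤ N ] (κ (1/! toℕ k) * x ^ toℕ k)

  open PowerSeries R

  -- R[[x, y]] as R[[y]] over which series in x are taken: the coefficient
  -- of x^i y^j in f is f i j.
  module ₂ = PowerSeries seriesRing
  open ₂ public using () renaming (Series to Series₂; _+ˢ_ to _+₂_)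

  private
    module T₁ = Truncated seriesRing (constant ∘ ι)
    module T₂ = Truncated ₂.seriesRing (₂.constant ∘ constant ∘ ι)

  -- The argument of an exponential is required to have no constant term, so
  -- that its k-th power has no terms of total degree below k.
  exp : Series → Series
  exp f n = T₁.exp≤ n f n

  exp₂ : Series₂ → Series₂
  exp₂ f i j = T₂.exp≤ (i ℕ.+ j) f i j

  inX inY : Series → Series₂
  inX f i = constant (f i)
  inY f   = ₂.constant f

module FieldOfFractions {c ℓ} (D : CommutativeRing c ℓ)
  (nontrivial : ¬ CommutativeRing._≈_ D (CommutativeRing.1# D) (CommutativeRing.0# D))
  (cancel : ∀ x y → ¬ CommutativeRing._≈_ D x (CommutativeRing.0# D) →
            CommutativeRing._≈_ D (CommutativeRing._*_ D x y) (CommutativeRing.0# D) →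
            CommutativeRing._≈_ D y (CommutativeRing.0# D))
  (zero? : ∀ x → Dec (CommutativeRing._≈_ D x (CommutativeRing.0# D)))
  where

  open CommutativeRing D
  open import Relation.Binary.Reasoning.Setoid setoid
  open RingProperties ring
    using (-‿distribˡ-*; x[y-z]≈xy-xz)
  open AbelianGroupProperties +-abelianGroup
    using () renaming (x∙y⁻¹≈ε⇒x≈y to x-y≈0⇒x≈y; x≈y⇒x∙y⁻¹≈ε to x≈y⇒x-y≈0)
  open CommutativeSemigroupProperties *-commutativeSemigroup
    using (x∙yz≈y∙xz; xy∙z≈xz∙y; interchange)

  record Fraction : Set (c ⊔ ℓ) where
    constructor fraction
    field
      num   : Carrier
      den   : Carrier
      den≉0 : ¬ (den ≈ 0#)
  open Fraction

  _≈ᶠ_ : Fraction → Fraction → Set ℓ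
  x ≈ᶠ y = num x * den y ≈ num y * den x

  private
    *-≉0 : ∀ {x y} → ¬ (x ≈ 0#) → ¬ (y ≈ 0#) → ¬ (x * y ≈ 0#)
    *-≉0 x≉0 y≉0 xy≈0 = y≉0 (cancel _ _ x≉0 xy≈0)

  embed : Carrier → Fraction
  embed x = fraction x 1# nontrivial

  _+ᶠ_ _*ᶠ_ : Fraction → Fraction → Fraction
  x +ᶠ y = fraction (num x * den y + num y * den x) (den x * den y)
                    (*-≉0 (den≉0 x) (den≉0 y))
  x *ᶠ y = fraction (num x * num y) (den x * den y) (*-≉0 (den≉0 x) (den≉0 y))

  -ᶠ_ : Fraction → Fraction
  -ᶠ x = fraction (- num x) (den x) (den≉0 x)

  -- The inverse, made total by 0⁻¹ = 0.
  _⁻¹ᶠ : Fraction → Fraction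
  x ⁻¹ᶠ with zero? (num x)
  ... | yes _   = embed 0#
  ... | no  x≉0 = fraction (den x) (num x) x≉0

  private
    cancelˡ : ∀ z {x y} → ¬ (z ≈ 0#) → z * x ≈ z * y → x ≈ y
    cancelˡ z {x} {y} z≉0 eq = x-y≈0⇒x≈y _ _ (cancel z (x - y) z≉0 (begin
      z * (x - y)    ≈⟨ x[y-z]≈xy-xz _ _ _ ⟩
      z * x - z * y  ≈⟨ x≈y⇒x-y≈0 eq ⟩
      0#             ∎))

    ≈ᶠ-trans : ∀ {x y z} → x ≈ᶠ y → y ≈ᶠ z → x ≈ᶠ z
    ≈ᶠ-trans {x} {y} {z} p q = cancelˡ (den y) (den≉0 y) (begin
      den y * (num x * den z)  ≈⟨ x∙yz≈y∙xz _ _ _ ⟩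
      num x * (den y * den z)  ≈⟨ *-assoc _ _ _ ⟨
      (num x * den y) * den z  ≈⟨ *-congʳ p ⟩
      (num y * den x) * den z  ≈⟨ xy∙z≈xz∙y _ _ _ ⟩
      (num y * den z) * den x  ≈⟨ *-congʳ q ⟩
      (num z * den y) * den x  ≈⟨ xy∙z≈xz∙y _ _ _ ⟩
      (num z * den x) * den y  ≈⟨ *-comm _ _ ⟩
      den y * (num z * den x)  ∎)

    +ᶠ-cong : ∀ {x x′ y y′} → x ≈ᶠ x′ → y ≈ᶠ y′ → (x +ᶠ y) ≈ᶠ (x′ +ᶠ y′)
    +ᶠ-cong {x} {x′} {y} {y′} p q = begin
      (num x * den y + num y * den x) * (den x′ * den y′)
        ≈⟨ distribʳ _ _ _ ⟩
      num x * den y * (den x′ * den y′) + num y * den x * (den x′ * den y′)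
        ≈⟨ +-cong (interchange _ _ _ _)
                  (trans (*-congˡ (*-comm _ _)) (interchange _ _ _ _)) ⟩
      num x * den x′ * (den y * den y′) + num y * den y′ * (den x * den x′)
        ≈⟨ +-cong (*-congʳ p) (*-congʳ q) ⟩
      num x′ * den x * (den y * den y′) + num y′ * den y * (den x * den x′)
        ≈⟨ +-cong (trans (*-congˡ (*-comm _ _)) (interchange _ _ _ _))
                  (trans (*-congˡ (*-comm _ _))
                    (trans (interchange _ _ _ _) (*-congˡ (*-comm _ _)))) ⟩
      num x′ * den y′ * (den x * den y) + num y′ * den x′ * (den x * den y)
        ≈⟨ distribʳ _ _ _ ⟨
      (num x′ * den y′ + num y′ * den x′) * (den x * den y) ∎

    *ᶠ-cong : ∀ {x x′ y y′} → x ≈ᶠ x′ → y ≈ᶠ y′ → (x *ᶠ y) ≈ᶠ (x′ *ᶠ y′)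
    *ᶠ-cong p q =
      trans (interchange _ _ _ _) (trans (*-cong p q) (interchange _ _ _ _))

    cross : ∀ {n n′ d d′} → n ≈ n′ → d ≈ d′ → n * d′ ≈ n′ * d
    cross p q = *-cong p (sym q)

    +ᶠ-assoc : ∀ x y z → ((x +ᶠ y) +ᶠ z) ≈ᶠ (x +ᶠ (y +ᶠ z))
    +ᶠ-assoc x y z = cross (begin
      (num x * den y + num y * den x) * den z + num z * (den x * den y)
        ≈⟨ +-congʳ (distribʳ _ _ _) ⟩
      num x * den y * den z + num y * den x * den z + num z * (den x * den y)
        ≈⟨ +-assoc _ _ _ ⟩
      num x * den y * den z + (num y * den x * den z + num z * (den x * den y))
        ≈⟨ +-cong (*-assoc _ _ _)
             (+-cong (xy∙z≈xz∙y _ _ _)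
                     (trans (*-congˡ (*-comm _ _)) (sym (*-assoc _ _ _)))) ⟩
      num x * (den y * den z) + (num y * den z * den x + num z * den y * den x)
        ≈⟨ +-congˡ (distribʳ _ _ _) ⟨
      num x * (den y * den z) + (num y * den z + num z * den y) * den x ∎)
      (*-assoc _ _ _)

    distribˡᶠ : ∀ x y z → (x *ᶠ (y +ᶠ z)) ≈ᶠ ((x *ᶠ y) +ᶠ (x *ᶠ z))
    distribˡᶠ x y z = begin
      num x * (num y * den z + num z * den y) * (den x * den y * (den x * den z))
        ≈⟨ *-congˡ (trans (interchange _ _ _ _) (*-assoc _ _ _)) ⟩
      num x * (num y * den z + num z * den y) * (den x * (den x * (den y * den z)))
        ≈⟨ *-assoc _ _ _ ⟨
      num x * (num y * den z + num z * den y) * den x * (den x * (den y * den z))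
        ≈⟨ *-congʳ (trans (*-congʳ (distribˡ _ _ _)) (distribʳ _ _ _)) ⟩
      (num x * (num y * den z) * den x + num x * (num z * den y) * den x)
        * (den x * (den y * den z))
        ≈⟨ *-congʳ (+-cong (shuffle _ _ _ _) (shuffle _ _ _ _)) ⟩
      (num x * num y * (den x * den z) + num x * num z * (den x * den y))
        * (den x * (den y * den z)) ∎
      where
      shuffle : ∀ a b e d → a * (b * e) * d ≈ a * b * (d * e)
      shuffle a b e d = begin
        a * (b * e) * d    ≈⟨ *-congʳ (*-assoc _ _ _) ⟨
        a * b * e * d      ≈⟨ *-assoc _ _ _ ⟩
        a * b * (e * d)    ≈⟨ *-congˡ (*-comm _ _) ⟩
        a * b * (d * e)    ∎

    +ᶠ-comm : ∀ x y → (x +ᶠ y) ≈ᶠ (y +ᶠ x)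
    +ᶠ-comm x y = cross (+-comm _ _) (*-comm _ _)

    *ᶠ-comm : ∀ x y → (x *ᶠ y) ≈ᶠ (y *ᶠ x)
    *ᶠ-comm x y = cross (*-comm _ _) (*-comm _ _)

    +ᶠ-identityˡ : ∀ x → (embed 0# +ᶠ x) ≈ᶠ x
    +ᶠ-identityˡ x =
      cross (trans (+-cong (zeroˡ _) (*-identityʳ _)) (+-identityˡ _)) (*-identityˡ _)

    *ᶠ-identityˡ : ∀ x → (embed 1# *ᶠ x) ≈ᶠ x
    *ᶠ-identityˡ x = cross (*-identityˡ _) (*-identityˡ _)

    +ᶠ-inverseˡ : ∀ x → ((-ᶠ x) +ᶠ x) ≈ᶠ embed 0#
    +ᶠ-inverseˡ x = trans (*-identityʳ _) (trans (begin
      - num x * den x + num x * den x  ≈⟨ distribʳ _ _ _ ⟨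
      (- num x + num x) * den x        ≈⟨ *-congʳ (-‿inverseˡ _) ⟩
      0# * den x                       ≈⟨ zeroˡ _ ⟩
      0#                               ∎) (sym (zeroˡ _)))

    -ᶠ-cong : ∀ {x y} → x ≈ᶠ y → (-ᶠ x) ≈ᶠ (-ᶠ y)
    -ᶠ-cong p =
      trans (sym (-‿distribˡ-* _ _)) (trans (-‿cong p) (-‿distribˡ-* _ _))

  fractionField : CommutativeRing (c ⊔ ℓ) ℓ
  fractionField = record
    { Carrier = Fraction
    ; _≈_ = _≈ᶠ_
    ; _+_ = _+ᶠ_
    ; _*_ = _*ᶠ_
    ; -_  = -ᶠ_
    ; 0#  = embed 0#
    ; 1#  = embed 1#
    ; isCommutativeRing = record
      { isRing = record
        { +-isAbelianGroup = record
          { isGroup = record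
            { isMonoid = record
              { isSemigroup = record
                { isMagma = record
                  { isEquivalence = record
                    { refl  = refl
                    ; sym   = sym
                    ; trans = λ {x} {y} {z} → ≈ᶠ-trans {x} {y} {z} }
                  ; ∙-cong = λ {x} {x′} {y} {y′} → +ᶠ-cong {x} {x′} {y} {y′} }
                ; assoc = +ᶠ-assoc }
              ; identity = +ᶠ-identityˡ
                , (λ x → ≈ᶠ-trans {x +ᶠ embed 0#} {embed 0# +ᶠ x} {x}
                           (+ᶠ-comm x (embed 0#)) (+ᶠ-identityˡ x)) }
            ; inverse = +ᶠ-inverseˡ
              , (λ x → ≈ᶠ-trans {x +ᶠ (-ᶠ x)} {(-ᶠ x) +ᶠ x} {embed 0#}
                         (+ᶠ-comm x (-ᶠ x)) (+ᶠ-inverseˡ x))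
            ; ⁻¹-cong = λ {x} {y} → -ᶠ-cong {x} {y} }
          ; comm = +ᶠ-comm }
        ; *-cong  = λ {x} {x′} {y} {y′} → *ᶠ-cong {x} {x′} {y} {y′}
        ; *-assoc = λ x y z → cross (*-assoc _ _ _) (*-assoc _ _ _)
        ; *-identity = *ᶠ-identityˡ
          , (λ x → ≈ᶠ-trans {x *ᶠ embed 1#} {embed 1# *ᶠ x} {x}
                     (*ᶠ-comm x (embed 1#)) (*ᶠ-identityˡ x))
        ; distrib = distribˡᶠ
          , (λ x y z → ≈ᶠ-trans {(y +ᶠ z) *ᶠ x} {x *ᶠ (y +ᶠ z)} {(y *ᶠ x) +ᶠ (z *ᶠ x)}
                         (*ᶠ-comm (y +ᶠ z) x)
                         (≈ᶠ-trans {x *ᶠ (y +ᶠ z)} {(x *ᶠ y) +ᶠ (x *ᶠ z)}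
                                   {(y *ᶠ x) +ᶠ (z *ᶠ x)}
                           (distribˡᶠ x y z)
                           (+ᶠ-cong {x *ᶠ y} {y *ᶠ x} {x *ᶠ z} {z *ᶠ x}
                             (*ᶠ-comm x y) (*ᶠ-comm x z)))) }
      ; *-comm = *ᶠ-comm } }

  ⁻¹ᶠ-inverseʳ : ∀ x → ¬ (x ≈ᶠ embed 0#) → (x *ᶠ (x ⁻¹ᶠ)) ≈ᶠ embed 1#
  ⁻¹ᶠ-inverseʳ x x≉0 with zero? (num x)
  ... | yes n≈0 = contradiction (trans (*-identityʳ _) (trans n≈0 (sym (zeroˡ _)))) x≉0
  ... | no  _   = trans (*-identityʳ _) (trans (*-comm _ _) (sym (*-identityˡ _)))

module RationalFunctions where

  private
    ℚ-ring : CommutativeRing 0ℓ 0ℓ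
    ℚ-ring = ℚ.+-*-commutativeRing

  open CommutativePowerSeries ℚ-ring
  private module S = CommutativeRing seriesCommutativeRing

  VanishesFrom : ℕ → Series → Set
  VanishesFrom N f = ∀ n → N ℕ.≤ n → f n ≡ 0ℚ

  -- ℚ[t], as the power series with finitely many nonzero coefficients.
  record Polynomial : Set where
    constructor polynomial
    field
      coeff  : Series
      bound  : ℕ
      finite : VanishesFrom bound coeff
  open Polynomial

  _≈ᵖ_ : Polynomial → Polynomial → Set
  f ≈ᵖ g = coeff f ≈ˢ coeff g

  private
    constant-finite : ∀ q → VanishesFrom 1 (constant q)
    constant-finite q (suc n) _ = ≡.refl

    indeterminate-finite : VanishesFrom 2 indeterminate
    indeterminate-finite (suc zero)    (s≤s ())
    indeterminate-finite (suc (suc n)) _ = ≡.refl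

    +-finite : ∀ {M N f g} → VanishesFrom M f → VanishesFrom N g →
               VanishesFrom (M ℕ.+ N) (f +ˢ g)
    +-finite {M} {N} p q n M+N≤n =
      ≡.cong₂ ℚ._+_ (p n (ℕ.m+n≤o⇒m≤o M M+N≤n)) (q n (ℕ.m+n≤o⇒n≤o M M+N≤n))

    *-finite : ∀ {M N f g} → VanishesFrom M f → VanishesFrom N g →
               VanishesFrom (M ℕ.+ N) (f *ˢ g)
    *-finite {zero} {f = f} {g} p q n _ =
      ≡.trans (S.*-congʳ {g} {f} {λ _ → 0ℚ} (λ i → p i z≤n) n) (S.zeroˡ g n)
    *-finite {suc M} {N} {f} {g} p q (suc n) (s≤s M+N≤n) =
      ≡.cong₂ ℚ._+_
        (≡.trans (≡.cong (f 0 ℚ.*_)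
                   (q (suc n) (ℕ.≤-trans (ℕ.m+n≤o⇒n≤o M M+N≤n) (ℕ.n≤1+n n))))
                 (ℚ.*-zeroʳ (f 0)))
        (*-finite {M} {N} {f ∘ suc} {g} (λ i M≤i → p (suc i) (s≤s M≤i)) q n M+N≤n)

  polynomialRing : CommutativeRing 0ℓ 0ℓ
  polynomialRing = record
    { Carrier = Polynomial
    ; _≈_ = _≈ᵖ_
    ; _+_ = λ f g → polynomial (coeff f +ˢ coeff g) (bound f ℕ.+ bound g)
                      (+-finite {f = coeff f} {coeff g} (finite f) (finite g))
    ; _*_ = λ f g → polynomial (coeff f *ˢ coeff g) (bound f ℕ.+ bound g)
                      (*-finite {f = coeff f} {coeff g} (finite f) (finite g))
    ; -_  = λ f → polynomial (-ˢ coeff f) (bound f)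
                    (λ n b≤n → ≡.cong ℚ.-_ (finite f n b≤n))
    ; 0#  = polynomial S.0# 0 (λ _ _ → ≡.refl)
    ; 1#  = polynomial S.1# 1 (constant-finite 1ℚ)
    ; isCommutativeRing = record
      { isRing = record
        { +-isAbelianGroup = record
          { isGroup = record
            { isMonoid = record
              { isSemigroup = record
                { isMagma = record
                  { isEquivalence = record
                    { refl  = λ _ → ≡.refl
                    ; sym   = λ p n → ≡.sym (p n)
                    ; trans = λ p q n → ≡.trans (p n) (q n) }
                  ; ∙-cong = λ p q n → ≡.cong₂ ℚ._+_ (p n) (q n) }
                ; assoc = λ f g h → S.+-assoc (coeff f) (coeff g) (coeff h) }
              ; identity = (λ f → S.+-identityˡ (coeff f)) , (λ f → S.+-identityʳ (coeff f)) }
            ; inverse = (λ f → S.-‿inverseˡ (coeff f)) , (λ f → S.-‿inverseʳ (coeff f))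
            ; ⁻¹-cong = λ p n → ≡.cong ℚ.-_ (p n) }
          ; comm = λ f g → S.+-comm (coeff f) (coeff g) }
        ; *-cong = λ {f} {f′} {g} {g′} →
                     S.*-cong {coeff f} {coeff f′} {coeff g} {coeff g′}
        ; *-assoc = λ f g h → S.*-assoc (coeff f) (coeff g) (coeff h)
        ; *-identity = (λ f → S.*-identityˡ (coeff f)) , (λ f → S.*-identityʳ (coeff f))
        ; distrib = (λ f g h → S.distribˡ (coeff f) (coeff g) (coeff h))
                  , (λ f g h → S.distribʳ (coeff f) (coeff g) (coeff h)) }
      ; *-comm = λ f g → S.*-comm (coeff f) (coeff g) } }

  private
    module P = CommutativeRing polynomialRing

    cancel-ℚ : ∀ x y → ¬ (x ≡ 0ℚ) → x ℚ.* y ≡ 0ℚ → y ≡ 0ℚ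
    cancel-ℚ x y x≢0 xy≡0 = begin
      y                          ≡⟨ ℚ.*-identityˡ y ⟨
      1ℚ ℚ.* y                   ≡⟨ ≡.cong (ℚ._* y) (ℚ.*-inverseˡ x) ⟨
      (ℚ.1/ x ℚ.* x) ℚ.* y       ≡⟨ ℚ.*-assoc (ℚ.1/ x) x y ⟩
      ℚ.1/ x ℚ.* (x ℚ.* y)       ≡⟨ ≡.cong (ℚ.1/ x ℚ.*_) xy≡0 ⟩
      ℚ.1/ x ℚ.* 0ℚ              ≡⟨ ℚ.*-zeroʳ (ℚ.1/ x) ⟩
      0ℚ                         ∎
      where
      open ≡.≡-Reasoning
      instance _ = ℚ.≢-nonZero x≢0

    cancel₀ : ∀ f g → ¬ (f 0 ≡ 0ℚ) → (∀ n → (f *ˢ g) n ≡ 0ℚ) → ∀ n → g n ≡ 0ℚ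
    cancel₀ f g f₀≢0 fg≡0 zero    = cancel-ℚ _ _ f₀≢0 (fg≡0 0)
    cancel₀ f g f₀≢0 fg≡0 (suc n) = cancel₀ f (g ∘ suc) f₀≢0 (λ m → begin
      (f *ˢ (g ∘ suc)) m
        ≡⟨ ℚ.+-identityʳ _ ⟨
      (f *ˢ (g ∘ suc)) m ℚ.+ 0ℚ
        ≡⟨ ≡.cong ((f *ˢ (g ∘ suc)) m ℚ.+_)
             (≡.trans (≡.cong (f (suc m) ℚ.*_) (cancel-ℚ _ _ f₀≢0 (fg≡0 0)))
                      (ℚ.*-zeroʳ (f (suc m)))) ⟨
      (f *ˢ (g ∘ suc)) m ℚ.+ f (suc m) ℚ.* g 0
        ≡⟨ *ˢ-last f g m ⟨
      (f *ˢ g) (suc m)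
        ≡⟨ fg≡0 (suc m) ⟩
      0ℚ ∎) n
      where open ≡.≡-Reasoning

    cancelˢ : ∀ i f g → ¬ (f i ≡ 0ℚ) → (∀ n → (f *ˢ g) n ≡ 0ℚ) → ∀ n → g n ≡ 0ℚ
    cancelˢ zero    f g fᵢ≢0 fg≡0 = cancel₀ f g fᵢ≢0 fg≡0
    cancelˢ (suc i) f g fᵢ≢0 fg≡0 with f 0 ℚ.≟ 0ℚ
    ... | no  f₀≢0 = cancel₀ f g f₀≢0 fg≡0
    ... | yes f₀≡0 = cancelˢ i (f ∘ suc) g fᵢ≢0 (λ n → begin
      ((f ∘ suc) *ˢ g) n                          ≡⟨ ℚ.+-identityˡ _ ⟨
      0ℚ ℚ.+ ((f ∘ suc) *ˢ g) n                   ≡⟨ ≡.cong (ℚ._+ ((f ∘ suc) *ˢ g) n)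
                                                       (≡.trans (≡.cong (ℚ._* g (suc n)) f₀≡0)
                                                                (ℚ.*-zeroˡ (g (suc n)))) ⟨
      (f *ˢ g) (suc n)                            ≡⟨ fg≡0 (suc n) ⟩
      0ℚ                                          ∎)
      where open ≡.≡-Reasoning

    search : ∀ N f → VanishesFrom N f → (∀ n → f n ≡ 0ℚ) ⊎ ∃ λ i → ¬ (f i ≡ 0ℚ)
    search zero    f p = inj₁ (λ n → p n z≤n)
    search (suc N) f p with f 0 ℚ.≟ 0ℚ
    ... | no f₀≢0 = inj₂ (0 , f₀≢0)
    ... | yes f₀≡0 with search N (f ∘ suc) (λ n N≤n → p (suc n) (s≤s N≤n))
    ...   | inj₁ q       = inj₁ λ { zero → f₀≡0 ; (suc n) → q n }
    ...   | inj₂ (i , q) = inj₂ (suc i , q)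

    zeroᵖ? : ∀ f → Dec (f P.≈ P.0#)
    zeroᵖ? f with search (bound f) (coeff f) (finite f)
    ... | inj₁ p       = yes p
    ... | inj₂ (i , q) = no (λ p → q (p i))

    cancelᵖ : ∀ f g → ¬ (f P.≈ P.0#) → (f P.* g) P.≈ P.0# → g P.≈ P.0#
    cancelᵖ f g f≉0 fg≈0 with search (bound f) (coeff f) (finite f)
    ... | inj₁ p       = contradiction p f≉0
    ... | inj₂ (i , q) = cancelˢ i (coeff f) (coeff g) q fg≈0

    nontrivialᵖ : ¬ (P.1# P.≈ P.0#)
    nontrivialᵖ p with () ← p 0

  open FieldOfFractions polynomialRing nontrivialᵖ cancelᵖ zeroᵖ? public

  ℚ⟨t⟩ : CommutativeRing 0ℓ 0ℓ
  ℚ⟨t⟩ = fractionField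

  fromℚ : ℚ → Fraction
  fromℚ q = embed (polynomial (constant q) 1 (constant-finite q))

  t : Fraction
  t = embed (polynomial indeterminate 2 indeterminate-finite)

private
  b-m+j<0 : ∀ b m j {d} → ℤ.∣ b ∣ ℕ.+ d ℕ.< m → j ℕ.≤ d → (b ℤ.- + m) ℤ.+ + j ℤ.< + 0
  b-m+j<0 b m j {d} N<m j≤d = begin-strict
    (b ℤ.- + m) ℤ.+ + j           ≡⟨ ℤ.+-assoc b (ℤ.- + m) (+ j) ⟩
    b ℤ.+ (ℤ.- + m ℤ.+ + j)       ≡⟨ ≡.cong (λ i → b ℤ.+ i) (ℤ.+-comm (ℤ.- + m) (+ j)) ⟩
    b ℤ.+ (+ j ℤ.- + m)           ≡⟨ ℤ.+-assoc b (+ j) (ℤ.- + m) ⟨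
    (b ℤ.+ + j) ℤ.- + m           ≤⟨ ℤ.+-monoˡ-≤ (ℤ.- + m) (ℤ.+-mono-≤ (i≤∣i∣ b) (ℤ.+≤+ j≤d)) ⟩
    + (ℤ.∣ b ∣ ℕ.+ d) ℤ.- + m     <⟨ ℤ.+-monoˡ-< (ℤ.- + m) (ℤ.+<+ N<m) ⟩
    + m ℤ.- + m                   ≡⟨ ℤ.+-inverseʳ (+ m) ⟩
    + 0                           ∎
    where
    open ℤ.≤-Reasoning
    i≤∣i∣ : ∀ i → i ℤ.≤ + ℤ.∣ i ∣
    i≤∣i∣ (+ n)    = ℤ.≤-refl
    i≤∣i∣ -[1+ n ] = ℤ.-≤+

-- _⁻¹ and ι are the inversion of the field K and its structure map as an algebra over ℚ.

module VertexOperators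
  (K : CommutativeRing 0ℓ 0ℓ)
  (_⁻¹ : CommutativeRing.Carrier K → CommutativeRing.Carrier K)
  (ι : ℚ → CommutativeRing.Carrier K)
  where

  private
    module K = CommutativeRing K
    open SemiringExp K.semiring using (_^_)

  -- Every odd number is odd k for exactly one k.
  odd : ℕ → ℕ
  odd k = suc (2 ℕ.* k)

  infixl 6 _⊕_
  infixl 7 _⊗_
  infix  8 ⊖_
  infix  4 _≈_

  -- K[p₁, p₃, p₅, …] as the free commutative K-algebra on generators p k, which
  -- stand for p_(odd k): expressions modulo the laws of commutative K-algebras.
  data Γ : Set where
    con     : K.Carrier → Γ
    p       : ℕ → Γ
    _⊕_ _⊗_ : Γ → Γ → Γ
    ⊖_      : Γ → Γ

  data _≈_ : Γ → Γ → Set where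
    ≈-refl  : ∀ {f} → f ≈ f
    ≈-sym   : ∀ {f g} → f ≈ g → g ≈ f
    ≈-trans : ∀ {f g h} → f ≈ g → g ≈ h → f ≈ h

    ⊕-cong : ∀ {f f′ g g′} → f ≈ f′ → g ≈ g′ → f ⊕ g ≈ f′ ⊕ g′
    ⊗-cong : ∀ {f f′ g g′} → f ≈ f′ → g ≈ g′ → f ⊗ g ≈ f′ ⊗ g′
    ⊖-cong : ∀ {f f′} → f ≈ f′ → ⊖ f ≈ ⊖ f′

    ⊕-assoc     : ∀ f g h → (f ⊕ g) ⊕ h ≈ f ⊕ (g ⊕ h)
    ⊕-comm      : ∀ f g → f ⊕ g ≈ g ⊕ f
    ⊕-identityˡ : ∀ f → con K.0# ⊕ f ≈ f
    ⊖-inverseˡ  : ∀ f → ⊖ f ⊕ f ≈ con K.0#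
    ⊗-assoc     : ∀ f g h → (f ⊗ g) ⊗ h ≈ f ⊗ (g ⊗ h)
    ⊗-comm      : ∀ f g → f ⊗ g ≈ g ⊗ f
    ⊗-identityˡ : ∀ f → con K.1# ⊗ f ≈ f
    ⊗-distribʳ  : ∀ f g h → (g ⊕ h) ⊗ f ≈ g ⊗ f ⊕ h ⊗ f

    con-cong : ∀ {a b} → a K.≈ b → con a ≈ con b
    con-+    : ∀ a b → con (a K.+ b) ≈ con a ⊕ con b
    con-*    : ∀ a b → con (a K.* b) ≈ con a ⊗ con b

  Γ-commutativeRing : CommutativeRing 0ℓ 0ℓ
  Γ-commutativeRing = record
    { Carrier = Γ
    ; _≈_ = _≈_
    ; _+_ = _⊕_
    ; _*_ = _⊗_
    ; -_  = ⊖_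
    ; 0#  = con K.0#
    ; 1#  = con K.1#
    ; isCommutativeRing = record
      { isRing = record
        { +-isAbelianGroup = record
          { isGroup = record
            { isMonoid = record
              { isSemigroup = record
                { isMagma = record
                  { isEquivalence = record
                    { refl = ≈-refl ; sym = ≈-sym ; trans = ≈-trans }
                  ; ∙-cong = ⊕-cong }
                ; assoc = ⊕-assoc }
              ; identity = ⊕-identityˡ
                , (λ f → ≈-trans (⊕-comm f _) (⊕-identityˡ f)) }
            ; inverse = ⊖-inverseˡ , (λ f → ≈-trans (⊕-comm f _) (⊖-inverseˡ f))
            ; ⁻¹-cong = ⊖-cong }
          ; comm = ⊕-comm }
        ; *-cong = ⊗-cong
        ; *-assoc = ⊗-assoc
        ; *-identity = ⊗-identityˡ , (λ f → ≈-trans (⊗-comm f _) (⊗-identityˡ f))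
        ; distrib = (λ f g h → ≈-trans (⊗-comm f _) (≈-trans (⊗-distribʳ f g h)
                                 (⊕-cong (⊗-comm g f) (⊗-comm h f))))
                  , ⊗-distribʳ }
      ; *-comm = ⊗-comm } }

  private
    module G = CommutativeRing Γ-commutativeRing
    module G⁺ = CommutativeSemigroupProperties G.+-commutativeSemigroup
    module G* = CommutativeSemigroupProperties G.*-commutativeSemigroup
    module Gʳ = RingProperties G.ring
    module Gᵃ = AbelianGroupProperties G.+-abelianGroup
    open MonoidSum G.+-monoid using (sum; sum-syntax)
    open import Relation.Binary.Reasoning.Setoid G.setoid

  record Operator : Set where
    constructor operator
    field
      apply     : Γ → Γ
      cong      : ∀ {f g} → f ≈ g → apply f ≈ apply g
      additive  : ∀ f g → apply (f ⊕ g) ≈ apply f ⊕ apply g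
      homogeneous : ∀ a f → apply (con a ⊗ f) ≈ con a ⊗ apply f

    apply-0 : apply (con K.0#) ≈ con K.0#
    apply-0 = begin
      apply (con K.0#)                  ≈⟨ cong (G.zeroˡ _) ⟨
      apply (con K.0# ⊗ con K.0#)       ≈⟨ homogeneous _ _ ⟩
      con K.0# ⊗ apply (con K.0#)       ≈⟨ G.zeroˡ _ ⟩
      con K.0#                          ∎

  open Operator

  _≈ᵒ_ : Operator → Operator → Set
  S ≈ᵒ T = ∀ f → apply S f ≈ apply T f

  0ᵒ 1ᵒ : Operator
  0ᵒ = operator (λ _ → con K.0#) (λ _ → ≈-refl)
         (λ _ _ → ≈-sym (⊕-identityˡ _)) (λ _ _ → ≈-sym (G.zeroʳ _))
  1ᵒ = operator id id (λ _ _ → ≈-refl) (λ _ _ → ≈-refl)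

  _+ᵒ_ _∘ᵒ_ : Operator → Operator → Operator
  S +ᵒ T = operator (λ f → apply S f ⊕ apply T f)
    (λ e → ⊕-cong (cong S e) (cong T e))
    (λ f g → ≈-trans (⊕-cong (additive S f g) (additive T f g)) (G⁺.interchange _ _ _ _))
    (λ a f → ≈-trans (⊕-cong (homogeneous S a f) (homogeneous T a f))
                     (≈-sym (G.distribˡ _ _ _)))
  S ∘ᵒ T = operator (apply S ∘ apply T)
    (cong S ∘ cong T)
    (λ f g → ≈-trans (cong S (additive T f g)) (additive S _ _))
    (λ a f → ≈-trans (cong S (homogeneous T a f)) (homogeneous S _ _))

  -ᵒ_ : Operator → Operator
  -ᵒ S = operator (λ f → ⊖ apply S f)
    (λ e → ⊖-cong (cong S e))
    (λ f g → ≈-trans (⊖-cong (additive S f g)) (≈-sym (Gᵃ.⁻¹-∙-comm _ _)))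
    (λ a f → ≈-trans (⊖-cong (homogeneous S a f)) (Gʳ.-‿distribʳ-* _ _))

  operatorRing : Ring 0ℓ 0ℓ
  operatorRing = record
    { Carrier = Operator
    ; _≈_ = _≈ᵒ_
    ; _+_ = _+ᵒ_
    ; _*_ = _∘ᵒ_
    ; -_  = -ᵒ_
    ; 0#  = 0ᵒ
    ; 1#  = 1ᵒ
    ; isRing = record
      { +-isAbelianGroup = record
        { isGroup = record
          { isMonoid = record
            { isSemigroup = record
              { isMagma = record
                { isEquivalence = record
                  { refl  = λ _ → ≈-refl
                  ; sym   = λ e f → ≈-sym (e f)
                  ; trans = λ e e′ f → ≈-trans (e f) (e′ f) }
                ; ∙-cong = λ e e′ f → ⊕-cong (e f) (e′ f) }
              ; assoc = λ _ _ _ _ → ⊕-assoc _ _ _ }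
            ; identity = (λ _ _ → ⊕-identityˡ _) , (λ _ _ → G.+-identityʳ _) }
          ; inverse = (λ _ _ → ⊖-inverseˡ _) , (λ _ _ → G.-‿inverseʳ _)
          ; ⁻¹-cong = λ e f → ⊖-cong (e f) }
        ; comm = λ _ _ _ → ⊕-comm _ _ }
      ; *-cong = λ {S} e e′ f → ≈-trans (cong S (e′ f)) (e _)
      ; *-assoc = λ _ _ _ _ → ≈-refl
      ; *-identity = (λ _ _ → ≈-refl) , (λ _ _ → ≈-refl)
      ; distrib = (λ S _ _ _ → additive S _ _) , (λ _ _ _ _ → ≈-refl) } }

  multiplication : Γ → Operator
  multiplication g = operator (g ⊗_)
    (⊗-cong ≈-refl)
    (λ _ _ → G.distribˡ _ _ _)
    (λ _ _ → G*.x∙yz≈y∙xz _ _ _)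

  scalar : K.Carrier → Operator
  scalar a = multiplication (con a)

  derivative : ℕ → Γ → Γ
  derivative k (con a) = con K.0#
  derivative k (p j) with k ℕ.≟ j
  ... | yes _ = con K.1#
  ... | no  _ = con K.0#
  derivative k (f ⊕ g) = derivative k f ⊕ derivative k g
  derivative k (f ⊗ g) = derivative k f ⊗ g ⊕ f ⊗ derivative k g
  derivative k (⊖ f)   = ⊖ derivative k f

  derivative-con-⊗ : ∀ k a f → derivative k (con a ⊗ f) ≈ con a ⊗ derivative k f
  derivative-con-⊗ k a f = ≈-trans (⊕-cong (G.zeroˡ _) ≈-refl) (⊕-identityˡ _)

  derivative-cong : ∀ k {f g} → f ≈ g → derivative k f ≈ derivative k g
  derivative-cong k ≈-refl = ≈-refl
  derivative-cong k (≈-sym e) = ≈-sym (derivative-cong k e)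
  derivative-cong k (≈-trans e e′) =
    ≈-trans (derivative-cong k e) (derivative-cong k e′)
  derivative-cong k (⊕-cong e e′) =
    ⊕-cong (derivative-cong k e) (derivative-cong k e′)
  derivative-cong k (⊗-cong e e′) =
    ⊕-cong (⊗-cong (derivative-cong k e) e′) (⊗-cong e (derivative-cong k e′))
  derivative-cong k (⊖-cong e) = ⊖-cong (derivative-cong k e)
  derivative-cong k (⊕-assoc f g h) = ⊕-assoc _ _ _
  derivative-cong k (⊕-comm f g) = ⊕-comm _ _
  derivative-cong k (⊕-identityˡ f) = ⊕-identityˡ _
  derivative-cong k (⊖-inverseˡ f) = ⊖-inverseˡ _
  derivative-cong k (⊗-assoc f g h) = begin
    (∂f ⊗ g ⊕ f ⊗ ∂g) ⊗ h ⊕ (f ⊗ g) ⊗ ∂h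
      ≈⟨ ⊕-cong (⊗-distribʳ _ _ _) (⊗-assoc _ _ _) ⟩
    ((∂f ⊗ g) ⊗ h ⊕ (f ⊗ ∂g) ⊗ h) ⊕ f ⊗ (g ⊗ ∂h)
      ≈⟨ ⊕-cong (⊕-cong (⊗-assoc _ _ _) (⊗-assoc _ _ _)) ≈-refl ⟩
    (∂f ⊗ (g ⊗ h) ⊕ f ⊗ (∂g ⊗ h)) ⊕ f ⊗ (g ⊗ ∂h)
      ≈⟨ ⊕-assoc _ _ _ ⟩
    ∂f ⊗ (g ⊗ h) ⊕ (f ⊗ (∂g ⊗ h) ⊕ f ⊗ (g ⊗ ∂h))
      ≈⟨ ⊕-cong ≈-refl (G.distribˡ _ _ _) ⟨
    ∂f ⊗ (g ⊗ h) ⊕ f ⊗ (∂g ⊗ h ⊕ g ⊗ ∂h) ∎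
    where
    ∂f = derivative k f
    ∂g = derivative k g
    ∂h = derivative k h
  derivative-cong k (⊗-comm f g) =
    ≈-trans (⊕-comm _ _) (⊕-cong (⊗-comm _ _) (⊗-comm _ _))
  derivative-cong k (⊗-identityˡ f) =
    ≈-trans (derivative-con-⊗ k K.1# f) (⊗-identityˡ _)
  derivative-cong k (⊗-distribʳ f g h) =
    ≈-trans (⊕-cong (⊗-distribʳ _ _ _) (⊗-distribʳ _ _ _)) (G⁺.interchange _ _ _ _)
  derivative-cong k (con-cong e) = ≈-refl
  derivative-cong k (con-+ a b) = ≈-sym (⊕-identityˡ _)
  derivative-cong k (con-* a b) =
    ≈-sym (≈-trans (⊕-cong (G.zeroˡ _) (G.zeroʳ _)) (⊕-identityˡ _))

  -- ∂ k = ∂ / ∂p_(odd k)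
  ∂ : ℕ → Operator
  ∂ k = operator (derivative k) (derivative-cong k) (λ _ _ → ≈-refl) (derivative-con-⊗ k)

  -- a₋ k = a_(- odd k) and a₊ k = a_(odd k)
  a₋ a₊ : ℕ → Operator
  a₋ k = multiplication (p k)
  a₊ k = scalar (ι (+ odd k ℚ./ 2)) ∘ᵒ ∂ k

  -- Only finitely many of the T n are nonzero at any given f.
  LocallyFinite : (ℕ → Operator) → Set
  LocallyFinite T = ∀ f → ∃ λ N → ∀ n → N ℕ.≤ n → apply (T n) f ≈ con K.0#

  sum-extend : ∀ (u : ℕ → Γ) M d → (∀ n → M ℕ.≤ n → u n ≈ con K.0#) →
               ∑[ i < M ℕ.+ d ] u (toℕ i) ≈ ∑[ i < M ] u (toℕ i)
  sum-extend u zero    zero    q = ≈-refl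
  sum-extend u zero    (suc d) q =
    ≈-trans (⊕-cong (q 0 z≤n) (sum-extend (u ∘ suc) zero d (λ n _ → q (suc n) z≤n)))
            (⊕-identityˡ _)
  sum-extend u (suc M) d       q =
    ⊕-cong ≈-refl (sum-extend (u ∘ suc) M d (λ n M≤n → q (suc n) (s≤s M≤n)))

  sum-unique : ∀ (u : ℕ → Γ) M N →
               (∀ n → M ℕ.≤ n → u n ≈ con K.0#) → (∀ n → N ℕ.≤ n → u n ≈ con K.0#) →
               ∑[ i < M ] u (toℕ i) ≈ ∑[ i < N ] u (toℕ i)
  sum-unique u M N q r = begin
    ∑[ i < M ] u (toℕ i)         ≈⟨ sum-extend u M N q ⟨
    ∑[ i < M ℕ.+ N ] u (toℕ i)   ≡⟨ ≡.cong (λ L → ∑[ i < L ] u (toℕ i)) (ℕ.+-comm M N) ⟩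
    ∑[ i < N ℕ.+ M ] u (toℕ i)   ≈⟨ sum-extend u N M r ⟩
    ∑[ i < N ] u (toℕ i)         ∎

  sum-cong : ∀ (u v : ℕ → Γ) N → (∀ n → u n ≈ v n) →
             ∑[ i < N ] u (toℕ i) ≈ ∑[ i < N ] v (toℕ i)
  sum-cong u v zero    e = ≈-refl
  sum-cong u v (suc N) e = ⊕-cong (e 0) (sum-cong (u ∘ suc) (v ∘ suc) N (e ∘ suc))

  sum-⊕ : ∀ (u v : ℕ → Γ) N →
          ∑[ i < N ] (u (toℕ i) ⊕ v (toℕ i)) ≈
            ∑[ i < N ] u (toℕ i) ⊕ ∑[ i < N ] v (toℕ i)
  sum-⊕ u v zero    = ≈-sym (⊕-identityˡ _)
  sum-⊕ u v (suc N) =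
    ≈-trans (⊕-cong ≈-refl (sum-⊕ (u ∘ suc) (v ∘ suc) N)) (G⁺.interchange _ _ _ _)

  sum-⊗ : ∀ a (u : ℕ → Γ) N →
          ∑[ i < N ] (a ⊗ u (toℕ i)) ≈ a ⊗ (∑[ i < N ] u (toℕ i))
  sum-⊗ a u zero    = ≈-sym (G.zeroʳ _)
  sum-⊗ a u (suc N) =
    ≈-trans (⊕-cong ≈-refl (sum-⊗ a (u ∘ suc) N)) (≈-sym (G.distribˡ _ _ _))

  -- ∑_{n ≥ 0} T n
  ∑∞ : (T : ℕ → Operator) → LocallyFinite T → Operator
  ∑∞ T fin = operator value
    (λ {f} {g} e → begin
      value f                                     ≈⟨ sum-cong _ _ (N f) (λ n → cong (T n) e) ⟩
      ∑[ i < N f ] apply (T (toℕ i)) g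
        ≈⟨ stable g (N f) (λ n N≤n → ≈-trans (cong (T n) (≈-sym e)) (fin f .proj₂ n N≤n)) ⟩
      value g                                     ∎)
    (λ f g → begin
      value (f ⊕ g)
        ≈⟨ stable (f ⊕ g) (N f ℕ.+ N g) (λ n N≤n → ≈-trans (additive (T n) f g)
             (≈-trans (⊕-cong (vanishˡ f g n N≤n) (vanishʳ f g n N≤n)) (⊕-identityˡ _))) ⟨
      ∑[ i < N f ℕ.+ N g ] apply (T (toℕ i)) (f ⊕ g)
        ≈⟨ sum-cong _ _ (N f ℕ.+ N g) (λ n → additive (T n) f g) ⟩
      ∑[ i < N f ℕ.+ N g ] (apply (T (toℕ i)) f ⊕ apply (T (toℕ i)) g)
        ≈⟨ sum-⊕ (λ n → apply (T n) f) (λ n → apply (T n) g) (N f ℕ.+ N g) ⟩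
      ∑[ i < N f ℕ.+ N g ] apply (T (toℕ i)) f ⊕ ∑[ i < N f ℕ.+ N g ] apply (T (toℕ i)) g
        ≈⟨ ⊕-cong (stable f (N f ℕ.+ N g) (vanishˡ f g)) (stable g (N f ℕ.+ N g) (vanishʳ f g)) ⟩
      value f ⊕ value g ∎)
    (λ a f → begin
      value (con a ⊗ f)
        ≈⟨ stable (con a ⊗ f) (N f) (λ n N≤n → ≈-trans (homogeneous (T n) a f)
             (≈-trans (⊗-cong ≈-refl (fin f .proj₂ n N≤n)) (G.zeroʳ _))) ⟨
      ∑[ i < N f ] apply (T (toℕ i)) (con a ⊗ f)
        ≈⟨ sum-cong _ _ (N f) (λ n → homogeneous (T n) a f) ⟩
      ∑[ i < N f ] (con a ⊗ apply (T (toℕ i)) f)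
        ≈⟨ sum-⊗ (con a) (λ n → apply (T n) f) (N f) ⟩
      con a ⊗ value f ∎)
    where
    N : Γ → ℕ
    N f = fin f .proj₁

    value : Γ → Γ
    value f = ∑[ i < N f ] apply (T (toℕ i)) f

    stable : ∀ f M → (∀ n → M ℕ.≤ n → apply (T n) f ≈ con K.0#) →
             ∑[ i < M ] apply (T (toℕ i)) f ≈ value f
    stable f M q = sum-unique (λ n → apply (T n) f) M (N f) q (fin f .proj₂)

    vanishˡ : ∀ f g n → N f ℕ.+ N g ℕ.≤ n → apply (T n) f ≈ con K.0#
    vanishˡ f g n N≤n = fin f .proj₂ n (ℕ.m+n≤o⇒m≤o (N f) N≤n)

    vanishʳ : ∀ f g n → N f ℕ.+ N g ℕ.≤ n → apply (T n) g ≈ con K.0#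
    vanishʳ f g n N≤n = fin g .proj₂ n (ℕ.m+n≤o⇒n≤o (N f) N≤n)

  ∑∞-zero : ∀ T fin f → (∀ n → apply (T n) f ≈ con K.0#) →
            apply (∑∞ T fin) f ≈ con K.0#
  ∑∞-zero T fin f q =
    sum-unique (λ n → apply (T n) f) (fin f .proj₁) 0 (λ n _ → q n) (λ n _ → q n)

  ∘-locallyFinite : ∀ (S T : ℕ → Operator) → LocallyFinite T → LocallyFinite (λ n → S n ∘ᵒ T n)
  ∘-locallyFinite S T fin f = fin f .proj₁ ,
    λ n N≤n → ≈-trans (cong (S n) (fin f .proj₂ n N≤n)) (apply-0 (S n))

  LocallyFinite₂ : (ℕ → ℕ → Operator) → Set
  LocallyFinite₂ T = ∀ f → ∃ λ N → ∀ i j → N ℕ.≤ i ⊎ N ℕ.≤ j → apply (T i j) f ≈ con K.0#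

  inner : ∀ T → LocallyFinite₂ T → ∀ i → LocallyFinite (T i)
  inner T fin i f = fin f .proj₁ , λ j N≤j → fin f .proj₂ i j (inj₂ N≤j)

  outer : ∀ T (fin : LocallyFinite₂ T) → LocallyFinite (λ i → ∑∞ (T i) (inner T fin i))
  outer T fin f = fin f .proj₁ , λ i N≤i →
    ∑∞-zero (T i) (inner T fin i) f (λ j → fin f .proj₂ i j (inj₁ N≤i))

  -- ∑_{i, j ≥ 0} T i j
  ∑∞₂ : (T : ℕ → ℕ → Operator) → LocallyFinite₂ T → Operator
  ∑∞₂ T fin = ∑∞ (λ i → ∑∞ (T i) (inner T fin i)) (outer T fin)

  ∑∞₂-zero : ∀ T fin f → (∀ i j → apply (T i j) f ≈ con K.0#) →
             apply (∑∞₂ T fin) f ≈ con K.0#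
  ∑∞₂-zero T fin f q =
    ∑∞-zero (λ i → ∑∞ (T i) (inner T fin i)) (outer T fin) f
      (λ i → ∑∞-zero (T i) (inner T fin i) f (q i))

  ∘-locallyFinite₂ : ∀ (S T : ℕ → ℕ → Operator) →
                     LocallyFinite₂ T → LocallyFinite₂ (λ i j → S i j ∘ᵒ T i j)
  ∘-locallyFinite₂ S T fin f = fin f .proj₁ , λ i j N≤ →
    ≈-trans (cong (S i j) (fin f .proj₂ i j N≤)) (apply-0 (S i j))

  open PowerSeries operatorRing using (Series)
  open Exponential operatorRing (scalar ∘ ι) using (exp; exp₂; inX; inY; Series₂; _+₂_; 1/!_)

  -- ∑_k c k x^(odd k)
  onOdds : ∀ {a} {A : Set a} → A → (ℕ → A) → ℕ → A
  onOdds 0# c zero          = 0#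
  onOdds 0# c (suc zero)    = c 0
  onOdds 0# c (suc (suc n)) = onOdds 0# (c ∘ suc) n

  2/odd : ℕ → K.Carrier
  2/odd k = ι (+ 2 ℚ./ odd k)

  -- A s is a power series in z, whereas B s is one in z⁻¹.
  A B : K.Carrier → Series
  A s = onOdds 0ᵒ λ k → scalar (2/odd k K.* (K.1# K.- s ^ odd k)) ∘ᵒ a₋ k
  B s = onOdds 0ᵒ λ k → -ᵒ (scalar (2/odd k K.* (K.1# K.- s ^ odd k) ⁻¹) ∘ᵒ a₊ k)

  -- The exponentials e^{A_r(z) + A_s(w)} in z, w and e^{B_r(z) + B_s(w)} in z⁻¹, w⁻¹.
  expA₂ expB₂ : K.Carrier → K.Carrier → Series₂
  expA₂ r s = exp₂ (inX (A r) +₂ inY (A s))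
  expB₂ r s = exp₂ (inX (B r) +₂ inY (B s))

  -- The coefficient in any integral degree, which is 0 in negative degrees.
  _⟨_⟩ : Series → ℤ → Operator
  f ⟨ + n ⟩      = f n
  f ⟨ -[1+ _ ] ⟩ = 0ᵒ

  _⟨_∣_⟩ : Series₂ → ℤ → ℤ → Operator
  f ⟨ + m ∣ b ⟩      = f m ⟨ b ⟩
  f ⟨ -[1+ _ ] ∣ b ⟩ = 0ᵒ

  -- Local finiteness of e^B: in degree n, it lowers the degree of polynomials
  -- by n, where p k has degree odd k.

  -- Deg< d f: f has degree less than d
  data Deg< : ℕ → Γ → Set where
    null   : ∀ {d} → Deg< d (con K.0#)
    resp   : ∀ {d f g} → f ≈ g → Deg< d f → Deg< d g
    weaken : ∀ {d e f} → d ℕ.≤ e → Deg< d f → Deg< e f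
    con    : ∀ {a} → Deg< 1 (con a)
    p      : ∀ {k} → Deg< (suc (odd k)) (p k)
    _⊕_    : ∀ {d f g} → Deg< d f → Deg< d g → Deg< d (f ⊕ g)
    _⊗_    : ∀ {d e f g} → Deg< (suc d) f → Deg< (suc e) g → Deg< (suc (d ℕ.+ e)) (f ⊗ g)
    ⊖_     : ∀ {d f} → Deg< d f → Deg< d (⊖ f)

  recast : ∀ {d e f} → d ≡ e → Deg< d f → Deg< e f
  recast ≡.refl q = q

  Deg<0⇒≈0 : ∀ {f} → Deg< 0 f → f ≈ con K.0#
  Deg<0⇒≈0 null           = ≈-refl
  Deg<0⇒≈0 (resp e q)     = ≈-trans (≈-sym e) (Deg<0⇒≈0 q)
  Deg<0⇒≈0 (weaken z≤n q) = Deg<0⇒≈0 q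
  Deg<0⇒≈0 (q ⊕ r)        = ≈-trans (⊕-cong (Deg<0⇒≈0 q) (Deg<0⇒≈0 r)) (⊕-identityˡ _)
  Deg<0⇒≈0 (⊖ q)          = ≈-trans (⊖-cong (Deg<0⇒≈0 q)) Gᵃ.ε⁻¹≈ε

  degree : Γ → ℕ
  degree (con a) = 0
  degree (p k)   = odd k
  degree (f ⊕ g) = degree f ℕ.⊔ degree g
  degree (f ⊗ g) = degree f ℕ.+ degree g
  degree (⊖ f)   = degree f

  degree-bound : ∀ f → Deg< (suc (degree f)) f
  degree-bound (con a) = con
  degree-bound (p k)   = p
  degree-bound (f ⊕ g) = weaken (s≤s (ℕ.m≤m⊔n _ _)) (degree-bound f)
                       ⊕ weaken (s≤s (ℕ.m≤n⊔m (degree f) _)) (degree-bound g)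
  degree-bound (f ⊗ g) = degree-bound f ⊗ degree-bound g
  degree-bound (⊖ f)   = ⊖ degree-bound f

  record Lowers (n : ℕ) (T : Operator) : Set where
    constructor lowers
    field lower : ∀ {d f} → Deg< d f → Deg< (d ℕ.∸ n) (apply T f)
  open Lowers

  Deg<-∸-⊗ : ∀ {d e n f g} → Deg< (suc d ℕ.∸ n) f → Deg< (suc e) g →
             Deg< (suc (d ℕ.+ e) ℕ.∸ n) (f ⊗ g)
  Deg<-∸-⊗ {d} {e} {n} q r with n ℕ.≤? d
  ... | yes n≤d = weaken (ℕ.≤-reflexive (≡.trans
                    (≡.cong suc (≡.sym (ℕ.+-∸-comm e n≤d)))
                    (≡.sym (ℕ.+-∸-assoc 1 (ℕ.≤-trans n≤d (ℕ.m≤m+n d e))))))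
                    (recast (ℕ.+-∸-assoc 1 n≤d) q ⊗ r)
  ... | no  n≰d = resp (≈-trans (≈-sym (G.zeroˡ _)) (⊗-cong (≈-sym
                    (Deg<0⇒≈0 (recast (ℕ.m≤n⇒m∸n≡0 (ℕ.≰⇒> n≰d)) q)))
                    ≈-refl)) null

  ∂-lower : ∀ k {d f} → Deg< d f → Deg< (d ℕ.∸ odd k) (derivative k f)
  ∂-lower k null = null
  ∂-lower k (resp e q) = resp (derivative-cong k e) (∂-lower k q)
  ∂-lower k (weaken d≤e q) = weaken (ℕ.∸-monoˡ-≤ (odd k) d≤e) (∂-lower k q)
  ∂-lower k con = null
  ∂-lower k (p {j}) with k ℕ.≟ j
  ... | yes ≡.refl = weaken (ℕ.≤-reflexive (≡.sym (ℕ.m+n∸n≡m 1 (odd k)))) con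
  ... | no  _      = null
  ∂-lower k (_⊕_ q r) = ∂-lower k q ⊕ ∂-lower k r
  ∂-lower k (_⊗_ {d} {e} q r) =
    Deg<-∸-⊗ {d} {e} {odd k} (∂-lower k q) r
    ⊕ resp (⊗-comm _ _) (recast (≡.cong (λ m → suc m ℕ.∸ odd k) (ℕ.+-comm e d))
             (Deg<-∸-⊗ {e} {d} {odd k} (∂-lower k r) q))
  ∂-lower k (⊖ q) = ⊖ ∂-lower k q

  scalar-lower : ∀ a {d f} → Deg< d f → Deg< d (con a ⊗ f)
  scalar-lower a {zero}  q = resp (≈-trans (≈-sym (G.zeroʳ _))
                               (⊗-cong ≈-refl (≈-sym (Deg<0⇒≈0 q)))) null
  scalar-lower a {suc d} q = con ⊗ q

  scalar-lowers : ∀ a → Lowers 0 (scalar a)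
  scalar-lowers a = lowers (scalar-lower a)

  -- A multiplicative filtration of a ring S is extended to S[[x]] by giving x
  -- degree -1.
  record Filtration (S : Ring 0ℓ 0ℓ) : Set₁ where
    open Ring S using (Carrier; 0#; 1#; _+_; _*_; semiring)
    field
      F   : ℕ → Carrier → Set
      F-0 : ∀ {m} → F m 0#
      F-+ : ∀ {m x y} → F m x → F m y → F m (x + y)
      F-* : ∀ {m n x y} → F m x → F n y → F (m ℕ.+ n) (x * y)
      F-1 : F 0 1#

    open SemiringExp semiring using () renaming (_^_ to _^ᶠ_)
    open SemiringSum semiring using () renaming (sum to sumᶠ)

    F-^ : ∀ {x} → F 0 x → ∀ n → F 0 (x ^ᶠ n)
    F-^ q zero    = F-1
    F-^ q (suc n) = F-* q (F-^ q n)

    F-sum : ∀ {n} (u : Fin n → Carrier) → (∀ i → F 0 (u i)) → F 0 (sumᶠ u)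
    F-sum {zero}  u q = F-0
    F-sum {suc n} u q = F-+ (q zero) (F-sum (u ∘ suc) (q ∘ suc))

  module _ {S : Ring 0ℓ 0ℓ} (𝓕 : Filtration S) where
    open Filtration 𝓕
    private module PS = PowerSeries S

    record Fˢ (m : ℕ) (f : PS.Series) : Set where
      constructor coefficientwise
      field at : ∀ n → F (m ℕ.+ n) (f n)
    open Fˢ public

    *-at : ∀ {m n f g} → Fˢ m f → Fˢ n g → ∀ i → F ((m ℕ.+ n) ℕ.+ i) ((f PS.*ˢ g) i)
    *-at {m} {n} {f} {g} q r zero =
      ≡.subst (λ l → F l (f 0 * g 0)) (≡.trans
        (≡.cong₂ ℕ._+_ (ℕ.+-identityʳ m) (ℕ.+-identityʳ n))
        (≡.sym (ℕ.+-identityʳ (m ℕ.+ n)))) (F-* (at q 0) (at r 0))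
      where open Ring S using (_*_)
    *-at {m} {n} {f} {g} q r (suc i) = F-+
      (≡.subst (λ l → F l (f 0 * g (suc i))) (≡.trans
        (≡.cong (ℕ._+ (n ℕ.+ suc i)) (ℕ.+-identityʳ m))
        (≡.sym (ℕ.+-assoc m n (suc i)))) (F-* (at q 0) (at r (suc i))))
      (≡.subst (λ l → F l (((f ∘ suc) PS.*ˢ g) i)) (≡.sym (ℕ.+-suc (m ℕ.+ n) i))
        (*-at tail-f r i))
      where
      open Ring S using (_*_)
      tail-f : Fˢ (suc m) (f ∘ suc)
      tail-f = coefficientwise λ j →
        ≡.subst (λ l → F l (f (suc j))) (ℕ.+-suc m j) (at q (suc j))

    constant-at : ∀ {m x} → F m x → ∀ n → F (m ℕ.+ n) (PS.constant x n)
    constant-at {m} {x} q zero    = ≡.subst (λ l → F l x) (≡.sym (ℕ.+-identityʳ m)) q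
    constant-at         q (suc n) = F-0

    Fˢ-constant : ∀ {m x} → F m x → Fˢ m (PS.constant x)
    Fˢ-constant q = coefficientwise (constant-at q)

    series-filtration : Filtration PS.seriesRing
    series-filtration = record
      { F = Fˢ
      ; F-0 = coefficientwise λ _ → F-0
      ; F-+ = λ q r → coefficientwise λ n → F-+ (at q n) (at r n)
      ; F-* = λ q r → coefficientwise (*-at q r)
      ; F-1 = Fˢ-constant F-1 }

  operator-filtration : Filtration operatorRing
  operator-filtration = record
    { F = Lowers
    ; F-0 = lowers λ _ → null
    ; F-+ = λ q r → lowers λ u → lower q u ⊕ lower r u
    ; F-* = λ {m} {n} q r → lowers λ {d} u → recast
              (≡.trans (ℕ.∸-+-assoc d n m) (≡.cong (d ℕ.∸_) (ℕ.+-comm n m)))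
              (lower q (lower r u))
    ; F-1 = lowers id }

  onOdds-lowers : ∀ c m → (∀ k → Lowers (m ℕ.+ odd k) (c k)) →
                  ∀ n → Lowers (m ℕ.+ n) (onOdds 0ᵒ c n)
  onOdds-lowers c m q zero          = lowers λ _ → null
  onOdds-lowers c m q (suc zero)    = q 0
  onOdds-lowers c m q (suc (suc n)) = ≡.subst (λ l → Lowers l (onOdds 0ᵒ (c ∘ suc) n))
    (≡.sym (+-suc₂ n))
    (onOdds-lowers (c ∘ suc) (2 ℕ.+ m) (λ k → ≡.subst (λ l → Lowers l (c (suc k)))
      (≡.trans (≡.cong (λ l → m ℕ.+ suc l) (ℕ.*-suc 2 k)) (+-suc₂ (odd k)))
      (q (suc k))) n)
    where
    +-suc₂ : ∀ k → m ℕ.+ suc (suc k) ≡ suc (suc (m ℕ.+ k))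
    +-suc₂ k = ≡.trans (ℕ.+-suc m (suc k)) (≡.cong suc (ℕ.+-suc m k))

  B-lowers : ∀ s n → Lowers n (B s n)
  B-lowers s = onOdds-lowers _ 0 λ k →
    lowers λ u → ⊖ scalar-lower _ (scalar-lower _ (∂-lower k u))

  𝓢  = series-filtration operator-filtration
  𝓢₂ = series-filtration 𝓢

  expB-lowers : ∀ s n → Lowers n (exp (B s) n)
  expB-lowers s n = at (F-sum {suc n} _ λ k → F-*
    (Fˢ-constant operator-filtration (scalar-lowers (ι (1/! toℕ k))))
    (F-^ (coefficientwise (B-lowers s)) (toℕ k))) n
    where open Filtration 𝓢

  expB₂-lowers : ∀ r s i j → Lowers (i ℕ.+ j) (expB₂ r s i j)
  expB₂-lowers r s i j = at (at (F-sum {suc (i ℕ.+ j)} _ λ k → F-*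
    (Fˢ-constant 𝓢 (Fˢ-constant operator-filtration (scalar-lowers (ι (1/! toℕ k)))))
    (F-^ argument (toℕ k))) i) j
    where
    open Filtration 𝓢₂
    argument : F 0 (inX (B r) +₂ inY (B s))
    argument = F-+
      (coefficientwise λ i → Fˢ-constant operator-filtration (B-lowers r i))
      (Fˢ-constant 𝓢 (coefficientwise (B-lowers s)))

  lowers-kills : ∀ {n T} f → degree f ℕ.< n → Lowers n T → apply T f ≈ con K.0#
  lowers-kills f d<n q = Deg<0⇒≈0
    (recast (ℕ.m≤n⇒m∸n≡0 d<n) (lower q (degree-bound f)))

  expB-locallyFinite : ∀ s → LocallyFinite (exp (B s))
  expB-locallyFinite s f = suc (degree f) , λ n d<n → lowers-kills f d<n (expB-lowers s n)

  expB₂-locallyFinite : ∀ r s → LocallyFinite₂ (expB₂ r s)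
  expB₂-locallyFinite r s f = suc (degree f) , λ where
    i j (inj₁ d<i) → lowers-kills f (ℕ.≤-trans d<i (ℕ.m≤m+n i j)) (expB₂-lowers r s i j)
    i j (inj₂ d<j) → lowers-kills f (ℕ.≤-trans d<j (ℕ.m≤n+m j i)) (expB₂-lowers r s i j)

  -- P a is the coefficient of z^a.
  Distribution : Set
  Distribution = ℤ → Operator

  -- P a b is the coefficient of z^a w^b.
  Distribution₂ : Set
  Distribution₂ = ℤ → ℤ → Operator

  infix 4 _≈ᵈ_
  _≈ᵈ_ : Distribution₂ → Distribution₂ → Set
  P ≈ᵈ Q = ∀ a b → P a b ≈ᵒ Q a b

  𝒴 : K.Carrier → Distribution
  𝒴 s a = ∑∞ (λ j → (exp (A s) ⟨ a ℤ.+ + j ⟩) ∘ᵒ exp (B s) j)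
              (∘-locallyFinite (λ j → exp (A s) ⟨ a ℤ.+ + j ⟩) (exp (B s)) (expB-locallyFinite s))

  infixl 7 _⊙_

  _⊙_ : Distribution → Distribution → Distribution₂
  (P ⊙ Q) a b = P a ∘ᵒ Q b

  -- :𝒴(z;r) 𝒴(w;s):
  normalOrdered : K.Carrier → K.Carrier → Distribution₂
  normalOrdered r s a b =
    ∑∞₂ (λ i j → (expA₂ r s ⟨ a ℤ.+ + i ∣ b ℤ.+ + j ⟩) ∘ᵒ expB₂ r s i j)
        (∘-locallyFinite₂ (λ i j → expA₂ r s ⟨ a ℤ.+ + i ∣ b ℤ.+ + j ⟩) (expB₂ r s)
          (expB₂-locallyFinite r s))

  -- The condition for power series in w/z to act on P.
  Summable : Distribution₂ → Set
  Summable P = ∀ a b → LocallyFinite (λ m → P (a ℤ.+ + m) (b ℤ.- + m))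

  -- c(w/z) P(z, w)
  scaleBy : (c : ℕ → K.Carrier) (P : Distribution₂) → Summable P → Distribution₂
  scaleBy c P fin a b =
    ∑∞ (λ m → scalar (c m) ∘ᵒ P (a ℤ.+ + m) (b ℤ.- + m))
       (∘-locallyFinite (λ m → scalar (c m)) (λ m → P (a ℤ.+ + m) (b ℤ.- + m)) (fin a b))

  normalOrdered-summable : ∀ r s → Summable (normalOrdered r s)
  normalOrdered-summable r s a b f = suc (ℤ.∣ b ∣ ℕ.+ degree f) , λ m N<m →
    ∑∞₂-zero (term m)
      (∘-locallyFinite₂ (left m) (expB₂ r s) (expB₂-locallyFinite r s))
      f (vanish m N<m)
    where
    left term : ℕ → ℕ → ℕ → Operator
    left m i j = expA₂ r s ⟨ (a ℤ.+ + m) ℤ.+ + i ∣ (b ℤ.- + m) ℤ.+ + j ⟩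
    term m i j = left m i j ∘ᵒ expB₂ r s i j

    negative : ∀ g a {b} → b ℤ.< + 0 → ∀ h → apply (g ⟨ a ∣ b ⟩) h ≈ con K.0#
    negative g (+ n)    { -[1+ _ ]} _ h = ≈-refl
    negative g (+ n)    {+ _} (ℤ.+<+ ()) h
    negative g -[1+ n ] _ h = ≈-refl

    vanish : ∀ m → ℤ.∣ b ∣ ℕ.+ degree f ℕ.< m → ∀ i j → apply (term m i j) f ≈ con K.0#
    vanish m N<m i j = by-cases (degree f ℕ.<? j)
      where
      by-cases : Dec (degree f ℕ.< j) → apply (term m i j) f ≈ con K.0#
      by-cases (yes d<j) = ≈-trans
        (cong (left m i j) (expB₂-locallyFinite r s f .proj₂ i j (inj₂ d<j)))
        (apply-0 (left m i j))
      by-cases (no d≮j)  = negative (expA₂ r s) ((a ℤ.+ + m) ℤ.+ + i)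
        (b-m+j<0 b m j N<m (ℕ.≮⇒≥ d≮j)) (apply (expB₂ r s i j) f)

  open CommutativePowerSeries K public
    using (1/_; seriesCommutativeRing; indeterminate; constant)
    renaming (Series to ScalarSeries; _≈ˢ_ to _≈ᵘ_)
  open CommutativeRing seriesCommutativeRing public
    using () renaming (_+_ to _+ᵘ_; _*_ to _*ᵘ_; -_ to -ᵘ_; _-_ to _-ᵘ_; 1# to 1ᵘ)
  open Exponential K.ring ι public using () renaming (exp to expᵘ)

  open MonoidSum (CommutativeRing.*-monoid seriesCommutativeRing)
    using () renaming (sum to product)

  infixl 7 _÷_
  _÷_ : ScalarSeries → ScalarSeries → ScalarSeries
  f ÷ g = f *ᵘ (1/ g)

  u : ScalarSeries
  u = indeterminate

  ∏< : ℕ → (ℕ → ScalarSeries) → ScalarSeries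
  ∏< M f = product {M} (f ∘ toℕ)

  -- F_{r,s}(u)
  F : K.Carrier → K.Carrier → ScalarSeries
  F r s = expᵘ (onOdds K.0# λ k →
    K.- (2/odd k K.* ((K.1# K.- s ^ odd k) K.* (K.1# K.- r ^ odd k) ⁻¹)))

  -- (a ; t)_M
  pochhammer : ScalarSeries → K.Carrier → ℕ → ScalarSeries
  pochhammer a t M = ∏< M λ j → 1ᵘ -ᵘ a *ᵘ constant (t ^ j)

open RationalFunctions public using (ℚ⟨t⟩; t; _⁻¹ᶠ; fromℚ)
open SemiringExp (CommutativeRing.semiring ℚ⟨t⟩) public using (_^_)
open VertexOperators ℚ⟨t⟩ _⁻¹ᶠ fromℚ public
  using ( 𝒴; _⊙_; _≈ᵈ_; normalOrdered; normalOrdered-summable; scaleBy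
        ; F; _≈ᵘ_; ∏<; _÷_; pochhammer; u; constant; 1ᵘ; _+ᵘ_; _-ᵘ_; _*ᵘ_; -ᵘ_ )

module Submission where

-- The operator identity and the product formula for F rest on one principle: over a
-- ℚ-algebra, a power series X is determined by its constant term and by an equation
-- θ X = f X, where θ = x d/dx and f has no constant term (θ-unique).  Exponentials
-- satisfy θ (e^f) = θ f e^f as soon as the coefficients of f commute; more generally
-- D (e^f) = D f e^f for a derivation D such that D f commutes with f (derive-exp).
--
-- The operators.  The coefficients of B_r and A_s satisfy
-- [B_{r,i}, A_{s,j}] = φ_i for i = j and 0 otherwise, where φ is the exponent of
-- F_{r,s} (commutator).  With D = [B_{r,i}, -] this gives
-- [B_{r,i}, e^{A_s(w)}] = φ_i w^i e^{A_s(w)} (commute-expA).  Hence, as series in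
-- x = 1/z, e^{B_r(z)} e^{A_s(w)} and F_{r,s}(w/z) e^{A_s(w)} e^{B_r(z)} solve the same
-- equation θ X = θ B_r X and are equal (expB-expA).  As the exponentials in two
-- variables factor (exp₂-split), 𝒴(z;r) 𝒴(w;s) and F_{r,s}(w/z) :𝒴(z;r) 𝒴(w;s): have
-- the same summands in a different order, and only finitely many of them are nonzero
-- at a given polynomial (𝒴-𝒴).
--
-- The scalar factor.  (1 - c u) / (1 + c u) has the logarithmic derivative
-- - 2 (c u + c^3 u^3 + ...) (θ-factor).  The sum of these over c = t^j, j < M, has the
-- coefficient - 2 (1 - t^{Mn}) / (1 - t^n) at u^n for odd n, by the geometric sum;
-- this is the logarithmic derivative of F_{t,t^M} (F-product).  Here 1 - t^n is
-- invertible because its value at t = 0 is 1.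
--
-- Finally the product of the quotients is the quotient of the products
-- (product-pochhammer).

open import Defs using
  ( module PowerSeries; module CommutativePowerSeries; module Exponential
  ; module VertexOperators; module RationalFunctions )
open import Level using (_⊔_; 0ℓ)
open import Function.Base using (_∘_; flip)
open import Algebra.Bundles using (Ring; CommutativeRing)
import Algebra.Properties.Ring as RingProperties
import Algebra.Properties.CommutativeSemigroup as CommutativeSemigroupProperties
import Algebra.Properties.Semiring.Sum as SemiringSum
import Algebra.Properties.Semiring.Exp as SemiringExp
import Algebra.Properties.Semiring.Mult as SemiringMult
import Algebra.Properties.CommutativeMonoid.Mult as CommutativeMonoidMult
import Algebra.Properties.Monoid.Sum as MonoidSum
open import Data.Fin.Base using (zero; suc; toℕ)
open import Data.Nat.Base as ℕ using (ℕ; zero; suc; z≤n; s≤s; _!)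
import Data.Nat.Properties as ℕ
open import Data.Integer.Base as ℤ using (ℤ; +_; -[1+_])
import Data.Integer.Properties as ℤ
open import Data.Rational.Base as ℚ using (ℚ; 0ℚ; 1ℚ)
import Data.Rational.Properties as ℚ
open import Data.Rational.Unnormalised.Base as ℚᵘ using (ℚᵘ; mkℚᵘ; _≃_; *≡*)
import Data.Rational.Unnormalised.Properties as ℚᵘ
open import Data.Product.Base using (_,_; proj₁; proj₂)
open import Data.Sum.Base using (_⊎_; inj₁; inj₂)
open import Relation.Nullary using (¬_; Dec; yes; no; contradiction)
open import Relation.Binary.PropositionalEquality as ≡ using (_≡_)

-- Sums over antidiagonals and over initial segments

module Convolution {c ℓ} (R : Ring c ℓ) where

  open Ring R hiding (zero)
  open PowerSeries R using (_*ˢ_)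
  open SemiringSum semiring using (sum; sum-cong-≋)
  open import Relation.Binary.Reasoning.Setoid setoid
  private module +CS = CommutativeSemigroupProperties +-commutativeSemigroup

  -- conv x n = ∑_{i + j = n} x i j
  conv : (ℕ → ℕ → Carrier) → ℕ → Carrier
  conv x zero    = x 0 0
  conv x (suc n) = x 0 (suc n) + conv (x ∘ suc) n

  *ˢ-conv : ∀ f g n → (f *ˢ g) n ≡ conv (λ i j → f i * g j) n
  *ˢ-conv f g zero    = ≡.refl
  *ˢ-conv f g (suc n) = ≡.cong (λ y → f 0 * g (suc n) + y) (*ˢ-conv (f ∘ suc) g n)

  conv-cong : ∀ {x y} n → (∀ i j → i ℕ.+ j ≡ n → x i j ≈ y i j) → conv x n ≈ conv y n
  conv-cong zero    e = e 0 0 ≡.refl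
  conv-cong (suc n) e =
    +-cong (e 0 (suc n) ≡.refl) (conv-cong n λ i j i+j≡n → e (suc i) j (≡.cong suc i+j≡n))

  conv-0 : ∀ n → conv (λ _ _ → 0#) n ≈ 0#
  conv-0 zero    = refl
  conv-0 (suc n) = trans (+-identityˡ _) (conv-0 n)

  conv-zero : ∀ {x} n → (∀ i j → i ℕ.+ j ≡ n → x i j ≈ 0#) → conv x n ≈ 0#
  conv-zero n e = trans (conv-cong n e) (conv-0 n)

  conv-+ : ∀ x y n → conv (λ i j → x i j + y i j) n ≈ conv x n + conv y n
  conv-+ x y zero    = refl
  conv-+ x y (suc n) = trans (+-congˡ (conv-+ (x ∘ suc) (y ∘ suc) n)) (+CS.interchange _ _ _ _)

  conv-last : ∀ x n → conv x (suc n) ≈ conv (λ i j → x i (suc j)) n + x (suc n) 0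
  conv-last x zero    = refl
  conv-last x (suc n) = trans (+-congˡ (conv-last (x ∘ suc) n)) (sym (+-assoc _ _ _))

  conv-flip : ∀ x n → conv (flip x) n ≈ conv x n
  conv-flip x zero    = refl
  conv-flip x (suc n) = begin
    x (suc n) 0 + conv (λ i j → x j (suc i)) n    ≈⟨ +-comm _ _ ⟩
    conv (λ i j → x j (suc i)) n + x (suc n) 0    ≈⟨ +-congʳ (conv-flip (λ i j → x i (suc j)) n) ⟩
    conv (λ i j → x i (suc j)) n + x (suc n) 0    ≈⟨ conv-last x n ⟨
    conv x (suc n)                                ∎

  -- ∑< n u = ∑_{k < n} u k
  ∑< : ℕ → (ℕ → Carrier) → Carrier
  ∑< n u = sum {n} (u ∘ toℕ)

  ∑<-cong : ∀ {u v} n → (∀ k → u k ≈ v k) → ∑< n u ≈ ∑< n v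
  ∑<-cong n e = sum-cong-≋ {n} (e ∘ toℕ)

  ∑<-zero : ∀ {u} n → (∀ k → u k ≈ 0#) → ∑< n u ≈ 0#
  ∑<-zero zero    e = refl
  ∑<-zero (suc n) e = trans (+-cong (e 0) (∑<-zero n (e ∘ suc))) (+-identityˡ _)

  ∑<-+ : ∀ u v n → ∑< n (λ k → u k + v k) ≈ ∑< n u + ∑< n v
  ∑<-+ u v zero    = sym (+-identityˡ _)
  ∑<-+ u v (suc n) = trans (+-congˡ (∑<-+ (u ∘ suc) (v ∘ suc) n)) (+CS.interchange _ _ _ _)

  -- The summands from n on vanish.
  ∑<-truncate : ∀ u {m} n → n ℕ.≤ m → (∀ k → n ℕ.≤ k → u k ≈ 0#) → ∑< m u ≈ ∑< n u
  ∑<-truncate u {m} zero _ e = ∑<-zero m (λ k → e k z≤n)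
  ∑<-truncate u (suc n) (s≤s n≤m) e =
    +-congˡ (∑<-truncate (u ∘ suc) n n≤m (λ k n≤k → e (suc k) (s≤s n≤k)))

  -- If x is supported on the rectangle K × N, then the antidiagonals of index
  -- below K + N exhaust it.
  conv-rectangle : ∀ x K N → (∀ k l → K ℕ.≤ k ⊎ N ℕ.≤ l → x k l ≈ 0#) →
                   ∑< (K ℕ.+ N) (conv x) ≈ ∑< K (λ k → ∑< N (x k))
  conv-rectangle x zero    N e = ∑<-zero N λ n → conv-zero n λ k l _ → e k l (inj₁ z≤n)
  conv-rectangle x (suc K) N e = begin
    x 0 0 + ∑< (K ℕ.+ N) (λ n → x 0 (suc n) + conv (x ∘ suc) n)
      ≈⟨ +-congˡ (∑<-+ (x 0 ∘ suc) (conv (x ∘ suc)) (K ℕ.+ N)) ⟩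
    x 0 0 + (∑< (K ℕ.+ N) (x 0 ∘ suc) + ∑< (K ℕ.+ N) (conv (x ∘ suc)))
      ≈⟨ +-assoc _ _ _ ⟨
    ∑< (suc K ℕ.+ N) (x 0) + ∑< (K ℕ.+ N) (conv (x ∘ suc))
      ≈⟨ +-cong (∑<-truncate (x 0) N (ℕ.m≤n+m N (suc K)) (λ l N≤l → e 0 l (inj₂ N≤l)))
                (conv-rectangle (x ∘ suc) K N λ where
                  k l (inj₁ K≤k) → e (suc k) l (inj₁ (s≤s K≤k))
                  k l (inj₂ N≤l) → e (suc k) l (inj₂ N≤l)) ⟩
    ∑< N (x 0) + ∑< K (λ k → ∑< N (x (suc k))) ∎

module _ {c ℓ c′ ℓ′} (R : Ring c ℓ) (S : Ring c′ ℓ′) where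

  private
    module R = Ring R
    module S = Ring S
    module CR = Convolution R
    module CS = Convolution S

  conv-map : (h : R.Carrier → S.Carrier) → (∀ x y → h (x R.+ y) S.≈ h x S.+ h y) →
             ∀ x n → h (CR.conv x n) S.≈ CS.conv (λ i j → h (x i j)) n
  conv-map h h-+ x zero    = S.refl
  conv-map h h-+ x (suc n) = S.trans (h-+ _ _) (S.+-congˡ (conv-map h h-+ (x ∘ suc) n))

  ∑<-map : (h : R.Carrier → S.Carrier) → h R.0# S.≈ S.0# →
           (∀ x y → h (x R.+ y) S.≈ h x S.+ h y) →
           ∀ u n → h (CR.∑< n u) S.≈ CS.∑< n (h ∘ u)
  ∑<-map h h-0 h-+ u zero    = h-0
  ∑<-map h h-0 h-+ u (suc n) =
    S.trans (h-+ _ _) (S.+-congˡ (∑<-map h h-0 h-+ (u ∘ suc) n))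

-- Algebras over ℚ

-- ι makes the ring R, which need not be commutative, an algebra over ℚ: it is a
-- ring homomorphism with central image.
record IsℚAlgebra {c ℓ} (R : Ring c ℓ) (ι : ℚ → Ring.Carrier R) : Set (c ⊔ ℓ) where
  open Ring R
  field
    ι-+     : ∀ p q → ι (p ℚ.+ q) ≈ ι p + ι q
    ι-*     : ∀ p q → ι (p ℚ.* q) ≈ ι p * ι q
    ι-1     : ι 1ℚ ≈ 1#
    central : ∀ q x → ι q * x ≈ x * ι q

-- Arithmetic of fractions with natural numerators; n ×ℚ q is the n-fold sum of q.
module Fractions where

  open SemiringMult (Ring.semiring ℚ.+-*-ring) public using () renaming (_×_ to _×ℚ_)

  private
    -- m / d without reduction to lowest terms
    _/ᵘ_ : ℕ → ∀ d .{{_ : ℕ.NonZero d}} → ℚᵘ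
    m /ᵘ suc d = mkℚᵘ (+ m) d

    toℚᵘ-/ : ∀ m d .{{_ : ℕ.NonZero d}} → ℚ.toℚᵘ (+ m ℚ./ d) ≃ (m /ᵘ d)
    toℚᵘ-/ m (suc d) = ℚ.toℚᵘ-fromℚᵘ (mkℚᵘ (+ m) d)

    /ᵘ-+ : ∀ m n d .{{_ : ℕ.NonZero d}} → (m /ᵘ d) ℚᵘ.+ (n /ᵘ d) ≃ ((m ℕ.+ n) /ᵘ d)
    /ᵘ-+ m n (suc d) = *≡* (≡.trans
      (≡.cong (ℤ._* + suc d) (≡.sym (ℤ.*-distribʳ-+ (+ suc d) (+ m) (+ n))))
      (ℤ.*-assoc (+ (m ℕ.+ n)) (+ suc d) (+ suc d)))

    /ᵘ-* : ∀ m n c d .{{_ : ℕ.NonZero c}} .{{_ : ℕ.NonZero d}} →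
           (m /ᵘ c) ℚᵘ.* (n /ᵘ d) ≃ ((m ℕ.* n) /ᵘ (c ℕ.* d)) {{ℕ.m*n≢0 c d}}
    /ᵘ-* m n (suc c) (suc d) = *≡* (≡.cong (ℤ._* + (suc c ℕ.* suc d)) (≡.sym (ℤ.pos-* m n)))

    /ᵘ-≃ : ∀ m n c d .{{_ : ℕ.NonZero c}} .{{_ : ℕ.NonZero d}} →
           m ℕ.* d ≡ n ℕ.* c → (m /ᵘ c) ≃ (n /ᵘ d)
    /ᵘ-≃ m n (suc c) (suc d) e =
      *≡* (≡.trans (≡.sym (ℤ.pos-* m (suc d))) (≡.trans (≡.cong +_ e) (ℤ.pos-* n (suc c))))

  /-≡ : ∀ m n c d .{{_ : ℕ.NonZero c}} .{{_ : ℕ.NonZero d}} →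
        m ℕ.* d ≡ n ℕ.* c → + m ℚ./ c ≡ + n ℚ./ d
  /-≡ m n c d e = ℚ.toℚᵘ-injective (ℚᵘ.≃-trans (toℚᵘ-/ m c)
    (ℚᵘ.≃-trans (/ᵘ-≃ m n c d e) (ℚᵘ.≃-sym (toℚᵘ-/ n d))))

  /-+ : ∀ m n d .{{_ : ℕ.NonZero d}} → (+ m ℚ./ d) ℚ.+ (+ n ℚ./ d) ≡ + (m ℕ.+ n) ℚ./ d
  /-+ m n d = ℚ.toℚᵘ-injective (ℚᵘ.≃-trans (ℚ.toℚᵘ-homo-+ (+ m ℚ./ d) (+ n ℚ./ d))
    (ℚᵘ.≃-trans (ℚᵘ.+-cong (toℚᵘ-/ m d) (toℚᵘ-/ n d))
      (ℚᵘ.≃-trans (/ᵘ-+ m n d) (ℚᵘ.≃-sym (toℚᵘ-/ (m ℕ.+ n) d)))))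

  /-* : ∀ m n c d .{{_ : ℕ.NonZero c}} .{{_ : ℕ.NonZero d}} →
        (+ m ℚ./ c) ℚ.* (+ n ℚ./ d) ≡ (+ (m ℕ.* n) ℚ./ (c ℕ.* d)) {{ℕ.m*n≢0 c d}}
  /-* m n c d = ℚ.toℚᵘ-injective (ℚᵘ.≃-trans (ℚ.toℚᵘ-homo-* (+ m ℚ./ c) (+ n ℚ./ d))
    (ℚᵘ.≃-trans (ℚᵘ.*-cong (toℚᵘ-/ m c) (toℚᵘ-/ n d))
      (ℚᵘ.≃-trans (/ᵘ-* m n c d)
        (ℚᵘ.≃-sym (toℚᵘ-/ (m ℕ.* n) (c ℕ.* d) {{ℕ.m*n≢0 c d}})))))

  ×-/ : ∀ n m d .{{_ : ℕ.NonZero d}} → n ×ℚ (+ m ℚ./ d) ≡ + (n ℕ.* m) ℚ./ d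
  ×-/ zero    m d = /-≡ 0 0 1 d ≡.refl
  ×-/ (suc n) m d = ≡.trans (≡.cong (λ q → (+ m ℚ./ d) ℚ.+ q) (×-/ n m d)) (/-+ m (n ℕ.* m) d)

  ×-1/ : ∀ n .{{_ : ℕ.NonZero n}} → n ×ℚ (+ 1 ℚ./ n) ≡ 1ℚ
  ×-1/ n = ≡.trans (×-/ n 1 n) (/-≡ (n ℕ.* 1) 1 n 1
    (≡.trans (ℕ.*-identityʳ (n ℕ.* 1)) (ℕ.*-comm n 1)))

  -- 1 / k!
  1/! : ℕ → ℚ
  1/! k = ((+ 1) ℚ./ (k !)) {{k ℕ.!≢0}}

  ×-1/! : ∀ k → suc k ×ℚ 1/! (suc k) ≡ 1/! k
  ×-1/! k = ≡.trans (×-/ (suc k) 1 (suc k !))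
    (/-≡ (suc k ℕ.* 1) 1 (suc k !) (k !)
      (≡.trans (≡.cong (ℕ._* k !) (ℕ.*-identityʳ (suc k))) (≡.sym (ℕ.*-identityˡ (suc k !)))))
    where instance
      _ = k ℕ.!≢0
      _ = suc k ℕ.!≢0

module ℚAlgebra {c ℓ} (R : Ring c ℓ) {ι : ℚ → Ring.Carrier R} (alg : IsℚAlgebra R ι) where

  open Ring R hiding (zero)
  open IsℚAlgebra alg public
  open SemiringMult semiring using ()
    renaming (_×_ to _·_; ×-assoc-* to ·-assoc-*; ×-comm-* to ·-comm-*)
  open RingProperties R using (x+x≈x⇒x≈0)
  open import Relation.Binary.Reasoning.Setoid setoid
  open Fractions

  -- Throughout, n · x is the n-fold sum of x.

  ι-0 : ι 0ℚ ≈ 0#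
  ι-0 = x+x≈x⇒x≈0 _ (sym (ι-+ 0ℚ 0ℚ))

  ι-· : ∀ n q → ι (n ×ℚ q) ≈ n · ι q
  ι-· zero    q = ι-0
  ι-· (suc n) q = trans (ι-+ _ _) (+-congˡ (ι-· n q))

  ·-cancel : ∀ n x y → suc n · x ≈ suc n · y → x ≈ y
  ·-cancel n x y e = trans (sym (inverse x)) (trans (*-congˡ e) (inverse y))
    where
    inverse : ∀ x → ι (+ 1 ℚ./ suc n) * (suc n · x) ≈ x
    inverse x = begin
      ι (+ 1 ℚ./ suc n) * (suc n · x)   ≈⟨ ·-comm-* (suc n) _ x ⟩
      suc n · (ι (+ 1 ℚ./ suc n) * x)   ≈⟨ ·-assoc-* (suc n) _ x ⟨
      (suc n · ι (+ 1 ℚ./ suc n)) * x   ≈⟨ *-congʳ (ι-· (suc n) (+ 1 ℚ./ suc n)) ⟨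
      ι (suc n ×ℚ (+ 1 ℚ./ suc n)) * x  ≡⟨ ≡.cong (λ q → ι q * x) (×-1/ (suc n)) ⟩
      ι 1ℚ * x                          ≈⟨ *-congʳ ι-1 ⟩
      1# * x                            ≈⟨ *-identityˡ x ⟩
      x                                 ∎

  ·-ι-1/! : ∀ k → suc k · ι (1/! (suc k)) ≈ ι (1/! k)
  ·-ι-1/! k = trans (sym (ι-· (suc k) (1/! (suc k)))) (reflexive (≡.cong ι (×-1/! k)))

-- Products of power series

module SeriesProperties {c ℓ} (R : Ring c ℓ) where

  open Ring R hiding (zero)
  open PowerSeries R
  open Convolution R
  open SemiringExp (Ring.semiring seriesRing) using (_^_)
  open import Relation.Binary.Reasoning.Setoid setoid

  constant-*ˢ : ∀ a f n → (constant a *ˢ f) n ≈ a * f n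
  constant-*ˢ a f zero    = refl
  constant-*ˢ a f (suc n) = begin
    a * f (suc n) + ((λ _ → 0#) *ˢ f) n
      ≡⟨ ≡.cong (λ y → a * f (suc n) + y) (*ˢ-conv _ f n) ⟩
    a * f (suc n) + conv (λ _ j → 0# * f j) n      ≈⟨ +-congˡ (conv-zero n λ _ _ _ → zeroˡ _) ⟩
    a * f (suc n) + 0#                             ≈⟨ +-identityʳ _ ⟩
    a * f (suc n)                                  ∎

  *ˢ-constant : ∀ f a n → (f *ˢ constant a) n ≈ f n * a
  *ˢ-constant f a zero    = refl
  *ˢ-constant f a (suc n) =
    trans (+-cong (zeroʳ _) (*ˢ-constant (f ∘ suc) a n)) (+-identityˡ _)

  -- The coefficient of x^n in a product depends on coefficients up to x^n only.
  *ˢ-cong-≤ : ∀ {f f′ g g′} n → (∀ m → m ℕ.≤ n → f m ≈ f′ m) → (∀ m → m ℕ.≤ n → g m ≈ g′ m) →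
              (f *ˢ g) n ≈ (f′ *ˢ g′) n
  *ˢ-cong-≤ {f} {f′} {g} {g′} n e e′ = begin
    (f *ˢ g) n                   ≡⟨ *ˢ-conv f g n ⟩
    conv (λ i j → f i * g j) n
      ≈⟨ conv-cong n (λ i j i+j≡n → *-cong (e i (ℕ.m+n≤o⇒m≤o i (ℕ.≤-reflexive i+j≡n)))
                                           (e′ j (ℕ.m+n≤o⇒n≤o i (ℕ.≤-reflexive i+j≡n)))) ⟩
    conv (λ i j → f′ i * g′ j) n  ≡⟨ *ˢ-conv f′ g′ n ⟨
    (f′ *ˢ g′) n                 ∎

  -- The k-th power of a series without constant term has no terms below x^k.
  ^-order : ∀ {f} → f 0 ≈ 0# → ∀ k n → n ℕ.< k → (f ^ k) n ≈ 0#
  ^-order {f} f₀≈0 (suc k) n (s≤s n≤k) =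
    trans (reflexive (*ˢ-conv f (f ^ k) n)) (conv-zero n λ where
      zero    j _      → trans (*-congʳ f₀≈0) (zeroˡ _)
      (suc i) j ≡.refl → trans (*-congˡ (^-order f₀≈0 k j (ℕ.≤-trans (s≤s (ℕ.m≤n+m j i)) n≤k)))
                               (zeroʳ _))

  -- All coefficients of f commute with all coefficients of g.
  Commuting : Series → Series → Set ℓ
  Commuting f g = ∀ i j → f i * g j ≈ g j * f i

  *ˢ-comm : ∀ {f g} → Commuting f g → (f *ˢ g) ≈ˢ (g *ˢ f)
  *ˢ-comm {f} {g} fg n = begin
    (f *ˢ g) n                  ≡⟨ *ˢ-conv f g n ⟩
    conv (λ i j → f i * g j) n  ≈⟨ conv-flip _ n ⟨
    conv (λ i j → f j * g i) n  ≈⟨ conv-cong n (λ i j _ → fg j i) ⟩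
    conv (λ i j → g i * f j) n  ≡⟨ *ˢ-conv g f n ⟨
    (g *ˢ f) n                  ∎

  -- diagonal φ i j is the coefficient of x^i y^j in φ(xy).
  diagonal : Series → ℕ → Series
  diagonal φ zero    zero    = φ 0
  diagonal φ (suc i) (suc j) = diagonal (φ ∘ suc) i j
  diagonal φ zero    (suc j) = 0#
  diagonal φ (suc i) zero    = 0#

  diagonal-≡ : ∀ φ i → diagonal φ i i ≡ φ i
  diagonal-≡ φ zero    = ≡.refl
  diagonal-≡ φ (suc i) = diagonal-≡ (φ ∘ suc) i

  diagonal-≢ : ∀ φ i j → ¬ (i ≡ j) → diagonal φ i j ≡ 0#
  diagonal-≢ φ zero    zero    i≢j = contradiction ≡.refl i≢j
  diagonal-≢ φ zero    (suc j) i≢j = ≡.refl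
  diagonal-≢ φ (suc i) zero    i≢j = ≡.refl
  diagonal-≢ φ (suc i) (suc j) i≢j = diagonal-≢ (φ ∘ suc) i j (i≢j ∘ ≡.cong suc)

  diagonal-scale : ∀ (x : ℕ → ℕ → Carrier) φ → (∀ i → x i i ≈ φ i) →
                   ∀ i j → x i j * diagonal (λ _ → 1#) i j ≈ diagonal φ i j
  diagonal-scale x φ e zero    zero    = trans (*-identityʳ _) (e 0)
  diagonal-scale x φ e zero    (suc j) = zeroʳ _
  diagonal-scale x φ e (suc i) zero    = zeroʳ _
  diagonal-scale x φ e (suc i) (suc j) =
    diagonal-scale (λ i j → x (suc i) (suc j)) (φ ∘ suc) (e ∘ suc) i j

module _ {c ℓ} (R : Ring c ℓ) {ι : ℚ → Ring.Carrier R} (alg : IsℚAlgebra R ι) where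

  open Ring R hiding (zero)
  open PowerSeries R
  open SeriesProperties R
  open IsℚAlgebra alg

  series-ℚAlgebra : IsℚAlgebra seriesRing (constant ∘ ι)
  series-ℚAlgebra = record
    { ι-+     = λ { p q zero → ι-+ p q ; p q (suc n) → sym (+-identityˡ 0#) }
    ; ι-*     = λ { p q zero → ι-* p q
                  ; p q (suc n) → sym (trans (constant-*ˢ _ _ (suc n)) (zeroʳ _)) }
    ; ι-1     = λ { zero → ι-1 ; (suc n) → refl }
    ; central = λ q f n → trans (constant-*ˢ _ f n)
                            (trans (central q (f n)) (sym (*ˢ-constant f _ n))) }

-- Derivations and exponentials

record IsDerivation {c ℓ} (R : Ring c ℓ) (D : Ring.Carrier R → Ring.Carrier R) : Set (c ⊔ ℓ) where
  open Ring R hiding (zero)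
  field
    D-cong : ∀ {x y} → x ≈ y → D x ≈ D y
    D-+    : ∀ x y → D (x + y) ≈ D x + D y
    D-*    : ∀ x y → D (x * y) ≈ D x * y + x * D y

  open RingProperties R using (x+x≈x⇒x≈0)
  open SemiringMult semiring using () renaming (_×_ to _·_)

  D-0 : D 0# ≈ 0#
  D-0 = x+x≈x⇒x≈0 _ (trans (sym (D-+ 0# 0#)) (D-cong (+-identityˡ 0#)))

  D-1 : D 1# ≈ 0#
  D-1 = x+x≈x⇒x≈0 _ (sym (trans (D-cong (sym (*-identityˡ 1#)))
          (trans (D-* 1# 1#) (+-cong (*-identityʳ _) (*-identityˡ _)))))

  -- D Y = 0 expresses that Y is constant for D, so X Y solves the same linear
  -- equation as X.
  D-solution : ∀ {X c Y} → D X ≈ c * X → D Y ≈ 0# → D (X * Y) ≈ c * (X * Y)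
  D-solution {X} {c} {Y} DX DY = begin
    D (X * Y)              ≈⟨ D-* X Y ⟩
    D X * Y + X * D Y      ≈⟨ +-cong (*-congʳ DX) (*-congˡ DY) ⟩
    c * X * Y + X * 0#     ≈⟨ +-cong (*-assoc c X Y) (zeroʳ X) ⟩
    c * (X * Y) + 0#       ≈⟨ +-identityʳ _ ⟩
    c * (X * Y)            ∎
    where open import Relation.Binary.Reasoning.Setoid setoid

  D-· : ∀ n x → D (n · x) ≈ n · D x
  D-· zero    x = D-0
  D-· (suc n) x = trans (D-+ _ _) (+-congˡ (D-· n x))

module Exponentials {c ℓ} (R : Ring c ℓ) {ι : ℚ → Ring.Carrier R} (alg : IsℚAlgebra R ι) where

  open Ring R hiding (zero)
  open ℚAlgebra R alg
  open Convolution R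
  open Fractions using (1/!)
  open SemiringExp semiring using (_^_)
  open SemiringMult semiring using ()
    renaming (_×_ to _·_; ×-congʳ to ·-congʳ; ×-assoc-* to ·-assoc-*; ×-comm-* to ·-comm-*)
  open import Relation.Binary.Reasoning.Setoid setoid

  -- The divided power x^k / k!
  _^[_] : Carrier → ℕ → Carrier
  x ^[ k ] = ι (1/! k) * x ^ k

  -- exp≤ N x = ∑_{k ≤ N} x^k / k!
  exp≤ : ℕ → Carrier → Carrier
  exp≤ N x = ∑< (suc N) (x ^[_])

  ^[0]≈1 : ∀ x → x ^[ 0 ] ≈ 1#
  ^[0]≈1 x = trans (*-identityʳ _) ι-1

  module _ {D : Carrier → Carrier} (der : IsDerivation R D) where
    open IsDerivation der

    -- Derivations kill 1 / k!, because they kill 1 = k! (1 / k!).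
    D-ι-1/! : ∀ k → D (ι (1/! k)) ≈ 0#
    D-ι-1/! zero    = trans (D-cong ι-1) D-1
    D-ι-1/! (suc k) = ·-cancel k _ _ (begin
      suc k · D (ι (1/! (suc k)))  ≈⟨ D-· (suc k) _ ⟨
      D (suc k · ι (1/! (suc k)))  ≈⟨ D-cong (·-ι-1/! k) ⟩
      D (ι (1/! k))                ≈⟨ D-ι-1/! k ⟩
      0#                           ≈⟨ trans (sym (zeroˡ _)) (·-comm-* (suc k) 0# 0#) ⟩
      suc k · (0# * 0#)            ≈⟨ ·-congʳ (suc k) (zeroʳ 0#) ⟩
      suc k · 0#                   ∎)

    module _ {x : Carrier} (comm : D x * x ≈ x * D x) where

      D-^ : ∀ k → D (x ^ suc k) ≈ suc k · (D x * x ^ k)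
      D-^ zero = begin
        D (x * 1#)              ≈⟨ D-* x 1# ⟩
        D x * 1# + x * D 1#     ≈⟨ +-congˡ (trans (*-congˡ D-1) (zeroʳ x)) ⟩
        D x * 1# + 0#           ∎
      D-^ (suc k) = begin
        D (x * x ^ suc k)                         ≈⟨ D-* x (x ^ suc k) ⟩
        D x * x ^ suc k + x * D (x ^ suc k)       ≈⟨ +-congˡ (*-congˡ (D-^ k)) ⟩
        D x * x ^ suc k + x * (suc k · (D x * x ^ k))
          ≈⟨ +-congˡ (·-comm-* (suc k) x _) ⟩
        D x * x ^ suc k + suc k · (x * (D x * x ^ k))
          ≈⟨ +-congˡ (·-congʳ (suc k) (begin
               x * (D x * x ^ k)  ≈⟨ *-assoc _ _ _ ⟨
               x * D x * x ^ k    ≈⟨ *-congʳ comm ⟨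
               D x * x * x ^ k    ≈⟨ *-assoc _ _ _ ⟩
               D x * x ^ suc k    ∎)) ⟩
        D x * x ^ suc k + suc k · (D x * x ^ suc k) ∎

      D-^[] : ∀ k → D (x ^[ suc k ]) ≈ D x * x ^[ k ]
      D-^[] k = begin
        D (a * x ^ suc k)                     ≈⟨ D-* a (x ^ suc k) ⟩
        D a * x ^ suc k + a * D (x ^ suc k)
          ≈⟨ +-cong (trans (*-congʳ (D-ι-1/! (suc k))) (zeroˡ _)) (*-congˡ (D-^ k)) ⟩
        0# + a * (suc k · (D x * x ^ k))      ≈⟨ +-identityˡ _ ⟩
        a * (suc k · (D x * x ^ k))           ≈⟨ ·-comm-* (suc k) a _ ⟩
        suc k · (a * (D x * x ^ k))           ≈⟨ ·-assoc-* (suc k) a _ ⟨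
        (suc k · a) * (D x * x ^ k)           ≈⟨ *-congʳ (·-ι-1/! k) ⟩
        ι (1/! k) * (D x * x ^ k)             ≈⟨ *-assoc _ _ _ ⟨
        ι (1/! k) * D x * x ^ k               ≈⟨ *-congʳ (central _ _) ⟩
        D x * ι (1/! k) * x ^ k               ≈⟨ *-assoc _ _ _ ⟩
        D x * x ^[ k ]                        ∎
        where a = ι (1/! (suc k))

      -- The chain rule D (e^x) = D x e^x, exact at the level of truncations
      D-exp≤ : ∀ N → D (exp≤ (suc N) x) ≈ D x * exp≤ N x
      D-exp≤ N = begin
        D (x ^[ 0 ] + ∑< (suc N) (λ k → x ^[ suc k ]))
          ≈⟨ D-+ _ _ ⟩
        D (x ^[ 0 ]) + D (∑< (suc N) (λ k → x ^[ suc k ]))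
          ≈⟨ +-cong (trans (D-cong (^[0]≈1 x)) D-1)
                    (∑<-map R R D D-0 D-+ (λ k → x ^[ suc k ]) (suc N)) ⟩
        0# + ∑< (suc N) (λ k → D (x ^[ suc k ]))
          ≈⟨ trans (+-identityˡ _) (∑<-cong (suc N) D-^[]) ⟩
        ∑< (suc N) (λ k → D x * x ^[ k ])
          ≈⟨ ∑<-map R R (D x *_) (zeroʳ _) (distribˡ _) (x ^[_]) (suc N) ⟨
        D x * exp≤ N x ∎

-- A derivation of R[[x]] that acts on the coefficient of x^n by δ n
record IsGradedDerivation {c ℓ} (R : Ring c ℓ) (δ : ℕ → Ring.Carrier R → Ring.Carrier R) :
       Set (c ⊔ ℓ) where
  open Ring R hiding (zero)
  field
    δ-cong : ∀ n {x y} → x ≈ y → δ n x ≈ δ n y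
    δ-+    : ∀ n x y → δ n (x + y) ≈ δ n x + δ n y
    δ-*    : ∀ i j x y → δ (i ℕ.+ j) (x * y) ≈ δ i x * y + x * δ j y

  open PowerSeries R
  open Convolution R
  open import Relation.Binary.Reasoning.Setoid setoid

  derive : Series → Series
  derive f n = δ n (f n)

  derive-* : ∀ f g → derive (f *ˢ g) ≈ˢ ((derive f *ˢ g) +ˢ (f *ˢ derive g))
  derive-* f g n = begin
    δ n ((f *ˢ g) n)                          ≡⟨ ≡.cong (δ n) (*ˢ-conv f g n) ⟩
    δ n (conv (λ i j → f i * g j) n)          ≈⟨ conv-map R R (δ n) (δ-+ n) _ n ⟩
    conv (λ i j → δ n (f i * g j)) n
      ≈⟨ conv-cong n (λ { i j ≡.refl → δ-* i j (f i) (g j) }) ⟩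
    conv (λ i j → δ i (f i) * g j + f i * δ j (g j)) n
      ≈⟨ conv-+ _ _ n ⟩
    conv (λ i j → δ i (f i) * g j) n + conv (λ i j → f i * δ j (g j)) n
      ≡⟨ ≡.cong₂ _+_ (*ˢ-conv (derive f) g n) (*ˢ-conv f (derive g) n) ⟨
    (derive f *ˢ g) n + (f *ˢ derive g) n     ∎

  isDerivation : IsDerivation seriesRing derive
  isDerivation = record
    { D-cong = λ e n → δ-cong n (e n)
    ; D-+    = λ f g n → δ-+ n (f n) (g n)
    ; D-*    = derive-* }

-- Exponentials of power series, and the equation X' = f X in Euler form

module SeriesExponential {c ℓ} (R : Ring c ℓ) {ι : ℚ → Ring.Carrier R} (alg : IsℚAlgebra R ι) where

  open Ring R hiding (zero)
  open PowerSeries R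
  open Convolution R
  open SeriesProperties R
  open Fractions using (1/!)
  open ℚAlgebra R alg
  open Exponential R ι using (exp)
  open Exponentials seriesRing (series-ℚAlgebra R alg) public
  open SemiringExp (Ring.semiring seriesRing) using (_^_)
  open SemiringMult semiring using ()
    renaming (_×_ to _·_; ×-congʳ to ·-congʳ; ×-assoc-* to ·-assoc-*; ×-comm-* to ·-comm-*
             ; ×-homo-+ to ·-homo-+)
  open CommutativeMonoidMult +-commutativeMonoid using () renaming (×-distrib-+ to ·-distrib-+)
  open import Relation.Binary.Reasoning.Setoid setoid

  ^[]-at : ∀ f k n → (f ^[ k ]) n ≈ ι (1/! k) * (f ^ k) n
  ^[]-at f k n = constant-*ˢ (ι (1/! k)) (f ^ k) n

  exp≤-at : ∀ N f n → exp≤ N f n ≈ ∑< (suc N) (λ k → (f ^[ k ]) n)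
  exp≤-at N f n = ∑<-map seriesRing R (λ g → g n) refl (λ _ _ → refl) (f ^[_]) (suc N)

  exp≤-stable : ∀ {f} → f 0 ≈ 0# → ∀ {N n} → n ℕ.≤ N → exp≤ N f n ≈ exp f n
  exp≤-stable {f} f₀≈0 {N} {n} n≤N = begin
    exp≤ N f n                            ≈⟨ exp≤-at N f n ⟩
    ∑< (suc N) (λ k → (f ^[ k ]) n)
      ≈⟨ ∑<-truncate _ (suc n) (s≤s n≤N) (λ k n<k → trans (^[]-at f k n)
           (trans (*-congˡ (^-order f₀≈0 k n n<k)) (zeroʳ _))) ⟩
    ∑< (suc n) (λ k → (f ^[ k ]) n)       ≈⟨ exp≤-at n f n ⟨
    exp f n                               ∎

  exp-0 : ∀ f → exp f 0 ≈ 1#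
  exp-0 f = trans (+-identityʳ _) (^[0]≈1 f 0)

  -- D (e^f) = D f e^f if the coefficients of D f commute with those of f
  derive-exp : ∀ {δ} (der : IsGradedDerivation R δ) {f} → f 0 ≈ 0# →
               Commuting (IsGradedDerivation.derive der f) f →
               IsGradedDerivation.derive der (exp f) ≈ˢ (IsGradedDerivation.derive der f *ˢ exp f)
  derive-exp {δ} der {f} f₀≈0 comm n = begin
    δ n (exp f n)                  ≈⟨ δ-cong n (exp≤-stable f₀≈0 (ℕ.n≤1+n n)) ⟨
    derive (exp≤ (suc n) f) n      ≈⟨ D-exp≤ isDerivation (*ˢ-comm comm) n n ⟩
    (derive f *ˢ exp≤ n f) n       ≈⟨ *ˢ-cong-≤ n (λ _ _ → refl) (λ m m≤n → exp≤-stable f₀≈0 m≤n) ⟩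
    (derive f *ˢ exp f) n          ∎
    where open IsGradedDerivation der

  -- The Euler derivation θ = x d/dx
  θ-graded : IsGradedDerivation R _·_
  θ-graded = record
    { δ-cong = ·-congʳ
    ; δ-+    = λ n x y → ·-distrib-+ x y n
    ; δ-*    = λ i j x y → begin
        (i ℕ.+ j) · (x * y)            ≈⟨ ·-homo-+ (x * y) i j ⟩
        i · (x * y) + j · (x * y)      ≈⟨ +-cong (·-assoc-* i x y) (·-comm-* j x y) ⟨
        (i · x) * y + x * (j · y)      ∎ }

  open IsGradedDerivation θ-graded public using ()
    renaming (derive to θ; isDerivation to θ-isDerivation; derive-* to θ-*)

  θ-constant : ∀ a n → θ (constant a) n ≈ 0#
  θ-constant a zero    = refl
  θ-constant a (suc n) = trans (+-congˡ (·-0 n)) (+-identityˡ 0#)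
    where
    ·-0 : ∀ n → n · 0# ≈ 0#
    ·-0 zero    = refl
    ·-0 (suc n) = trans (+-identityˡ _) (·-0 n)

  θ-exp : ∀ {f} → f 0 ≈ 0# → Commuting f f → θ (exp f) ≈ˢ (θ f *ˢ exp f)
  θ-exp {f} f₀≈0 comm = derive-exp θ-graded f₀≈0 λ i j → begin
    (i · f i) * f j  ≈⟨ ·-assoc-* i _ _ ⟩
    i · (f i * f j)  ≈⟨ ·-congʳ i (comm i j) ⟩
    i · (f j * f i)  ≈⟨ ·-comm-* i _ _ ⟨
    f j * (i · f i)  ∎

  -- A solution of θ X = f X is determined by its constant term: the coefficient of
  -- x^n expresses n X_n through the X_m with m < n, and n is invertible for n > 0.
  θ-unique : ∀ {f X Y} → f 0 ≈ 0# → θ X ≈ˢ (f *ˢ X) → θ Y ≈ˢ (f *ˢ Y) → X 0 ≈ Y 0 → X ≈ˢ Y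
  θ-unique {f} {X} {Y} f₀≈0 θX θY X₀≈Y₀ n = below n n ℕ.≤-refl
    where
    below : ∀ n m → m ℕ.≤ n → X m ≈ Y m
    below n       zero    _         = X₀≈Y₀
    below (suc n) (suc m) (s≤s m≤n) = ·-cancel m _ _ (begin
      suc m · X (suc m)                          ≈⟨ θX (suc m) ⟩
      f 0 * X (suc m) + ((f ∘ suc) *ˢ X) m
        ≈⟨ +-cong (vanish (X (suc m)) (Y (suc m)))
                  (*ˢ-cong-≤ m (λ _ _ → refl) (λ i i≤m → below n i (ℕ.≤-trans i≤m m≤n))) ⟩
      f 0 * Y (suc m) + ((f ∘ suc) *ˢ Y) m       ≈⟨ θY (suc m) ⟨
      suc m · Y (suc m)                          ∎)
      where
      vanish : ∀ a b → f 0 * a ≈ f 0 * b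
      vanish a b = trans (trans (*-congʳ f₀≈0) (zeroˡ a))
                         (sym (trans (*-congʳ f₀≈0) (zeroˡ b)))

-- Exponentials of power series in two variables

-- As in the definition of exp₂, R[[x, y]] is R[[y]][[x]]: the subscript 1 marks
-- series in y over R, and 2 marks series in x over R[[y]].

module SeriesExponential₂ {c ℓ} (R : Ring c ℓ) {ι : ℚ → Ring.Carrier R} (alg : IsℚAlgebra R ι) where

  open Ring R hiding (zero)
  open PowerSeries R
  open Convolution R
  open SeriesProperties R
  open Fractions using (1/!)
  open Exponential R ι using (exp; exp₂; inX; inY; Series₂; _+₂_)
  open SemiringMult semiring using ()
    renaming (_×_ to _·_; ×-congʳ to ·-congʳ; ×-comm-* to ·-comm-*; ×-assoc-* to ·-assoc-*)
  open SemiringExp (Ring.semiring seriesRing) using (_^_)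
  open import Relation.Binary.Reasoning.Setoid setoid
  private
    R₁ = seriesRing
    module R₁ = Ring seriesRing
    module C₁ = Convolution seriesRing
    module L₁ = SeriesProperties seriesRing
    module P₂ = PowerSeries seriesRing
    module R₂ = Ring P₂.seriesRing
    module E₁ = SeriesExponential R alg
    module E₂ = SeriesExponential seriesRing (series-ℚAlgebra R alg)
    module θ₂ = IsDerivation E₂.θ-isDerivation
    module M₁ = SemiringMult (Ring.semiring seriesRing)
    open SemiringExp R₂.semiring using () renaming (_^_ to _^₂_)

  *₂-at : ∀ (f g : Series₂) i j → (f P₂.*ˢ g) i j ≈ conv (λ i₁ i₂ → (f i₁ *ˢ g i₂) j) i
  *₂-at f g i j = begin
    (f P₂.*ˢ g) i j                            ≡⟨ ≡.cong (λ h → h j) (C₁.*ˢ-conv f g i) ⟩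
    C₁.conv (λ i₁ i₂ → f i₁ *ˢ g i₂) i j       ≈⟨ conv-map R₁ R (λ h → h j) (λ _ _ → refl) _ i ⟩
    conv (λ i₁ i₂ → (f i₁ *ˢ g i₂) j) i        ∎

  -- Only the coefficients of total degree at most i + j matter.
  *₂-cong-≤ : ∀ (f : Series₂) {g g′ : Series₂} i j →
              (∀ i′ j′ → i′ ℕ.+ j′ ℕ.≤ i ℕ.+ j → g i′ j′ ≈ g′ i′ j′) →
              (f P₂.*ˢ g) i j ≈ (f P₂.*ˢ g′) i j
  *₂-cong-≤ f {g} {g′} i j e = begin
    (f P₂.*ˢ g) i j                         ≈⟨ *₂-at f g i j ⟩
    conv (λ i₁ i₂ → (f i₁ *ˢ g i₂) j) i
      ≈⟨ conv-cong i (λ i₁ i₂ i₁+i₂≡i → *ˢ-cong-≤ j (λ _ _ → refl) λ j′ j′≤j →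
           e i₂ j′ (ℕ.+-mono-≤ (ℕ.m+n≤o⇒n≤o i₁ (ℕ.≤-reflexive i₁+i₂≡i)) j′≤j)) ⟩
    conv (λ i₁ i₂ → (f i₁ *ˢ g′ i₂) j) i    ≈⟨ *₂-at f g′ i j ⟨
    (f P₂.*ˢ g′) i j                        ∎

  -- The k-th power of a series without constant term has no terms of total degree
  -- below k.
  ^₂-order : ∀ (h : Series₂) → h 0 0 ≈ 0# → ∀ k i j → i ℕ.+ j ℕ.< k → (h ^₂ k) i j ≈ 0#
  ^₂-order h h₀₀≈0 (suc k) i j (s≤s i+j≤k) =
    trans (*₂-at h (h ^₂ k) i j) (conv-zero i λ i₁ i₂ i₁+i₂≡i →
      trans (reflexive (*ˢ-conv (h i₁) ((h ^₂ k) i₂) j)) (conv-zero j λ j₁ j₂ j₁+j₂≡j →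
        vanish i₁ i₂ j₁ j₂ (≡.cong₂ ℕ._+_ i₁+i₂≡i j₁+j₂≡j)))
    where
    smaller : ∀ i₁ i₂ j₁ j₂ → (i₁ ℕ.+ i₂) ℕ.+ (j₁ ℕ.+ j₂) ≡ i ℕ.+ j →
              0 ℕ.< i₁ ℕ.+ j₁ → i₂ ℕ.+ j₂ ℕ.< k
    smaller i₁ i₂ j₁ j₂ e 0<i₁+j₁ = ℕ.≤-trans
      (ℕ.≤-trans (ℕ.+-monoˡ-≤ (i₂ ℕ.+ j₂) 0<i₁+j₁)
        (ℕ.≤-reflexive (≡.trans (ℕ+.interchange i₁ j₁ i₂ j₂) e))) i+j≤k
      where module ℕ+ = CommutativeSemigroupProperties ℕ.+-commutativeSemigroup

    vanish : ∀ i₁ i₂ j₁ j₂ → (i₁ ℕ.+ i₂) ℕ.+ (j₁ ℕ.+ j₂) ≡ i ℕ.+ j →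
             h i₁ j₁ * (h ^₂ k) i₂ j₂ ≈ 0#
    vanish zero     i₂ zero     j₂ e = trans (*-congʳ h₀₀≈0) (zeroˡ _)
    vanish zero     i₂ (suc j₁) j₂ e = trans (*-congˡ (^₂-order h h₀₀≈0 k i₂ j₂
      (smaller zero i₂ (suc j₁) j₂ e (s≤s z≤n)))) (zeroʳ _)
    vanish (suc i₁) i₂ j₁       j₂ e = trans (*-congˡ (^₂-order h h₀₀≈0 k i₂ j₂
      (smaller (suc i₁) i₂ j₁ j₂ e (s≤s z≤n)))) (zeroʳ _)

  exp≤-stable₂ : ∀ (h : Series₂) → h 0 0 ≈ 0# → ∀ {N} i j → i ℕ.+ j ℕ.≤ N →
                 E₂.exp≤ N h i j ≈ exp₂ h i j
  exp≤-stable₂ h h₀₀≈0 {N} i j i+j≤N = begin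
    E₂.exp≤ N h i j                               ≈⟨ at N ⟩
    ∑< (suc N) (λ k → (h E₂.^[ k ]) i j)
      ≈⟨ ∑<-truncate _ (suc (i ℕ.+ j)) (s≤s i+j≤N) (λ k i+j<k →
           trans (E₂.^[]-at h k i j) (trans (constant-*ˢ (ι (1/! k)) ((h ^₂ k) i) j)
             (trans (*-congˡ (^₂-order h h₀₀≈0 k i j i+j<k)) (zeroʳ _)))) ⟩
    ∑< (suc (i ℕ.+ j)) (λ k → (h E₂.^[ k ]) i j)  ≈⟨ at (i ℕ.+ j) ⟨
    exp₂ h i j                                    ∎
    where
    at : ∀ N → E₂.exp≤ N h i j ≈ ∑< (suc N) (λ k → (h E₂.^[ k ]) i j)
    at N = ∑<-map P₂.seriesRing R (λ g → g i j) refl (λ _ _ → refl) (h E₂.^[_]) (suc N)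

  ·-at : ∀ n f j → (n M₁.× f) j ≈ n · f j
  ·-at zero    f j = refl
  ·-at (suc n) f j = +-congˡ (·-at n f j)

  θ-exp₂ : ∀ h → h 0 0 ≈ 0# → (E₂.θ h P₂.*ˢ h) P₂.≈ˢ (h P₂.*ˢ E₂.θ h) →
           E₂.θ (exp₂ h) P₂.≈ˢ (E₂.θ h P₂.*ˢ exp₂ h)
  θ-exp₂ h h₀₀≈0 comm i j = begin
    (i M₁.× exp₂ h i) j                        ≈⟨ ·-at i (exp₂ h i) j ⟩
    i · exp₂ h i j                             ≈⟨ ·-congʳ i (exp≤-stable₂ h h₀₀≈0 i j (ℕ.n≤1+n _)) ⟨
    i · E₂.exp≤ (suc (i ℕ.+ j)) h i j          ≈⟨ ·-at i (E₂.exp≤ (suc (i ℕ.+ j)) h i) j ⟨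
    E₂.θ (E₂.exp≤ (suc (i ℕ.+ j)) h) i j       ≈⟨ E₂.D-exp≤ E₂.θ-isDerivation comm (i ℕ.+ j) i j ⟩
    (E₂.θ h P₂.*ˢ E₂.exp≤ (i ℕ.+ j) h) i j
      ≈⟨ *₂-cong-≤ (E₂.θ h) i j (λ i′ j′ → exp≤-stable₂ h h₀₀≈0 i′ j′) ⟩
    (E₂.θ h P₂.*ˢ exp₂ h) i j                  ∎

  constant-cong : ∀ {a b} → a ≈ b → constant a ≈ˢ constant b
  constant-cong e zero    = e
  constant-cong e (suc n) = refl

  constant-+ : ∀ a b → constant (a + b) ≈ˢ (constant a +ˢ constant b)
  constant-+ a b zero    = refl
  constant-+ a b (suc n) = sym (+-identityˡ 0#)

  constant-* : ∀ a b → constant (a * b) ≈ˢ (constant a *ˢ constant b)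
  constant-* a b n = sym (trans (*ˢ-constant (constant a) b n) (at n))
    where
    at : ∀ n → constant a n * b ≈ constant (a * b) n
    at zero    = refl
    at (suc n) = zeroˡ b

  constant-· : ∀ n a → constant (n · a) ≈ˢ (n M₁.× constant a)
  constant-· zero    a zero    = refl
  constant-· zero    a (suc j) = refl
  constant-· (suc n) a j = trans (constant-+ a (n · a) j) (+-congˡ (constant-· n a j))

  inX-* : ∀ f g → inX (f *ˢ g) P₂.≈ˢ (inX f P₂.*ˢ inX g)
  inX-* f g i = R₁.trans (constant-cong (reflexive (*ˢ-conv f g i)))
    (R₁.trans (conv-map R R₁ constant constant-+ _ i)
      (R₁.trans (C₁.conv-cong i (λ k l _ → constant-* (f k) (g l)))
        (R₁.reflexive (≡.sym (C₁.*ˢ-conv (inX f) (inX g) i)))))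

  θ-inX : ∀ f → E₂.θ (inX f) P₂.≈ˢ inX (E₁.θ f)
  θ-inX f i j = sym (constant-· i (f i) j)

  module _ {f g : Series} (f₀≈0 : f 0 ≈ 0#) (g₀≈0 : g 0 ≈ 0#)
           (ff : Commuting f f) (fg : Commuting f g) where

    private
      h : Series₂
      h = inX f +₂ inY g

      h₀≈g : h 0 ≈ˢ g
      h₀≈g n = trans (+-congʳ (zero-at n)) (+-identityˡ _)
        where
        zero-at : ∀ n → constant (f 0) n ≈ 0#
        zero-at zero    = f₀≈0
        zero-at (suc n) = refl

      θh : E₂.θ h P₂.≈ˢ inX (E₁.θ f)
      θh = R₂.trans {E₂.θ h} {E₂.θ (inX f) +₂ E₂.θ (inY g)} {inX (E₁.θ f)}
             (θ₂.D-+ (inX f) (inY g))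
             (λ i j → trans (+-cong (θ-inX f i j) (E₂.θ-constant g i j)) (+-identityʳ _))

      θf-f : Commuting (E₁.θ f) f
      θf-f i j = trans (·-assoc-* i _ _) (trans (·-congʳ i (ff i j)) (sym (·-comm-* i _ _)))

      θf-g : Commuting (E₁.θ f) g
      θf-g i j = trans (·-assoc-* i _ _) (trans (·-congʳ i (fg i j)) (sym (·-comm-* i _ _)))

      constant-comm : ∀ a s → (∀ j → a * s j ≈ s j * a) → (constant a *ˢ s) ≈ˢ (s *ˢ constant a)
      constant-comm a s e n = trans (constant-*ˢ a s n) (trans (e n) (sym (*ˢ-constant s a n)))

      -- θ (inX f) commutes with each h i, coefficientwise in y.
      θf-h : L₁.Commuting (inX (E₁.θ f)) h
      θf-h i k = constant-comm (E₁.θ f i) (h k) λ j → begin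
        E₁.θ f i * (constant (f k) j + inY g k j)
          ≈⟨ distribˡ _ _ _ ⟩
        E₁.θ f i * constant (f k) j + E₁.θ f i * inY g k j
          ≈⟨ +-cong (f-part i k j) (g-part i k j) ⟩
        constant (f k) j * E₁.θ f i + inY g k j * E₁.θ f i
          ≈⟨ distribʳ _ _ _ ⟨
        (constant (f k) j + inY g k j) * E₁.θ f i ∎
        where
        f-part : ∀ i k j → E₁.θ f i * constant (f k) j ≈ constant (f k) j * E₁.θ f i
        f-part i k zero    = θf-f i k
        f-part i k (suc j) = trans (zeroʳ _) (sym (zeroˡ _))
        g-part : ∀ i k j → E₁.θ f i * inY g k j ≈ inY g k j * E₁.θ f i
        g-part i zero    j = θf-g i j
        g-part i (suc k) j = trans (zeroʳ _) (sym (zeroˡ _))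

      θh-h : (E₂.θ h P₂.*ˢ h) P₂.≈ˢ (h P₂.*ˢ E₂.θ h)
      θh-h = R₂.trans {E₂.θ h P₂.*ˢ h} {inX (E₁.θ f) P₂.*ˢ h} {h P₂.*ˢ E₂.θ h}
        (R₂.*-cong {E₂.θ h} {inX (E₁.θ f)} {h} {h} θh (R₂.refl {h}))
        (R₂.trans {inX (E₁.θ f) P₂.*ˢ h} {h P₂.*ˢ inX (E₁.θ f)} {h P₂.*ˢ E₂.θ h}
          (L₁.*ˢ-comm θf-h)
          (R₂.*-cong {h} {h} {inX (E₁.θ f)} {E₂.θ h} (R₂.refl {h}) (R₂.sym {E₂.θ h} θh)))

      h₀₀≈0 : h 0 0 ≈ 0#
      h₀₀≈0 = trans (h₀≈g 0) g₀≈0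

      ^₂-at-0 : ∀ k → (h ^₂ k) 0 ≈ˢ (g ^ k)
      ^₂-at-0 zero    = R₁.refl
      ^₂-at-0 (suc k) = R₁.*-cong {h 0} {g} h₀≈g (^₂-at-0 k)

      exp₂-at-0 : exp₂ h 0 ≈ˢ exp g
      exp₂-at-0 j = begin
        E₂.exp≤ j h 0 j
          ≈⟨ ∑<-map P₂.seriesRing R₁ (λ s → s 0) R₁.refl (λ _ _ → R₁.refl) (h E₂.^[_]) (suc j) j ⟩
        C₁.∑< (suc j) (λ k → (h E₂.^[ k ]) 0) j
          ≈⟨ C₁.∑<-cong (suc j) (λ k → R₁.*-cong {constant (ι (1/! k))} R₁.refl (^₂-at-0 k)) j ⟩
        exp g j ∎

      -- e^{f(x)} times the value of e^{f(x) + g(y)} at x = 0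
      factored : Series₂
      factored = inX (exp f) P₂.*ˢ P₂.constant (exp₂ h 0)

      θ-factored : E₂.θ factored P₂.≈ˢ (inX (E₁.θ f) P₂.*ˢ factored)
      θ-factored = θ₂.D-solution {X = X} {c = inX (E₁.θ f)} {Y = Y} θX (E₂.θ-constant (exp₂ h 0))
        where
        X = inX (exp f)
        Y = P₂.constant (exp₂ h 0)
        θX : E₂.θ X P₂.≈ˢ (inX (E₁.θ f) P₂.*ˢ X)
        θX = R₂.trans {E₂.θ X} {inX (E₁.θ (exp f))} (θ-inX (exp f))
          (R₂.trans {inX (E₁.θ (exp f))} {inX (E₁.θ f *ˢ exp f)}
            (λ i → constant-cong (E₁.θ-exp f₀≈0 ff i)) (inX-* (E₁.θ f) (exp f)))

      θ-exp₂h : E₂.θ (exp₂ h) P₂.≈ˢ (inX (E₁.θ f) P₂.*ˢ exp₂ h)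
      θ-exp₂h = R₂.trans {E₂.θ (exp₂ h)} {E₂.θ h P₂.*ˢ exp₂ h} (θ-exp₂ h h₀₀≈0 θh-h)
                  (R₂.*-congʳ {exp₂ h} {E₂.θ h} {inX (E₁.θ f)} θh)

      constant-0 : constant (E₁.θ f 0) ≈ˢ R₁.0#
      constant-0 zero    = refl
      constant-0 (suc j) = refl

      constant-1 : constant (exp f 0) ≈ˢ R₁.1#
      constant-1 = constant-cong (E₁.exp-0 f)

    -- e^{f(x) + g(y)} = e^{f(x)} e^{g(y)}: both sides have logarithmic derivative
    -- θ f in the direction of x, and they agree at x = 0.
    exp₂-split : ∀ i j → exp₂ h i j ≈ exp f i * exp g j
    exp₂-split i j = begin
      exp₂ h i j                         ≈⟨ E₂.θ-unique {inX (E₁.θ f)} {exp₂ h} {factored}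
                                              constant-0 θ-exp₂h θ-factored
                                              (R₁.sym (R₁.trans (R₁.*-congʳ {exp₂ h 0} constant-1)
                                                                (R₁.*-identityˡ (exp₂ h 0)))) i j ⟩
      factored i j                       ≈⟨ L₁.*ˢ-constant (inX (exp f)) (exp₂ h 0) i j ⟩
      (constant (exp f i) *ˢ exp₂ h 0) j ≈⟨ constant-*ˢ (exp f i) (exp₂ h 0) j ⟩
      exp f i * exp₂ h 0 j               ≈⟨ *-congˡ (exp₂-at-0 j) ⟩
      exp f i * exp g j                  ∎

-- Commutation of exponentials

module Commutation {c ℓ} (R : Ring c ℓ) {ι : ℚ → Ring.Carrier R} (alg : IsℚAlgebra R ι) where

  open Ring R hiding (zero)
  open PowerSeries R
  open Convolution R
  open SeriesProperties R
  open SeriesExponential R alg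
  open Exponential R ι using (exp)
  open RingProperties R using (-‿+-comm; x[y-z]≈xy-xz; [y-z]x≈yx-zx)
  open SemiringMult semiring using ()
    renaming (_×_ to _·_; ×-congʳ to ·-congʳ; ×-comm-* to ·-comm-*; ×-assoc-* to ·-assoc-*)
  open CommutativeMonoidMult +-commutativeMonoid using () renaming (×-distrib-+ to ·-distrib-+)
  open import Relation.Binary.Reasoning.Setoid setoid
  private
    module +CS = CommutativeSemigroupProperties +-commutativeSemigroup
    module S = Ring seriesRing

  -- The derivation [b, -], applied to series coefficientwise; it does not depend on
  -- the degree n.
  ad : Carrier → ℕ → Carrier → Carrier
  ad b n x = b * x - x * b

  ad-graded : ∀ b → IsGradedDerivation R (ad b)
  ad-graded b = record
    { δ-cong = λ n e → +-cong (*-congˡ e) (-‿cong (*-congʳ e))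
    ; δ-+    = λ n x y → begin
        b * (x + y) - (x + y) * b
          ≈⟨ +-cong (distribˡ b x y) (-‿cong (distribʳ b x y)) ⟩
        (b * x + b * y) - (x * b + y * b)        ≈⟨ +-congˡ (-‿+-comm _ _) ⟨
        (b * x + b * y) + (- (x * b) - y * b)    ≈⟨ +CS.interchange _ _ _ _ ⟩
        (b * x - x * b) + (b * y - y * b)        ∎
    ; δ-*    = λ i j x y → begin
        b * (x * y) - (x * y) * b
          ≈⟨ +-cong (*-assoc b x y) (-‿cong (sym (*-assoc x y b))) ⟨
        b * x * y - x * (y * b)                  ≈⟨ +-congʳ (+-identityʳ _) ⟨
        (b * x * y + 0#) - x * (y * b)           ≈⟨ +-congʳ (+-congˡ (-‿inverseˡ (x * b * y))) ⟨
        (b * x * y + (- (x * b * y) + x * b * y)) - x * (y * b)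
          ≈⟨ trans (+-congʳ (sym (+-assoc _ _ _))) (+-assoc _ _ _) ⟩
        (b * x * y - x * b * y) + (x * b * y - x * (y * b))
          ≈⟨ +-cong (sym ([y-z]x≈yx-zx y _ _))
                    (trans (+-congʳ (*-assoc x b y)) (sym (x[y-z]≈xy-xz x _ _))) ⟩
        (b * x - x * b) * y + x * (b * y - y * b) ∎ }

  -- [b, e^a] = [b, a] e^a if [b, a] commutes with a.
  commute-exp : ∀ {b a ψ} → a 0 ≈ 0# → (∀ j → b * a j ≈ a j * b + ψ j) → Commuting ψ a →
                ∀ j → b * exp a j ≈ exp a j * b + (ψ *ˢ exp a) j
  commute-exp {b} {a} {ψ} a₀≈0 ba ψa j = begin
    b * exp a j                                       ≈⟨ split (b * exp a j) (exp a j * b) ⟩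
    exp a j * b + ad b j (exp a j)
      ≈⟨ +-congˡ (derive-exp (ad-graded b) a₀≈0 ada-a j) ⟩
    exp a j * b + (derive a *ˢ exp a) j               ≈⟨ +-congˡ (S.*-congʳ {exp a} ada j) ⟩
    exp a j * b + (ψ *ˢ exp a) j                      ∎
    where
    open IsGradedDerivation (ad-graded b) using (derive)
    split : ∀ x y → x ≈ y + (x - y)
    split x y = sym (trans (+-congˡ (+-comm x (- y))) (trans (sym (+-assoc _ _ _))
                  (trans (+-congʳ (-‿inverseʳ y)) (+-identityˡ x))))
    ada : derive a ≈ˢ ψ
    ada j = begin
      b * a j - a j * b               ≈⟨ +-congʳ (trans (ba j) (+-comm _ _)) ⟩
      (ψ j + a j * b) - a j * b       ≈⟨ +-assoc _ _ _ ⟩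
      ψ j + (a j * b - a j * b)       ≈⟨ +-congˡ (-‿inverseʳ _) ⟩
      ψ j + 0#                        ≈⟨ +-identityʳ _ ⟩
      ψ j                             ∎
    ada-a : Commuting (derive a) a
    ada-a i j = trans (*-congʳ (ada i)) (trans (ψa i j) (*-congˡ (sym (ada i))))

  Central : Series → Set (c ⊔ ℓ)
  Central f = ∀ n x → f n * x ≈ x * f n

  -- Let [b i, α m] = φ i α (m - i), and let F = e^φ have central coefficients.  Then
  -- e^b α m = (∑_k F k α (m - k) x^k) e^b.  Indeed both sides X satisfy
  -- θ X = θ b X with X 0 = α m; for the right-hand side this holds because
  -- Φ = ∑_k F k α (m - k) x^k satisfies [θ b, Φ] = θ Φ.
  module _ {b φ F : Series} (α : ℤ → Carrier)
           (b₀≈0 : b 0 ≈ 0#) (bb : Commuting b b)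
           (F-central : Central F) (F₀≈1 : F 0 ≈ 1#) (θF : θ F ≈ˢ (θ φ *ˢ F))
           (bα : ∀ i m → b i * α m ≈ α m * b i + φ i * α (m ℤ.- + i)) where

    private
      shift : ∀ m i k → m ℤ.- + k ℤ.- + i ≡ m ℤ.- + (i ℕ.+ k)
      shift m i k = ≡.trans (ℤ.+-assoc m (ℤ.- + k) (ℤ.- + i))
        (≡.cong (λ n → m ℤ.+ n) (≡.trans (ℤ.+-comm (ℤ.- + k) (ℤ.- + i))
          (≡.sym (ℤ.neg-distrib-+ (+ i) (+ k)))))

      module _ (m : ℤ) where
        Φ : Series
        Φ k = F k * α (m ℤ.- + k)

        -- [θ b, Φ] = θ Φ
        summand : ∀ n i k → i ℕ.+ k ≡ n →
                  θ b i * Φ k ≈ Φ k * θ b i + θ φ i * F k * α (m ℤ.- + n)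
        summand n i k ≡.refl = begin
          θ b i * Φ k
            ≈⟨ ·-assoc-* i (b i) (Φ k) ⟩
          i · (b i * (F k * αₖ))
            ≈⟨ ·-congʳ i (begin
                 b i * (F k * αₖ)                             ≈⟨ *-assoc _ _ _ ⟨
                 b i * F k * αₖ                               ≈⟨ *-congʳ (F-central k (b i)) ⟨
                 F k * b i * αₖ                               ≈⟨ *-assoc _ _ _ ⟩
                 F k * (b i * αₖ)                             ≈⟨ *-congˡ (bα i _) ⟩
                 F k * (αₖ * b i + φ i * α (m ℤ.- + k ℤ.- + i))
                   ≡⟨ ≡.cong (λ n → F k * (αₖ * b i + φ i * α n)) (shift m i k) ⟩
                 F k * (αₖ * b i + φ i * αₙ)                   ≈⟨ distribˡ _ _ _ ⟩
                 F k * (αₖ * b i) + F k * (φ i * αₙ)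
                   ≈⟨ +-cong (*-assoc _ _ _)
                        (trans (*-congʳ (sym (F-central k (φ i)))) (*-assoc _ _ _)) ⟨
                 Φ k * b i + φ i * F k * αₙ ∎) ⟩
          i · (Φ k * b i + φ i * F k * αₙ)
            ≈⟨ ·-distrib-+ _ _ i ⟩
          i · (Φ k * b i) + i · (φ i * F k * αₙ)
            ≈⟨ +-cong (sym (·-comm-* i _ _))
                 (sym (trans (*-congʳ (·-assoc-* i _ _)) (·-assoc-* i _ _))) ⟩
          Φ k * θ b i + θ φ i * F k * αₙ ∎
          where
          αₖ = α (m ℤ.- + k)
          αₙ = α (m ℤ.- + (i ℕ.+ k))

        θb-Φ : (θ b *ˢ Φ) ≈ˢ (θ Φ +ˢ (Φ *ˢ θ b))
        θb-Φ n = begin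
          (θ b *ˢ Φ) n
            ≡⟨ *ˢ-conv (θ b) Φ n ⟩
          conv (λ i k → θ b i * Φ k) n
            ≈⟨ conv-cong n (summand n) ⟩
          conv (λ i k → Φ k * θ b i + θ φ i * F k * αₙ) n
            ≈⟨ conv-+ _ _ n ⟩
          conv (λ i k → Φ k * θ b i) n + conv (λ i k → θ φ i * F k * αₙ) n
            ≈⟨ +-cong (conv-flip (λ k i → Φ k * θ b i) n)
                      (sym (conv-map R R (_* αₙ) (distribʳ αₙ) (λ i k → θ φ i * F k) n)) ⟩
          conv (λ k i → Φ k * θ b i) n + conv (λ i k → θ φ i * F k) n * αₙ
            ≡⟨ ≡.cong₂ (λ x y → x + y * αₙ) (*ˢ-conv Φ (θ b) n) (*ˢ-conv (θ φ) F n) ⟨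
          (Φ *ˢ θ b) n + (θ φ *ˢ F) n * αₙ
            ≈⟨ +-congˡ (*-congʳ (θF n)) ⟨
          (Φ *ˢ θ b) n + θ F n * αₙ
            ≈⟨ +-comm _ _ ⟩
          θ F n * αₙ + (Φ *ˢ θ b) n
            ≈⟨ +-congʳ (·-assoc-* n _ _) ⟩
          θ Φ n + (Φ *ˢ θ b) n ∎
          where αₙ = α (m ℤ.- + n)

        left right : Series
        left  = exp b *ˢ constant (α m)
        right = Φ *ˢ exp b

        θ-left : θ left ≈ˢ (θ b *ˢ left)
        θ-left = IsDerivation.D-solution θ-isDerivation {exp b} {θ b} {constant (α m)}
                   (θ-exp b₀≈0 bb) (θ-constant (α m))

        θ-right : θ right ≈ˢ (θ b *ˢ right)
        θ-right n = begin
          θ right n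
            ≈⟨ θ-* Φ (exp b) n ⟩
          (θ Φ *ˢ exp b) n + (Φ *ˢ θ (exp b)) n
            ≈⟨ +-congˡ (trans (S.*-congˡ {Φ} (θ-exp b₀≈0 bb) n)
                 (sym (S.*-assoc Φ (θ b) (exp b) n))) ⟩
          (θ Φ *ˢ exp b) n + ((Φ *ˢ θ b) *ˢ exp b) n
            ≈⟨ S.distribʳ (exp b) (θ Φ) (Φ *ˢ θ b) n ⟨
          ((θ Φ +ˢ (Φ *ˢ θ b)) *ˢ exp b) n
            ≈⟨ S.*-congʳ {exp b} θb-Φ n ⟨
          ((θ b *ˢ Φ) *ˢ exp b) n
            ≈⟨ S.*-assoc (θ b) Φ (exp b) n ⟩
          (θ b *ˢ right) n ∎

    exp-commute : ∀ m i → exp b i * α m ≈ conv (λ k l → F k * α (m ℤ.- + k) * exp b l) i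
    exp-commute m i = begin
      exp b i * α m      ≈⟨ *ˢ-constant (exp b) (α m) i ⟨
      left m i           ≈⟨ θ-unique {θ b} refl (θ-left m) (θ-right m) initial i ⟩
      right m i          ≡⟨ *ˢ-conv (Φ m) (exp b) i ⟩
      conv (λ k l → F k * α (m ℤ.- + k) * exp b l) i ∎
      where
      initial : exp b 0 * α m ≈ F 0 * α (m ℤ.- + 0) * exp b 0
      initial = begin
        exp b 0 * α m                     ≈⟨ *-congʳ (exp-0 b) ⟩
        1# * α m                          ≈⟨ *-identityʳ _ ⟨
        1# * α m * 1#                     ≡⟨ ≡.cong (λ n → 1# * α n * 1#) (ℤ.+-identityʳ m) ⟨
        1# * α (m ℤ.- + 0) * 1#           ≈⟨ *-cong (*-congʳ F₀≈1) (exp-0 b) ⟨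
        F 0 * α (m ℤ.- + 0) * exp b 0     ∎

-- The operators of the Heisenberg algebra

module _ {c ℓ} (K : CommutativeRing c ℓ) where

  open CommutativeRing K
  open RingProperties ring using (-‿distribˡ-*)
  open CommutativeSemigroupProperties *-commutativeSemigroup using (xy∙z≈xz∙y; x∙yz≈y∙zx)
  open import Relation.Binary.Reasoning.Setoid setoid

  -- In the commutator of the coefficients of B_r and A_s at n = odd k, the factor
  -- h = n / 2 from a_n cancels one of the two factors x = 2 / n.
  contract : ∀ x y z h → x * h ≈ 1# → - (x * y * h) * (x * z) ≈ - (x * (z * y))
  contract x y z h xh≈1 = begin
    - (x * y * h) * (x * z)      ≈⟨ -‿distribˡ-* _ _ ⟨
    - (x * y * h * (x * z))      ≈⟨ -‿cong (*-congʳ (trans (xy∙z≈xz∙y x y h) (*-congʳ xh≈1))) ⟩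
    - (1# * y * (x * z))         ≈⟨ -‿cong (*-congʳ (*-identityˡ y)) ⟩
    - (y * (x * z))              ≈⟨ -‿cong (x∙yz≈y∙zx y x z) ⟩
    - (x * (z * y))              ∎

module Heisenberg (K : CommutativeRing 0ℓ 0ℓ)
  (_⁻¹ : CommutativeRing.Carrier K → CommutativeRing.Carrier K)
  (ι : ℚ → CommutativeRing.Carrier K)
  (alg : IsℚAlgebra (CommutativeRing.ring K) ι)
  where

  open VertexOperators K _⁻¹ ι hiding (_≈ᵘ_; constant; indeterminate; ScalarSeries; 1/_)
  open Operator
  open PowerSeries operatorRing
  open Exponential operatorRing (scalar ∘ ι) using (exp)
  private
    module K = CommutativeRing K
    module Kₐ = ℚAlgebra K.ring alg
    module Kˢ = PowerSeries K.ring
    module Kᴰ = SeriesProperties K.ring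
    module Kᴱ = SeriesExponential K.ring alg
    module G = CommutativeRing Γ-commutativeRing
    module Gʳ = RingProperties G.ring
    module G⁺ = CommutativeSemigroupProperties G.+-commutativeSemigroup
    module G* = CommutativeSemigroupProperties G.*-commutativeSemigroup
    module O = Ring operatorRing
    module OC = Convolution operatorRing
    open SeriesProperties operatorRing
    open SemiringExp K.semiring using (_^_)
    open SemiringMult O.semiring using () renaming (_×_ to _·_)
    open SemiringMult K.semiring using () renaming (_×_ to _·ᴷ_)
    open import Relation.Binary.Reasoning.Setoid G.setoid

  scalar-+ : ∀ a b → scalar (a K.+ b) ≈ᵒ (scalar a +ᵒ scalar b)
  scalar-+ a b f = ≈-trans (⊗-cong (con-+ a b) ≈-refl) (⊗-distribʳ f (con a) (con b))

  scalar-* : ∀ a b → scalar (a K.* b) ≈ᵒ (scalar a ∘ᵒ scalar b)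
  scalar-* a b f = ≈-trans (⊗-cong (con-* a b) ≈-refl) (⊗-assoc (con a) (con b) f)

  scalar-cong : ∀ {a b} → a K.≈ b → scalar a ≈ᵒ scalar b
  scalar-cong e f = ⊗-cong (con-cong e) ≈-refl

  scalar-central : ∀ a T → (scalar a ∘ᵒ T) ≈ᵒ (T ∘ᵒ scalar a)
  scalar-central a T f = ≈-sym (homogeneous T a f)

  scalar-0 : scalar K.0# ≈ᵒ 0ᵒ
  scalar-0 f = G.zeroˡ f

  operator-ℚAlgebra : IsℚAlgebra operatorRing (scalar ∘ ι)
  operator-ℚAlgebra = record
    { ι-+     = λ p q f → ≈-trans (scalar-cong (Kₐ.ι-+ p q) f) (scalar-+ _ _ f)
    ; ι-*     = λ p q f → ≈-trans (scalar-cong (Kₐ.ι-* p q) f) (scalar-* _ _ f)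
    ; ι-1     = λ f → ≈-trans (scalar-cong Kₐ.ι-1 f) (⊗-identityˡ f)
    ; central = λ q → scalar-central (ι q) }

  open SeriesExponential operatorRing operator-ℚAlgebra
  open Commutation operatorRing operator-ℚAlgebra

  -- P holds for all coefficients of ∑_k c k x^(odd k).
  onOdds-∀ : ∀ {a ℓ} {A : Set a} (P : A → Set ℓ) {z c} → P z → (∀ k → P (c k)) →
             ∀ n → P (onOdds z c n)
  onOdds-∀ P Pz Pc zero          = Pz
  onOdds-∀ P Pz Pc (suc zero)    = Pc 0
  onOdds-∀ P Pz Pc (suc (suc n)) = onOdds-∀ P Pz (Pc ∘ suc) n

  -- The coefficients of A s and B r at odd k are α p_(odd k) and β ∂/∂p_(odd k) with
  -- the following scalars α and β.
  private
    α-coefficient β-coefficient : K.Carrier → ℕ → K.Carrier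
    α-coefficient s k = 2/odd k K.* (K.1# K.- s ^ odd k)
    β-coefficient r k = K.- (2/odd k K.* (K.1# K.- r ^ odd k) ⁻¹ K.* ι (+ odd k ℚ./ 2))

  -- The coefficients of A s and B r at odd k
  a[_] b[_] : K.Carrier → ℕ → Operator
  a[ s ] k = scalar (α-coefficient s k) ∘ᵒ a₋ k
  b[ r ] k = -ᵒ (scalar (2/odd k K.* (K.1# K.- r ^ odd k) ⁻¹) ∘ᵒ a₊ k)

  b≈β∂ : ∀ r k → b[ r ] k ≈ᵒ (scalar (β-coefficient r k) ∘ᵒ ∂ k)
  b≈β∂ r k f = begin
    ⊖ (con x ⊗ (con y ⊗ ∂f))     ≈⟨ ⊖-cong (⊗-assoc _ _ _) ⟨
    ⊖ (con x ⊗ con y ⊗ ∂f)       ≈⟨ Gʳ.-‿distribˡ-* _ _ ⟩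
    ⊖ (con x ⊗ con y) ⊗ ∂f       ≈⟨ ⊗-cong (⊖-cong (con-* x y)) ≈-refl ⟨
    ⊖ con (x K.* y) ⊗ ∂f         ≈⟨ ⊗-cong (con-⊖ (x K.* y)) ≈-refl ⟨
    con (K.- (x K.* y)) ⊗ ∂f     ∎
    where
    x = 2/odd k K.* (K.1# K.- r ^ odd k) ⁻¹
    y = ι (+ odd k ℚ./ 2)
    ∂f = derivative k f
    con-⊖ : ∀ a → con (K.- a) ≈ ⊖ con a
    con-⊖ a = Gʳ.+-inverseˡ-unique _ _
      (≈-trans (≈-sym (con-+ (K.- a) a)) (con-cong (K.-‿inverseˡ a)))

  derivative-comm : ∀ k l f → derivative k (derivative l f) ≈ derivative l (derivative k f)
  derivative-comm k l (con a) = ≈-refl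
  derivative-comm k l (p j) = ≈-trans (kills k l) (≈-sym (kills l k))
    where
    kills : ∀ k l → derivative k (derivative l (p j)) ≈ con K.0#
    kills k l with l ℕ.≟ j
    ... | yes _ = ≈-refl
    ... | no  _ = ≈-refl
  derivative-comm k l (f ⊕ g) = ⊕-cong (derivative-comm k l f) (derivative-comm k l g)
  derivative-comm k l (f ⊗ g) = begin
    (∂ₖ (∂ₗ f) ⊗ g ⊕ ∂ₗ f ⊗ ∂ₖ g) ⊕ (∂ₖ f ⊗ ∂ₗ g ⊕ f ⊗ ∂ₖ (∂ₗ g))
      ≈⟨ G⁺.interchange _ _ _ _ ⟩
    (∂ₖ (∂ₗ f) ⊗ g ⊕ ∂ₖ f ⊗ ∂ₗ g) ⊕ (∂ₗ f ⊗ ∂ₖ g ⊕ f ⊗ ∂ₖ (∂ₗ g))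
      ≈⟨ ⊕-cong (⊕-cong (⊗-cong (derivative-comm k l f) ≈-refl) ≈-refl)
                (⊕-cong ≈-refl (⊗-cong ≈-refl (derivative-comm k l g))) ⟩
    (∂ₗ (∂ₖ f) ⊗ g ⊕ ∂ₖ f ⊗ ∂ₗ g) ⊕ (∂ₗ f ⊗ ∂ₖ g ⊕ f ⊗ ∂ₗ (∂ₖ g)) ∎
    where
    ∂ₖ = derivative k
    ∂ₗ = derivative l
  derivative-comm k l (⊖ f) = ⊖-cong (derivative-comm k l f)

  Commute : Operator → Operator → Set
  Commute S T = (S ∘ᵒ T) ≈ᵒ (T ∘ᵒ S)

  Commute-0ˡ : ∀ T → Commute 0ᵒ T
  Commute-0ˡ T f = ≈-sym (apply-0 T)

  Commute-0ʳ : ∀ T → Commute T 0ᵒ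
  Commute-0ʳ T f = apply-0 T

  A-commuting : ∀ r s → Commuting (A r) (A s)
  A-commuting r s i j = onOdds-∀ (λ S → Commute S (A s j)) (Commute-0ˡ (A s j))
    (λ k → onOdds-∀ (Commute (a[ r ] k)) (Commute-0ʳ (a[ r ] k)) (λ l f → begin
      con _ ⊗ (p k ⊗ (con _ ⊗ (p l ⊗ f)))   ≈⟨ regroup _ _ _ _ f ⟩
      (con _ ⊗ p k) ⊗ ((con _ ⊗ p l) ⊗ f)   ≈⟨ G*.x∙yz≈y∙xz _ _ _ ⟩
      (con _ ⊗ p l) ⊗ ((con _ ⊗ p k) ⊗ f)   ≈⟨ regroup _ _ _ _ f ⟨
      con _ ⊗ (p l ⊗ (con _ ⊗ (p k ⊗ f)))   ∎) j) i
    where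
    regroup : ∀ a x b y f → a ⊗ (x ⊗ (b ⊗ (y ⊗ f))) ≈ (a ⊗ x) ⊗ ((b ⊗ y) ⊗ f)
    regroup a x b y f = ≈-trans (≈-sym (⊗-assoc _ _ _)) (⊗-cong ≈-refl (≈-sym (⊗-assoc _ _ _)))

  B-commuting : ∀ r s → Commuting (B r) (B s)
  B-commuting r s i j = onOdds-∀ (λ S → Commute S (B s j)) (Commute-0ˡ (B s j))
    (λ k → onOdds-∀ (Commute (b[ r ] k)) (Commute-0ʳ (b[ r ] k)) (λ l f → begin
      apply (b[ r ] k) (apply (b[ s ] l) f)         ≈⟨ product r s k l f ⟩
      con _ ⊗ (con _ ⊗ derivative k (derivative l f))
        ≈⟨ G*.x∙yz≈y∙xz _ _ _ ⟩
      con _ ⊗ (con _ ⊗ derivative k (derivative l f))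
        ≈⟨ ⊗-cong ≈-refl (⊗-cong ≈-refl (derivative-comm k l f)) ⟩
      con _ ⊗ (con _ ⊗ derivative l (derivative k f)) ≈⟨ product s r l k f ⟨
      apply (b[ s ] l) (apply (b[ r ] k) f)         ∎) j) i
    where
    product : ∀ r s k l f → apply (b[ r ] k) (apply (b[ s ] l) f) ≈
      con (β-coefficient r k) ⊗ (con (β-coefficient s l) ⊗ derivative k (derivative l f))
    product r s k l f = ≈-trans (cong (b[ r ] k) (b≈β∂ s l f))
      (≈-trans (b≈β∂ r k (con (β-coefficient s l) ⊗ derivative l f))
        (⊗-cong ≈-refl (homogeneous (∂ k) (β-coefficient s l) (derivative l f))))

  -- The coefficient of u^(odd k) in the exponent of F_{r,s}(u)
  logF : K.Carrier → K.Carrier → ℕ → K.Carrier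
  logF r s k = K.- (2/odd k K.* ((K.1# K.- s ^ odd k) K.* (K.1# K.- r ^ odd k) ⁻¹))

  -- ∂p_(odd l) / ∂p_(odd k) is 1 if k = l and 0 otherwise.
  derivative-p : ∀ k l → derivative k (p l) ≈ con (Kᴰ.diagonal (λ _ → K.1#) k l)
  derivative-p k l with k ℕ.≟ l
  ... | yes ≡.refl = con-cong (K.reflexive (≡.sym (Kᴰ.diagonal-≡ (λ _ → K.1#) k)))
  ... | no  k≢l    = con-cong (K.reflexive (≡.sym (Kᴰ.diagonal-≢ (λ _ → K.1#) k l k≢l)))

  β*α : ∀ r s k → β-coefficient r k K.* α-coefficient s k K.≈ logF r s k
  β*α r s k = contract K (2/odd k) ((K.1# K.- r ^ odd k) ⁻¹) (K.1# K.- s ^ odd k)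
                (ι (+ odd k ℚ./ 2)) inverse
    where
    inverse : 2/odd k K.* ι (+ odd k ℚ./ 2) K.≈ K.1#
    inverse = K.trans (K.sym (Kₐ.ι-* (+ 2 ℚ./ odd k) (+ odd k ℚ./ 2)))
      (K.trans (K.reflexive (≡.cong ι (≡.trans (Fractions./-* 2 (odd k) (odd k) 2)
        (Fractions./-≡ (2 ℕ.* odd k) 1 (odd k ℕ.* 2) 1
          (≡.trans (ℕ.*-identityʳ _) (≡.trans (ℕ.*-comm 2 (odd k)) (≡.sym (ℕ.*-identityˡ _))))))))
        Kₐ.ι-1)

  -- [β ∂/∂p_(odd k), α p_(odd l)] is αβ if k = l and 0 otherwise.
  commutator-odd : ∀ r s k l → (b[ r ] k ∘ᵒ a[ s ] l) ≈ᵒ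
    ((a[ s ] l ∘ᵒ b[ r ] k) +ᵒ scalar (Kᴰ.diagonal (logF r s) k l))
  commutator-odd r s k l f = begin
    apply (b[ r ] k) (con α ⊗ (p l ⊗ f))
      ≈⟨ b≈β∂ r k (con α ⊗ (p l ⊗ f)) ⟩
    con β ⊗ derivative k (con α ⊗ (p l ⊗ f))
      ≈⟨ ⊗-cong ≈-refl (derivative-con-⊗ k α (p l ⊗ f)) ⟩
    con β ⊗ (con α ⊗ (derivative k (p l) ⊗ f ⊕ p l ⊗ derivative k f))
      ≈⟨ ⊗-cong ≈-refl (⊗-cong ≈-refl (⊕-cong (⊗-cong (derivative-p k l) ≈-refl) ≈-refl)) ⟩
    con β ⊗ (con α ⊗ (con δ ⊗ f ⊕ p l ⊗ derivative k f))
      ≈⟨ ⊗-assoc _ _ _ ⟨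
    con β ⊗ con α ⊗ (con δ ⊗ f ⊕ p l ⊗ derivative k f)
      ≈⟨ ≈-trans (G.distribˡ _ _ _) (⊕-comm _ _) ⟩
    con β ⊗ con α ⊗ (p l ⊗ derivative k f) ⊕ con β ⊗ con α ⊗ (con δ ⊗ f)
      ≈⟨ ⊕-cong (≈-trans (rearrange (con β) (con α) (p l) (derivative k f))
                         (⊗-cong ≈-refl (⊗-cong ≈-refl (≈-sym (b≈β∂ r k f)))))
                (≈-trans (⊗-cong (≈-sym (con-* β α)) ≈-refl)
                  (≈-trans (≈-sym (⊗-assoc _ _ _)) (⊗-cong (≈-sym (con-* (β K.* α) δ)) ≈-refl))) ⟩
    con α ⊗ (p l ⊗ apply (b[ r ] k) f) ⊕ con (β K.* α K.* δ) ⊗ f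
      ≈⟨ ⊕-cong ≈-refl (⊗-cong (con-cong (Kᴰ.diagonal-scale
           (λ k l → β-coefficient r k K.* α-coefficient s l) (logF r s) (β*α r s) k l)) ≈-refl) ⟩
    con α ⊗ (p l ⊗ apply (b[ r ] k) f) ⊕ con (Kᴰ.diagonal (logF r s) k l) ⊗ f ∎
    where
    α = α-coefficient s l
    β = β-coefficient r k
    δ = Kᴰ.diagonal (λ _ → K.1#) k l
    rearrange : ∀ b a q g → b ⊗ a ⊗ (q ⊗ g) ≈ a ⊗ (q ⊗ (b ⊗ g))
    rearrange b a q g = begin
      b ⊗ a ⊗ (q ⊗ g)    ≈⟨ ⊗-assoc _ _ _ ⟩
      b ⊗ (a ⊗ (q ⊗ g))  ≈⟨ G*.x∙yz≈y∙xz _ _ _ ⟩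
      a ⊗ (b ⊗ (q ⊗ g))  ≈⟨ ⊗-cong ≈-refl (G*.x∙yz≈y∙xz _ _ _) ⟩
      a ⊗ (q ⊗ (b ⊗ g))  ∎

  Commute⇒ : ∀ {S T z} → z ≡ K.0# → Commute S T → (S ∘ᵒ T) ≈ᵒ ((T ∘ᵒ S) +ᵒ scalar z)
  Commute⇒ {T = T} ≡.refl e f =
    ≈-trans (e f) (≈-sym (≈-trans (⊕-cong ≈-refl (scalar-0 f)) (G.+-identityʳ _)))

  ⇒Commute : ∀ {S T z} → z ≡ K.0# → (S ∘ᵒ T) ≈ᵒ ((T ∘ᵒ S) +ᵒ scalar z) → Commute S T
  ⇒Commute ≡.refl e f = ≈-trans (e f) (≈-trans (⊕-cong ≈-refl (scalar-0 f)) (G.+-identityʳ _))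

  -- The relation [b k, a l] = diagonal φ k l is inherited by the series
  -- ∑_k b k x^(odd k), ∑_l a l y^(odd l) and ∑_k φ k u^(odd k).
  commutator-onOdds : ∀ {b a : ℕ → Operator} {φ} →
    (∀ k l → (b k ∘ᵒ a l) ≈ᵒ ((a l ∘ᵒ b k) +ᵒ scalar (Kᴰ.diagonal φ k l))) →
    ∀ i j → (onOdds 0ᵒ b i ∘ᵒ onOdds 0ᵒ a j) ≈ᵒ
      ((onOdds 0ᵒ a j ∘ᵒ onOdds 0ᵒ b i) +ᵒ scalar (Kᴰ.diagonal (onOdds K.0# φ) i j))
  commutator-onOdds e zero zero = Commute⇒ {0ᵒ} {0ᵒ} ≡.refl (Commute-0ˡ 0ᵒ)
  commutator-onOdds {a = a} e zero (suc j) =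
    Commute⇒ {0ᵒ} {onOdds 0ᵒ a (suc j)} ≡.refl (Commute-0ˡ (onOdds 0ᵒ a (suc j)))
  commutator-onOdds {b} e (suc zero) zero = Commute⇒ {b 0} {0ᵒ} ≡.refl (Commute-0ʳ (b 0))
  commutator-onOdds e (suc zero) (suc zero) = e 0 0
  commutator-onOdds {b} {a} e (suc zero) (suc (suc j)) =
    Commute⇒ {b 0} {onOdds 0ᵒ (a ∘ suc) j} ≡.refl
      (onOdds-∀ (Commute (b 0)) (Commute-0ʳ (b 0))
        (λ l → ⇒Commute {b 0} {a (suc l)} ≡.refl (e 0 (suc l))) j)
  commutator-onOdds {b} e (suc (suc i)) zero =
    Commute⇒ {onOdds 0ᵒ (b ∘ suc) i} {0ᵒ} ≡.refl (Commute-0ʳ (onOdds 0ᵒ (b ∘ suc) i))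
  commutator-onOdds {b} {a} e (suc (suc i)) (suc zero) =
    Commute⇒ {onOdds 0ᵒ (b ∘ suc) i} {a 0} ≡.refl
      (onOdds-∀ (λ S → Commute S (a 0)) (Commute-0ˡ (a 0))
        (λ k → ⇒Commute {b (suc k)} {a 0} ≡.refl (e (suc k) 0)) i)
  commutator-onOdds e (suc (suc i)) (suc (suc j)) =
    commutator-onOdds (λ k l → e (suc k) (suc l)) i j

  -- The exponent of F_{r,s}(u)
  φ : K.Carrier → K.Carrier → Kˢ.Series
  φ r s = onOdds K.0# (logF r s)

  commutator : ∀ r s i j → (B r i ∘ᵒ A s j) ≈ᵒ
    ((A s j ∘ᵒ B r i) +ᵒ scalar (Kᴰ.diagonal (φ r s) i j))
  commutator r s = commutator-onOdds (commutator-odd r s)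

  -- Multiplication of a series in y by φ i y^i
  diagonal-⟨⟩ : ∀ φ (E : Series) i j →
    ((λ k → scalar (Kᴰ.diagonal φ i k)) *ˢ E) j ≈ᵒ (scalar (φ i) ∘ᵒ (E ⟨ + j ℤ.- + i ⟩))
  diagonal-⟨⟩ φ E zero j f = begin
    apply (((λ k → scalar (Kᴰ.diagonal φ 0 k)) *ˢ E) j) f
      ≈⟨ Ring.*-congʳ seriesRing {E} diagonal-0 j f ⟩
    apply ((constant (scalar (φ 0)) *ˢ E) j) f
      ≈⟨ constant-*ˢ (scalar (φ 0)) E j f ⟩
    con (φ 0) ⊗ apply (E j) f
      ≡⟨ ≡.cong (λ n → con (φ 0) ⊗ apply (E ⟨ n ⟩) f) (ℤ.+-identityʳ (+ j)) ⟨
    con (φ 0) ⊗ apply (E ⟨ + j ℤ.- + 0 ⟩) f ∎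
    where
    diagonal-0 : (λ k → scalar (Kᴰ.diagonal φ 0 k)) ≈ˢ constant (scalar (φ 0))
    diagonal-0 zero    f = ≈-refl
    diagonal-0 (suc k) f = scalar-0 f
  diagonal-⟨⟩ φ E (suc i) zero f = ≈-trans (G.zeroˡ _) (≈-sym (G.zeroʳ _))
  diagonal-⟨⟩ φ E (suc i) (suc j) f = begin
    con K.0# ⊗ apply (E (suc j)) f ⊕ apply (((λ k → scalar (Kᴰ.diagonal (φ ∘ suc) i k)) *ˢ E) j) f
      ≈⟨ ≈-trans (⊕-cong (G.zeroˡ _) ≈-refl) (⊕-identityˡ _) ⟩
    apply (((λ k → scalar (Kᴰ.diagonal (φ ∘ suc) i k)) *ˢ E) j) f
      ≈⟨ diagonal-⟨⟩ (φ ∘ suc) E i j f ⟩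
    con (φ (suc i)) ⊗ apply (E ⟨ + j ℤ.- + i ⟩) f
      ≡⟨ ≡.cong (λ n → con (φ (suc i)) ⊗ apply (E ⟨ n ⟩) f)
           (≡.trans (ℤ.m-n≡m⊖n j i) (≡.sym (ℤ.[1+m]⊖[1+n]≡m⊖n j i))) ⟩
    con (φ (suc i)) ⊗ apply (E ⟨ + suc j ℤ.- + suc i ⟩) f ∎

  -- [B_r, e^{A_s}] = φ_{r,s}(xy) e^{A_s}, in degree i in x and m in y
  commute-expA : ∀ r s i m → (B r i ∘ᵒ (exp (A s) ⟨ m ⟩)) ≈ᵒ
    (((exp (A s) ⟨ m ⟩) ∘ᵒ B r i) +ᵒ (scalar (φ r s i) ∘ᵒ (exp (A s) ⟨ m ℤ.- + i ⟩)))
  commute-expA r s i (+ j) f = ≈-trans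
    (commute-exp {B r i} {A s} {λ k → scalar (Kᴰ.diagonal (φ r s) i k)}
      (λ _ → ≈-refl) (commutator r s i) (λ k l → scalar-central _ (A s l)) j f)
    (⊕-cong ≈-refl (diagonal-⟨⟩ (φ r s) (exp (A s)) i j f))
  commute-expA r s i -[1+ n ] f = ≈-trans (apply-0 (B r i)) (≈-sym (≈-trans (⊕-identityˡ _)
    (≈-trans (⊗-cong ≈-refl (negative i)) (G.zeroʳ _))))
    where
    negative : ∀ i → apply (exp (A s) ⟨ -[1+ n ] ℤ.- + i ⟩) f ≈ con K.0#
    negative zero    = ≈-refl
    negative (suc i) = ≈-refl

  F₀≈1 : ∀ r s → F r s 0 K.≈ K.1#
  F₀≈1 r s = Kᴱ.exp-0 (φ r s)

  θF : ∀ r s → Kᴱ.θ (F r s) Kˢ.≈ˢ (Kᴱ.θ (φ r s) Kˢ.*ˢ F r s)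
  θF r s = Kᴱ.θ-exp {φ r s} K.refl (λ i j → K.*-comm _ _)

  scalar-· : ∀ n a → scalar (n ·ᴷ a) ≈ᵒ (n · scalar a)
  scalar-· zero    a f = scalar-0 f
  scalar-· (suc n) a f = ≈-trans (scalar-+ a (n ·ᴷ a) f) (⊕-cong ≈-refl (scalar-· n a f))

  scalar-*ˢ : ∀ g h n → scalar ((g Kˢ.*ˢ h) n) ≈ᵒ ((scalar ∘ g) *ˢ (scalar ∘ h)) n
  scalar-*ˢ g h zero    = scalar-* (g 0) (h 0)
  scalar-*ˢ g h (suc n) f = ≈-trans (scalar-+ _ _ f)
    (⊕-cong (scalar-* (g 0) (h (suc n)) f) (scalar-*ˢ (g ∘ suc) h n f))

  θ-scalarF : ∀ r s → θ (scalar ∘ F r s) ≈ˢ (θ (scalar ∘ φ r s) *ˢ (scalar ∘ F r s))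
  θ-scalarF r s n f = begin
    apply (n · scalar (F r s n)) f
      ≈⟨ scalar-· n (F r s n) f ⟨
    con (Kᴱ.θ (F r s) n) ⊗ f
      ≈⟨ scalar-cong (θF r s n) f ⟩
    con ((Kᴱ.θ (φ r s) Kˢ.*ˢ F r s) n) ⊗ f
      ≈⟨ scalar-*ˢ (Kᴱ.θ (φ r s)) (F r s) n f ⟩
    apply (((scalar ∘ Kᴱ.θ (φ r s)) *ˢ (scalar ∘ F r s)) n) f
      ≈⟨ Ring.*-congʳ seriesRing {scalar ∘ F r s} {scalar ∘ Kᴱ.θ (φ r s)} {θ (scalar ∘ φ r s)}
           (λ k → scalar-· k (φ r s k)) n f ⟩
    apply ((θ (scalar ∘ φ r s) *ˢ (scalar ∘ F r s)) n) f ∎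

  -- e^{B_r(z)} e^{A_s(w)} = F_{r,s}(w/z) e^{A_s(w)} e^{B_r(z)}
  expB-expA : ∀ r s i m → (exp (B r) i ∘ᵒ (exp (A s) ⟨ m ⟩)) ≈ᵒ
    OC.conv (λ k l → (scalar (F r s k) ∘ᵒ (exp (A s) ⟨ m ℤ.- + k ⟩)) ∘ᵒ exp (B r) l) i
  expB-expA r s i m = exp-commute {B r} {scalar ∘ φ r s} {scalar ∘ F r s} (exp (A s) ⟨_⟩)
    (λ _ → ≈-refl) (B-commuting r r)
    (λ n → scalar-central (F r s n)) (λ f → ≈-trans (scalar-cong (F₀≈1 r s) f) (⊗-identityˡ f))
    (θ-scalarF r s)
    (commute-expA r s) m i

-- Reciprocals and quotients of power series

module Quotients (K : CommutativeRing 0ℓ 0ℓ) where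

  open CommutativeRing K hiding (zero)
  open CommutativePowerSeries K hiding (*ˢ-comm)
  open SeriesProperties ring using (*ˢ-cong-≤; ^-order)
  private
    module S = CommutativeRing seriesCommutativeRing
    module S* = CommutativeSemigroupProperties S.*-commutativeSemigroup
    module SC = Convolution S.ring
  open Convolution ring using (∑<; ∑<-truncate)
  open SemiringExp S.semiring using (_^_)
  open MonoidSum S.*-monoid using () renaming (sum to product)
  open import Relation.Binary.Reasoning.Setoid setoid

  module _ {f : Series} (f₀≈1 : f 0 ≈ 1#) where

    private
      -- 1 / f is the geometric series in y = 1 - f.
      y : Series
      y = S.1# S.- f

      -- ∑_{k ≤ N} y^k
      geometric : ℕ → Series
      geometric N = SC.∑< (suc N) (y ^_)

      y₀≈0 : y 0 ≈ 0#
      y₀≈0 = trans (+-congˡ (-‿cong f₀≈1)) (-‿inverseʳ 1#)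

      at : ∀ N n → geometric N n ≈ ∑< (suc N) (λ k → (y ^ k) n)
      at N n = ∑<-map S.ring ring (λ g → g n) refl (λ _ _ → refl) (y ^_) (suc N)

      geometric-stable : ∀ {N n} → n ℕ.≤ N → geometric N n ≈ (1/ f) n
      geometric-stable {N} {n} n≤N = begin
        geometric N n                      ≈⟨ at N n ⟩
        ∑< (suc N) (λ k → (y ^ k) n)
          ≈⟨ ∑<-truncate _ (suc n) (s≤s n≤N) (λ k n<k → ^-order {y} y₀≈0 k n n<k) ⟩
        ∑< (suc n) (λ k → (y ^ k) n)       ≈⟨ at n n ⟨
        (1/ f) n                           ∎

      1/-step : (1/ f) ≈ˢ (S.1# +ˢ (y *ˢ (1/ f)))
      1/-step n = begin
        (1/ f) n                                 ≈⟨ geometric-stable (ℕ.n≤1+n n) ⟨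
        S.1# n + SC.∑< (suc n) (λ k → y *ˢ (y ^ k)) n
          ≈⟨ +-congˡ (∑<-map S.ring S.ring (y *ˢ_) (S.zeroʳ y) (S.distribˡ y) (y ^_) (suc n) n) ⟨
        S.1# n + (y *ˢ geometric n) n
          ≈⟨ +-congˡ (*ˢ-cong-≤ {y} n (λ _ _ → refl) (λ m m≤n → geometric-stable m≤n)) ⟩
        S.1# n + (y *ˢ (1/ f)) n                 ∎

    -- From 1 / f = 1 + y (1 / f)
    1/-inverse : (f *ˢ (1/ f)) ≈ˢ S.1#
    1/-inverse n = begin
      (f *ˢ g) n                                ≈⟨ +-identityʳ _ ⟨
      (f *ˢ g) n + 0#                           ≈⟨ +-congˡ (-‿inverseʳ (g n)) ⟨
      (f *ˢ g) n + (g n - g n)                  ≈⟨ +-congˡ (+-congʳ (1/-step n)) ⟩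
      (f *ˢ g) n + (S.1# n + (y *ˢ g) n - g n)  ≈⟨ +-congˡ (+-congʳ (+-congˡ (y*g n))) ⟩
      (f *ˢ g) n + (S.1# n + (g n - (f *ˢ g) n) - g n)
        ≈⟨ regroup ((f *ˢ g) n) (S.1# n) (g n) ⟩
      S.1# n                                    ∎
      where
      g = 1/ f
      open RingProperties S.ring using () renaming ([y-z]x≈yx-zx to [y-z]x≈yx-zxˢ)
      y*g : (y *ˢ g) ≈ˢ (g S.- (f *ˢ g))
      y*g = S.trans {y *ˢ g} ([y-z]x≈yx-zxˢ g S.1# f) (S.+-congʳ {S.- (f *ˢ g)} (S.*-identityˡ g))
      regroup : ∀ a b c → a + (b + (c - a) - c) ≈ b
      regroup a b c = begin
        a + (b + (c - a) - c)
          ≈⟨ +-congˡ (trans (+-assoc _ _ _) (+-congˡ (trans (+-comm _ _) (sym (+-assoc _ _ _))))) ⟩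
        a + (b + (- c + c - a))
          ≈⟨ +-congˡ (+-congˡ (trans (+-congʳ (-‿inverseˡ c)) (+-identityˡ _))) ⟩
        a + (b - a)                ≈⟨ trans (+-comm _ _) (+-assoc _ _ _) ⟩
        b + (- a + a)              ≈⟨ trans (+-congˡ (-‿inverseˡ a)) (+-identityʳ b) ⟩
        b                          ∎

    *ˢ-cancelʳ : ∀ {g h} → (g *ˢ f) ≈ˢ (h *ˢ f) → g ≈ˢ h
    *ˢ-cancelʳ {g} {h} e = S.trans {g} {(g *ˢ f) *ˢ (1/ f)} {h}
      (S.sym {(g *ˢ f) *ˢ (1/ f)} {g} (undo g))
      (S.trans {(g *ˢ f) *ˢ (1/ f)} {(h *ˢ f) *ˢ (1/ f)} (S.*-congʳ {1/ f} e) (undo h))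
      where
      undo : ∀ g → ((g *ˢ f) *ˢ (1/ f)) ≈ˢ g
      undo g = S.trans {(g *ˢ f) *ˢ (1/ f)} (S.*-assoc g f (1/ f))
                 (S.trans {g *ˢ (f *ˢ (1/ f))} (S.*-congˡ {g} 1/-inverse) (S.*-identityʳ g))

    quotient-* : ∀ g → ((g *ˢ (1/ f)) *ˢ f) ≈ˢ g
    quotient-* g = S.trans {(g *ˢ (1/ f)) *ˢ f} (S*.xy∙z≈xz∙y g (1/ f) f)
      (S.trans {(g *ˢ f) *ˢ (1/ f)} (S.*-assoc g f (1/ f))
        (S.trans {g *ˢ (f *ˢ (1/ f))} (S.*-congˡ {g} 1/-inverse) (S.*-identityʳ g)))

  quotient-cong : ∀ {p q f g} → f 0 ≈ 1# → p ≈ˢ q → f ≈ˢ g → (p *ˢ (1/ f)) ≈ˢ (q *ˢ (1/ g))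
  quotient-cong {p} {q} {f} {g} f₀≈1 p≈q f≈g = *ˢ-cancelʳ f₀≈1 {p *ˢ (1/ f)} {q *ˢ (1/ g)} (S.trans
    {(p *ˢ (1/ f)) *ˢ f} (quotient-* f₀≈1 p) (S.trans {p} p≈q
      (S.sym {(q *ˢ (1/ g)) *ˢ f} (S.trans {(q *ˢ (1/ g)) *ˢ f} {(q *ˢ (1/ g)) *ˢ g}
        (S.*-congˡ {q *ˢ (1/ g)} f≈g) (quotient-* (trans (sym (f≈g 0)) f₀≈1) q)))))

  -- ∏ M f = ∏_{j < M} f j
  ∏ : ℕ → (ℕ → Series) → Series
  ∏ M f = product {M} (f ∘ toℕ)

  ∏-cong : ∀ M {f g} → (∀ j → f j ≈ˢ g j) → ∏ M f ≈ˢ ∏ M g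
  ∏-cong zero    e = S.refl {S.1#}
  ∏-cong (suc M) e = S.*-cong (e 0) (∏-cong M (e ∘ suc))

  ∏-0 : ∀ M f → (∀ j → f j 0 ≈ 1#) → ∏ M f 0 ≈ 1#
  ∏-0 zero    f e = refl
  ∏-0 (suc M) f e = trans (*-cong (e 0) (∏-0 M (f ∘ suc) (e ∘ suc))) (*-identityˡ 1#)

  ∏-quotient : ∀ M {f g} → (∀ j → g j 0 ≈ 1#) →
               ∏ M (λ j → f j *ˢ (1/ (g j))) ≈ˢ (∏ M f *ˢ (1/ ∏ M g))
  ∏-quotient M {f} {g} g₀≈1 = *ˢ-cancelʳ (∏-0 M g g₀≈1) {∏ M (λ j → f j *ˢ (1/ (g j)))}
    (S.trans {∏ M (λ j → f j *ˢ (1/ (g j))) *ˢ ∏ M g} (cleared M f g g₀≈1)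
      (S.sym {(∏ M f *ˢ (1/ ∏ M g)) *ˢ ∏ M g} (quotient-* (∏-0 M g g₀≈1) (∏ M f))))
    where
    cleared : ∀ M f g → (∀ j → g j 0 ≈ 1#) → (∏ M (λ j → f j *ˢ (1/ (g j))) *ˢ ∏ M g) ≈ˢ ∏ M f
    cleared zero    f g e = S.*-identityˡ S.1#
    cleared (suc M) f g e = S.trans
      {(q *ˢ ∏ M (λ j → f (suc j) *ˢ (1/ (g (suc j))))) *ˢ (g 0 *ˢ ∏ M (g ∘ suc))}
      (S*.interchange q (∏ M (λ j → f (suc j) *ˢ (1/ (g (suc j))))) (g 0) (∏ M (g ∘ suc)))
      (S.*-cong {q *ˢ g 0} (quotient-* (e 0) (f 0)) (cleared M (f ∘ suc) (g ∘ suc) (e ∘ suc)))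
      where q = f 0 *ˢ (1/ (g 0))

-- Logarithmic derivatives and the product formula for F

module LogarithmicDerivatives {c ℓ} (K : CommutativeRing c ℓ)
  {D : CommutativeRing.Carrier K → CommutativeRing.Carrier K}
  (der : IsDerivation (CommutativeRing.ring K) D)
  where

  open CommutativeRing K hiding (zero)
  open IsDerivation der
  open Convolution ring using (∑<)
  open MonoidSum *-monoid using () renaming (sum to product)
  open CommutativeSemigroupProperties *-commutativeSemigroup using (x∙yz≈y∙xz; xy∙z≈xz∙y)
  open CommutativeSemigroupProperties +-commutativeSemigroup using (interchange)
  open RingProperties ring using (-‿distribˡ-*; -‿+-comm; [y-z]x≈yx-zx)
  open import Relation.Binary.Reasoning.Setoid setoid

  -- The logarithmic derivative of a product is the sum of those of the factors.
  D-product : ∀ M (Q ψ : ℕ → Carrier) → (∀ j → D (Q j) ≈ ψ j * Q j) →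
              D (product {M} (Q ∘ toℕ)) ≈ ∑< M ψ * product {M} (Q ∘ toℕ)
  D-product zero    Q ψ e = trans D-1 (sym (zeroˡ 1#))
  D-product (suc M) Q ψ e = begin
    D (Q 0 * Π)                                  ≈⟨ D-* (Q 0) Π ⟩
    D (Q 0) * Π + Q 0 * D Π
      ≈⟨ +-cong (*-congʳ (e 0)) (*-congˡ (D-product M (Q ∘ suc) (ψ ∘ suc) (e ∘ suc))) ⟩
    ψ 0 * Q 0 * Π + Q 0 * (∑< M (ψ ∘ suc) * Π)   ≈⟨ +-cong (*-assoc _ _ _) (x∙yz≈y∙xz _ _ _) ⟩
    ψ 0 * (Q 0 * Π) + ∑< M (ψ ∘ suc) * (Q 0 * Π) ≈⟨ distribʳ _ _ _ ⟨
    (ψ 0 + ∑< M (ψ ∘ suc)) * (Q 0 * Π)           ∎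
    where Π = product {M} (Q ∘ suc ∘ toℕ)

  difference-of-squares : ∀ v → (1# - v) * (1# + v) ≈ 1# - v * v
  difference-of-squares v = begin
    (1# - v) * (1# + v)            ≈⟨ trans (distribˡ _ _ _) (+-congʳ (*-identityʳ _)) ⟩
    (1# - v) + (1# - v) * v
      ≈⟨ +-congˡ (trans ([y-z]x≈yx-zx v 1# v) (+-congʳ (*-identityˡ v))) ⟩
    (1# - v) + (v - v * v)         ≈⟨ trans (+-assoc _ _ _) (+-congˡ (sym (+-assoc _ _ _))) ⟩
    1# + ((- v + v) - v * v)       ≈⟨ +-congˡ (trans (+-congʳ (-‿inverseˡ v)) (+-identityˡ _)) ⟩
    1# - v * v                     ∎

  -- If D v = v then Q = (1 - v) / (1 + v) has logarithmic derivative
  -- ψ = - 2 v / (1 - v^2), up to cancellation of (1 + v)^2.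
  D-quotient : ∀ {v Q ψ} → D v ≈ v → Q * (1# + v) ≈ 1# - v →
               ψ * ((1# - v) * (1# + v)) ≈ - (v + v) →
               (D Q * (1# + v)) * (1# + v) ≈ (ψ * Q * (1# + v)) * (1# + v)
  D-quotient {v} {Q} {ψ} Dv Qw ψw = begin
    D Q * w * w                        ≈⟨ *-congʳ DQ*w ⟩
    (- v - Q * v) * w                  ≈⟨ distribʳ w (- v) (- (Q * v)) ⟩
    - v * w + - (Q * v) * w
      ≈⟨ +-cong (-‿distribˡ-* v w) (-‿distribˡ-* (Q * v) w) ⟨
    - (v * w) - Q * v * w
      ≈⟨ +-congˡ (-‿cong (trans (xy∙z≈xz∙y Q v w) (*-congʳ Qw))) ⟩
    - (v * w) - (1# - v) * v
      ≈⟨ +-cong (-‿cong (trans (distribˡ v 1# v) (+-congʳ (*-identityʳ v))))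
                (-‿cong (trans ([y-z]x≈yx-zx v 1# v) (+-congʳ (*-identityˡ v)))) ⟩
    - (v + v * v) - (v - v * v)
      ≈⟨ -‿+-comm _ _ ⟩
    - ((v + v * v) + (v - v * v))
      ≈⟨ -‿cong (interchange v (v * v) v (- (v * v))) ⟩
    - ((v + v) + (v * v - v * v))
      ≈⟨ -‿cong (trans (+-congˡ (-‿inverseʳ _)) (+-identityʳ _)) ⟩
    - (v + v)                          ≈⟨ ψw ⟨
    ψ * ((1# - v) * w)                 ≈⟨ *-congˡ (*-congʳ Qw) ⟨
    ψ * (Q * w * w)                    ≈⟨ trans (*-congʳ (*-assoc ψ Q w)) (*-assoc ψ (Q * w) w) ⟨
    ψ * Q * w * w                      ∎
    where
    w = 1# + v
    D-w : D w ≈ v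
    D-w = trans (D-+ 1# v) (trans (+-cong D-1 Dv) (+-identityˡ v))
    D-neg : ∀ x → D (- x) ≈ - D x
    D-neg x = RingProperties.+-inverseˡ-unique ring _ _
      (trans (sym (D-+ (- x) x)) (trans (D-cong (-‿inverseˡ x)) D-0))
    D-Qw : D (Q * w) ≈ 0# - v
    D-Qw = trans (D-cong Qw) (trans (D-+ 1# (- v)) (+-cong D-1 (trans (D-neg v) (-‿cong Dv))))
    DQ*w : D Q * w ≈ - v - Q * v
    DQ*w = begin
      D Q * w                          ≈⟨ +-identityʳ _ ⟨
      D Q * w + 0#                     ≈⟨ +-congˡ (-‿inverseʳ (Q * v)) ⟨
      D Q * w + (Q * v - Q * v)        ≈⟨ +-assoc _ _ _ ⟨
      D Q * w + Q * v - Q * v          ≈⟨ +-congʳ (+-congˡ (*-congˡ D-w)) ⟨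
      D Q * w + Q * D w - Q * v        ≈⟨ +-congʳ (D-* Q w) ⟨
      D (Q * w) - Q * v                ≈⟨ +-congʳ D-Qw ⟩
      0# - v - Q * v                   ≈⟨ +-congʳ (+-identityˡ _) ⟩
      - v - Q * v                      ∎

module ProductFormula (K : CommutativeRing 0ℓ 0ℓ)
  (_⁻¹ : CommutativeRing.Carrier K → CommutativeRing.Carrier K)
  (ι : ℚ → CommutativeRing.Carrier K)
  (alg : IsℚAlgebra (CommutativeRing.ring K) ι)
  where

  open CommutativeRing K hiding (zero)
  open VertexOperators K _⁻¹ ι
    using (odd; onOdds; 2/odd; F; ∏<; _÷_; pochhammer; u; 1ᵘ; _+ᵘ_; _*ᵘ_; -ᵘ_; _-ᵘ_)
  open CommutativePowerSeries K hiding (*ˢ-comm)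
  open SeriesProperties ring using (constant-*ˢ)
  open Quotients K
  open SeriesExponential ring alg using (θ; θ-isDerivation; θ-unique; θ-exp; exp-0)
  open ℚAlgebra ring alg using (ι-·; ι-+; ι-1)
  open Convolution ring using (∑<; ∑<-cong; ∑<-zero)
  open SemiringExp semiring using (_^_; ^-assocʳ)
  open SemiringMult semiring using ()
    renaming (_×_ to _·_; ×-assoc-* to ·-assoc-*; ×-congʳ to ·-congʳ)
  open RingProperties ring using (-‿distribʳ-*; -‿distribˡ-*; -‿+-comm)
  private
    module S = CommutativeRing seriesCommutativeRing
    module SC = Convolution S.ring
  open LogarithmicDerivatives seriesCommutativeRing θ-isDerivation
  open import Relation.Binary.Reasoning.Setoid setoid

  onOdds-odd : ∀ {a} {A : Set a} {z : A} x k → onOdds z x (odd k) ≡ x k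
  onOdds-odd x zero    = ≡.refl
  onOdds-odd {z = z} x (suc k) =
    ≡.trans (≡.cong (onOdds z x ∘ suc) (ℕ.*-suc 2 k)) (onOdds-odd (x ∘ suc) k)

  onOdds-even : ∀ {a} {A : Set a} {z : A} x k → onOdds z x (2 ℕ.* k) ≡ z
  onOdds-even x zero    = ≡.refl
  onOdds-even {z = z} x (suc k) =
    ≡.trans (≡.cong (onOdds z x) (ℕ.*-suc 2 k)) (onOdds-even (x ∘ suc) k)

  -- Every natural number is 2 k or odd k.
  data Parity : ℕ → Set where
    isEven : ∀ k → Parity (2 ℕ.* k)
    isOdd  : ∀ k → Parity (odd k)

  parity : ∀ n → Parity n
  parity zero = isEven 0
  parity (suc n) with parity n
  ... | isEven k = isOdd k
  ... | isOdd  k = ≡.subst Parity (ℕ.*-suc 2 k) (isEven (suc k))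

  -- The coefficient of u^(odd k) in ψ c
  ψ-coefficient : Carrier → ℕ → Carrier
  ψ-coefficient c k = - (c ^ odd k + c ^ odd k)

  -- The logarithmic derivative of (1 - c u) / (1 + c u)
  ψ : Carrier → Series
  ψ c = onOdds 0# (ψ-coefficient c)

  module _ (c : Carrier) where

    -- c u
    v : Series
    v = constant c *ᵘ u

    private
      -- Multiplication by c u shifts a series by one and scales it by c.
      v-shift : ∀ g n → (v *ˢ g) (suc n) ≈ c * g n
      v-shift g n = begin
        (v *ˢ g) (suc n)                          ≈⟨ S.*-assoc (constant c) u g (suc n) ⟩
        (constant c *ˢ (u *ˢ g)) (suc n)          ≈⟨ constant-*ˢ c (u *ˢ g) (suc n) ⟩
        c * (0# * g (suc n) + ((u ∘ suc) *ˢ g) n)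
          ≈⟨ *-congˡ (trans (+-congʳ (zeroˡ _)) (+-identityˡ _)) ⟩
        c * ((u ∘ suc) *ˢ g) n
          ≈⟨ *-congˡ (trans (S.*-congʳ {g} u∘suc n) (S.*-identityˡ g n)) ⟩
        c * g n                                   ∎
        where
        u∘suc : (u ∘ suc) ≈ˢ S.1#
        u∘suc zero    = refl
        u∘suc (suc n) = refl

      v-0 : v 0 ≈ 0#
      v-0 = zeroʳ c

      v-1 : v 1 ≈ c
      v-1 = trans (constant-*ˢ c u 1) (*-identityʳ c)

      v-2+ : ∀ n → v (suc (suc n)) ≈ 0#
      v-2+ n = trans (constant-*ˢ c u (suc (suc n))) (zeroʳ c)

      θv : θ v ≈ˢ v
      θv zero          = sym v-0
      θv (suc zero)    = +-identityʳ _
      θv (suc (suc n)) =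
        trans (·-congʳ (suc (suc n)) (v-2+ n)) (trans (·-0 (suc (suc n))) (sym (v-2+ n)))
        where
        ·-0 : ∀ n → n · 0# ≈ 0#
        ·-0 zero    = refl
        ·-0 (suc n) = trans (+-identityˡ _) (·-0 n)

      onOdds-step : ∀ {x y : ℕ → Carrier} (h : Carrier → Carrier) → h 0# ≈ 0# →
                    (∀ k → y k ≈ h (x k)) →
                    ∀ n → onOdds 0# y n ≈ h (onOdds 0# x n)
      onOdds-step h h-0 e zero          = sym h-0
      onOdds-step h h-0 e (suc zero)    = e 0
      onOdds-step h h-0 e (suc (suc n)) = onOdds-step h h-0 (e ∘ suc) n

      -- ψ c = - 2 c u - 2 c^3 u^3 - ... is a geometric series with ratio c^2 u^2.
      ψ-step : ∀ n → ψ c (suc (suc n)) ≈ c * (c * ψ c n)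
      ψ-step = onOdds-step (λ x → c * (c * x)) (trans (*-congˡ (zeroʳ c)) (zeroʳ c)) λ k → begin
        - (c ^ odd (suc k) + c ^ odd (suc k))
          ≡⟨ ≡.cong (λ n → - (c ^ suc n + c ^ suc n)) (ℕ.*-suc 2 k) ⟩
        - (c * (c * y k) + c * (c * y k))
          ≈⟨ -‿cong (trans (*-congˡ (distribˡ c (y k) (y k))) (distribˡ c _ _)) ⟨
        - (c * (c * (y k + y k)))
          ≈⟨ trans (*-congˡ (sym (-‿distribʳ-* c (y k + y k)))) (sym (-‿distribʳ-* c _)) ⟨
        c * (c * - (y k + y k)) ∎
        where
        y : ℕ → Carrier
        y k = c ^ odd k

      -- ψ (1 - v²) = - 2 v
      ψ-v : (ψ c *ˢ ((S.1# S.- v) *ˢ (S.1# +ˢ v))) ≈ˢ (-ˢ (v +ˢ v))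
      ψ-v n = trans (expand n) (at n)
        where
        g = ψ c
        vvg = v *ˢ (v *ˢ g)
        square : ((S.1# S.- v) *ˢ (S.1# +ˢ v)) ≈ˢ (S.1# S.- (v *ˢ v))
        square = difference-of-squares v
        expand : (g *ˢ ((S.1# S.- v) *ˢ (S.1# +ˢ v))) ≈ˢ (g S.- vvg)
        expand n = begin
          (g *ˢ ((S.1# S.- v) *ˢ (S.1# +ˢ v))) n   ≈⟨ S.*-congˡ {g} square n ⟩
          (g *ˢ (S.1# S.- (v *ˢ v))) n             ≈⟨ S.*-comm g (S.1# S.- (v *ˢ v)) n ⟩
          ((S.1# S.- (v *ˢ v)) *ˢ g) n
            ≈⟨ RingProperties.[y-z]x≈yx-zx S.ring g S.1# (v *ˢ v) n ⟩
          (S.1# *ˢ g) n - ((v *ˢ v) *ˢ g) n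
            ≈⟨ +-cong (S.*-identityˡ g n) (-‿cong (S.*-assoc v v g n)) ⟩
          g n - vvg n                              ∎
        at : ∀ n → g n - vvg n ≈ - (v n + v n)
        at zero = begin
          0# - v 0 * (v *ˢ g) 0      ≈⟨ +-congˡ (-‿cong (trans (*-congʳ v-0) (zeroˡ _))) ⟩
          0# - 0#                    ≈⟨ trans (+-identityˡ _) (-‿cong (sym (+-identityˡ 0#))) ⟩
          - (0# + 0#)                ≈⟨ -‿cong (+-cong v-0 v-0) ⟨
          - (v 0 + v 0)              ∎
        at (suc zero) = begin
          - (c * 1# + c * 1#) - vvg 1
            ≈⟨ +-cong (-‿cong (+-cong (*-identityʳ c) (*-identityʳ c)))
                 (-‿cong (trans (v-shift (v *ˢ g) 0)
                   (trans (*-congˡ (trans (*-congʳ v-0) (zeroˡ _))) (zeroʳ c)))) ⟩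
          - (c + c) - 0#
            ≈⟨ trans (+-congˡ (RingProperties.-0#≈0# ring)) (+-identityʳ _) ⟩
          - (c + c)                  ≈⟨ -‿cong (+-cong v-1 v-1) ⟨
          - (v 1 + v 1)              ∎
        at (suc (suc n)) = begin
          g (suc (suc n)) - vvg (suc (suc n))
            ≈⟨ +-cong (ψ-step n)
                      (-‿cong (trans (v-shift (v *ˢ g) (suc n)) (*-congˡ (v-shift g n)))) ⟩
          c * (c * g n) - c * (c * g n)    ≈⟨ -‿inverseʳ _ ⟩
          0#
            ≈⟨ trans (-‿cong (+-identityˡ 0#)) (RingProperties.-0#≈0# ring) ⟨
          - (0# + 0#)                      ≈⟨ -‿cong (+-cong (v-2+ n) (v-2+ n)) ⟨
          - (v (suc (suc n)) + v (suc (suc n))) ∎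

    -- (1 - c u) / (1 + c u)
    factor : Series
    factor = (1ᵘ -ᵘ v) ÷ (1ᵘ +ᵘ v)

    1+v-0 : (1ᵘ +ᵘ v) 0 ≈ 1#
    1+v-0 = trans (+-congˡ v-0) (+-identityʳ 1#)

    1-v-0 : (1ᵘ -ᵘ v) 0 ≈ 1#
    1-v-0 = trans (+-congˡ (trans (-‿cong v-0) (RingProperties.-0#≈0# ring))) (+-identityʳ 1#)

    factor-0 : factor 0 ≈ 1#
    factor-0 = begin
      factor 0                           ≈⟨ *-identityʳ _ ⟨
      factor 0 * 1#                      ≈⟨ *-congˡ 1+v-0 ⟨
      factor 0 * (1ᵘ +ᵘ v) 0             ≈⟨ quotient-* {1ᵘ +ᵘ v} 1+v-0 (1ᵘ -ᵘ v) 0 ⟩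
      (1ᵘ -ᵘ v) 0                        ≈⟨ 1-v-0 ⟩
      1#                                 ∎

    θ-factor : θ factor ≈ˢ (ψ c *ˢ factor)
    θ-factor = *ˢ-cancelʳ 1+v-0 {θ factor} {ψ c *ˢ factor}
      (*ˢ-cancelʳ 1+v-0 {θ factor *ˢ (1ᵘ +ᵘ v)} {(ψ c *ˢ factor) *ˢ (1ᵘ +ᵘ v)}
        (D-quotient {v} {factor} {ψ c} θv (quotient-* 1+v-0 (1ᵘ -ᵘ v)) ψ-v))

  geometric-sum : ∀ x M → (1# - x) * ∑< M (x ^_) ≈ 1# - x ^ M
  geometric-sum x zero = trans (zeroʳ _) (sym (-‿inverseʳ 1#))
  geometric-sum x (suc M) = begin
    (1# - x) * (1# + ∑< M (λ j → x * x ^ j))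
      ≈⟨ *-congˡ (+-congˡ (∑<-map ring ring (x *_) (zeroʳ x) (distribˡ x) (x ^_) M)) ⟨
    (1# - x) * (1# + x * ∑< M (x ^_))
      ≈⟨ trans (distribˡ _ _ _) (+-congʳ (*-identityʳ _)) ⟩
    (1# - x) + (1# - x) * (x * ∑< M (x ^_))
      ≈⟨ +-congˡ (trans (x∙yz≈y∙xz _ _ _) (*-congˡ (geometric-sum x M))) ⟩
    (1# - x) + x * (1# - x ^ M)
      ≈⟨ +-congˡ (trans (distribˡ x 1# _) (+-cong (*-identityʳ x) (sym (-‿distribʳ-* x _)))) ⟩
    (1# - x) + (x - x * x ^ M)
      ≈⟨ trans (+-assoc _ _ _) (+-congˡ (sym (+-assoc _ _ _))) ⟩
    1# + ((- x + x) - x * x ^ M)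
      ≈⟨ +-congˡ (trans (+-congʳ (-‿inverseˡ x)) (+-identityˡ _)) ⟩
    1# - x * x ^ M ∎
    where open CommutativeSemigroupProperties *-commutativeSemigroup using (x∙yz≈y∙xz)

  module _ (t : Carrier)
    (t-inverse : ∀ (k : ℕ) → (1# - t ^ odd k) * (1# - t ^ odd k) ⁻¹ ≈ 1#) (M : ℕ) where

    private
      -- The coefficient of u^(odd k) in the exponent of F_{t,t^M}(u)
      logF : ℕ → Carrier
      logF k = - (2/odd k * ((1# - (t ^ M) ^ odd k) * (1# - t ^ odd k) ⁻¹))

      -- t^n for n = odd k
      x : ℕ → Carrier
      x k = t ^ odd k

      Q : ℕ → Series
      Q j = factor (t ^ j)

      ^-swap : ∀ m n → (t ^ m) ^ n ≈ (t ^ n) ^ m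
      ^-swap m n = trans (^-assocʳ t m n) (trans (reflexive (≡.cong (t ^_) (ℕ.*-comm m n)))
                     (sym (^-assocʳ t n m)))

      -- (1 - t^{Mn}) / (1 - t^n) = ∑_{j < M} t^{jn} for n = odd k
      quotient-sum : ∀ k → (1# - (t ^ M) ^ odd k) * (1# - t ^ odd k) ⁻¹ ≈ ∑< M (x k ^_)
      quotient-sum k = begin
        (1# - (t ^ M) ^ odd k) * y
          ≈⟨ *-congʳ (+-congˡ (-‿cong (^-swap M (odd k)))) ⟩
        (1# - x k ^ M) * y                          ≈⟨ *-congʳ (geometric-sum (x k) M) ⟨
        (1# - x k) * ∑< M (x k ^_) * y              ≈⟨ xy∙z≈xz∙y _ _ _ ⟩
        (1# - x k) * y * ∑< M (x k ^_)              ≈⟨ *-congʳ (t-inverse k) ⟩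
        1# * ∑< M (x k ^_)                          ≈⟨ *-identityˡ _ ⟩
        ∑< M (x k ^_)                               ∎
        where
        y = (1# - t ^ odd k) ⁻¹
        open CommutativeSemigroupProperties *-commutativeSemigroup using (xy∙z≈xz∙y)

      odd·2/odd : ∀ k → odd k · 2/odd k ≈ 1# + 1#
      odd·2/odd k = begin
        odd k · ι (+ 2 ℚ./ odd k)               ≈⟨ ι-· (odd k) (+ 2 ℚ./ odd k) ⟨
        ι (odd k Fractions.×ℚ (+ 2 ℚ./ odd k))
          ≡⟨ ≡.cong ι (≡.trans (Fractions.×-/ (odd k) 2 (odd k))
               (Fractions./-≡ (odd k ℕ.* 2) 2 (odd k) 1
                 (≡.trans (ℕ.*-identityʳ _) (ℕ.*-comm (odd k) 2)))) ⟩
        ι (1ℚ ℚ.+ 1ℚ)                           ≈⟨ trans (ι-+ 1ℚ 1ℚ) (+-cong ι-1 ι-1) ⟩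
        1# + 1#                                 ∎

      -- The sum of the logarithmic derivatives of the factors
      ∑ψ : Series
      ∑ψ = SC.∑< M (λ j → ψ (t ^ j))

      ∑ψ-at : ∀ n → ∑ψ n ≈ ∑< M (λ j → ψ (t ^ j) n)
      ∑ψ-at n = ∑<-map S.ring ring (λ f → f n) refl (λ _ _ → refl) (λ j → ψ (t ^ j)) M

      θ-logF : θ (onOdds 0# logF) ≈ˢ ∑ψ
      θ-logF n = by-parity (parity n)
        where
        double : Carrier → Carrier
        double y = - (y + y)

        double-+ : ∀ y z → double (y + z) ≈ double y + double z
        double-+ y z = trans (-‿cong (interchange _ _ _ _)) (sym (-‿+-comm _ _))
          where open CommutativeSemigroupProperties +-commutativeSemigroup using (interchange)

        double-0 : double 0# ≈ 0#
        double-0 = trans (-‿cong (+-identityˡ 0#)) (RingProperties.-0#≈0# ring)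

        ·-0 : ∀ n → n · 0# ≈ 0#
        ·-0 zero    = refl
        ·-0 (suc n) = trans (+-identityˡ _) (·-0 n)

        by-parity : ∀ {n} → Parity n → n · onOdds 0# logF n ≈ ∑ψ n
        by-parity (isEven k) = begin
          (2 ℕ.* k) · onOdds 0# logF (2 ℕ.* k)
            ≡⟨ ≡.cong ((2 ℕ.* k) ·_) (onOdds-even logF k) ⟩
          (2 ℕ.* k) · 0#                              ≈⟨ ·-0 (2 ℕ.* k) ⟩
          0#
            ≈⟨ ∑<-zero M (λ j → reflexive (onOdds-even (ψ-coefficient (t ^ j)) k)) ⟨
          ∑< M (λ j → ψ (t ^ j) (2 ℕ.* k))          ≈⟨ ∑ψ-at (2 ℕ.* k) ⟨
          ∑ψ (2 ℕ.* k)                              ∎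
        by-parity (isOdd k) = begin
          odd k · onOdds 0# logF (odd k)            ≡⟨ ≡.cong (odd k ·_) (onOdds-odd logF k) ⟩
          odd k · - (2/odd k * y)                   ≈⟨ ·-congʳ (odd k) (-‿distribʳ-* _ _) ⟩
          odd k · (2/odd k * - y)                   ≈⟨ ·-assoc-* (odd k) _ _ ⟨
          (odd k · 2/odd k) * - y                   ≈⟨ *-congʳ (odd·2/odd k) ⟩
          (1# + 1#) * - y                           ≈⟨ sym (-‿distribʳ-* _ _) ⟩
          - ((1# + 1#) * y)
            ≈⟨ -‿cong (trans (distribʳ y 1# 1#) (+-cong (*-identityˡ y) (*-identityˡ y))) ⟩
          double y
            ≈⟨ -‿cong (+-cong (quotient-sum k) (quotient-sum k)) ⟩
          double (∑< M (x k ^_))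
            ≈⟨ ∑<-map ring ring double double-0 double-+ (x k ^_) M ⟩
          ∑< M (λ j → double (x k ^ j))
            ≈⟨ ∑<-cong M (λ j → -‿cong (+-cong (^-swap (odd k) j) (^-swap (odd k) j))) ⟩
          ∑< M (λ j → double ((t ^ j) ^ odd k))
            ≈⟨ ∑<-cong M (λ j → reflexive (onOdds-odd (ψ-coefficient (t ^ j)) k)) ⟨
          ∑< M (λ j → ψ (t ^ j) (odd k))            ≈⟨ ∑ψ-at (odd k) ⟨
          ∑ψ (odd k)                                ∎
          where y = (1# - (t ^ M) ^ odd k) * (1# - t ^ odd k) ⁻¹

    -- Both sides have logarithmic derivative ∑ψ and constant term 1.
    F-product : F t (t ^ M) ≈ˢ ∏< M Q
    F-product = θ-unique {∑ψ} {F t (t ^ M)} {∏< M Q} ∑ψ-0 θF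
      (D-product M Q (λ j → ψ (t ^ j)) (λ j → θ-factor (t ^ j)))
      (trans (exp-0 (onOdds 0# logF)) (sym (∏-0 M Q (λ j → factor-0 (t ^ j)))))
      where
      ∑ψ-0 : ∑ψ 0 ≈ 0#
      ∑ψ-0 = trans (∑ψ-at 0) (∑<-zero M (λ _ → refl))
      θF : θ (F t (t ^ M)) ≈ˢ (∑ψ *ˢ F t (t ^ M))
      θF = S.trans {θ (F t (t ^ M))} {θ (onOdds 0# logF) *ˢ F t (t ^ M)}
             (θ-exp {onOdds 0# logF} refl (λ i j → *-comm _ _))
             (S.*-congʳ {F t (t ^ M)} θ-logF)

  product-pochhammer : ∀ t M →
    ∏< M (λ j → factor (t ^ j)) ≈ˢ (pochhammer u t M ÷ pochhammer (-ᵘ u) t M)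
  product-pochhammer t M = S.trans {∏< M (λ j → factor (t ^ j))} {∏< M f ÷ ∏< M g}
    (∏-quotient M {f} {g} (λ j → 1+v-0 (t ^ j)))
    (quotient-cong {∏< M f} {pochhammer u t M} (∏-0 M g (λ j → 1+v-0 (t ^ j)))
      (∏-cong M f≈) (∏-cong M g≈))
    where
    f g : ℕ → Series
    f j = 1ᵘ -ᵘ v (t ^ j)
    g j = 1ᵘ +ᵘ v (t ^ j)
    f≈ : ∀ j → f j ≈ˢ (1ᵘ -ᵘ u *ᵘ constant (t ^ j))
    f≈ j n = +-congˡ (-‿cong (S.*-comm (constant (t ^ j)) u n))
    g≈ : ∀ j → g j ≈ˢ (1ᵘ -ᵘ (-ᵘ u) *ᵘ constant (t ^ j))
    g≈ j n = +-congˡ (begin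
      v (t ^ j) n                          ≈⟨ S.*-comm (constant (t ^ j)) u n ⟩
      (u *ᵘ constant (t ^ j)) n            ≈⟨ RingProperties.-‿involutive ring _ ⟨
      - - (u *ᵘ constant (t ^ j)) n
        ≈⟨ -‿cong (RingProperties.-‿distribˡ-* S.ring u (constant (t ^ j)) n) ⟩
      - ((-ᵘ u) *ᵘ constant (t ^ j)) n     ∎)

-- The product of two vertex operators

-- The conjunction of the three identities in question, as a predicate on the
-- operations that occur in them.  The identities are proved over an arbitrary
-- commutative ℚ-algebra K; as the operations are parameters, the result is carried
-- over to K = ℚ(t) operation by operation.
record Factorization
  {Scalar Series Distribution Distribution₂ : Set}
  (Summable : Distribution₂ → Set)
  (𝒴 : Scalar → Distribution)
  (_⊙_ : Distribution → Distribution → Distribution₂)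
  (_≈ᵈ_ : Distribution₂ → Distribution₂ → Set)
  (scaleBy : Series → (P : Distribution₂) → Summable P → Distribution₂)
  (normalOrdered : Scalar → Scalar → Distribution₂)
  (normalOrdered-summable : ∀ r s → Summable (normalOrdered r s))
  (F : Scalar → Scalar → Series)
  (_≈ᵘ_ : Series → Series → Set)
  (∏< : ℕ → (ℕ → Series) → Series)
  (pochhammer : Series → Scalar → ℕ → Series)
  (_÷_ _+ᵘ_ _-ᵘ_ _*ᵘ_ : Series → Series → Series)
  (-ᵘ_ : Series → Series)
  (1ᵘ u : Series)
  (constant : Scalar → Series)
  (_^_ : Scalar → ℕ → Scalar)
  (t : Scalar) (M : ℕ) : Set where
  field
    commutation : (𝒴 t ⊙ 𝒴 (t ^ M)) ≈ᵈ
      scaleBy (pochhammer u t M ÷ pochhammer (-ᵘ u) t M)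
              (normalOrdered t (t ^ M)) (normalOrdered-summable t (t ^ M))
    F-product : F t (t ^ M) ≈ᵘ
      ∏< M (λ j → (1ᵘ -ᵘ (constant (t ^ j) *ᵘ u)) ÷ (1ᵘ +ᵘ (constant (t ^ j) *ᵘ u)))
    product-pochhammer :
      ∏< M (λ j → (1ᵘ -ᵘ (constant (t ^ j) *ᵘ u)) ÷ (1ᵘ +ᵘ (constant (t ^ j) *ᵘ u))) ≈ᵘ
      (pochhammer u t M ÷ pochhammer (-ᵘ u) t M)

module NormalOrdering (K : CommutativeRing 0ℓ 0ℓ)
  (_⁻¹ : CommutativeRing.Carrier K → CommutativeRing.Carrier K)
  (ι : ℚ → CommutativeRing.Carrier K)
  (alg : IsℚAlgebra (CommutativeRing.ring K) ι)
  where

  open VertexOperators K _⁻¹ ι public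
  open Operator
  open Heisenberg K _⁻¹ ι alg
  open Exponential operatorRing (scalar ∘ ι) using (exp)
  open SeriesExponential₂ operatorRing operator-ℚAlgebra using (exp₂-split)
  private
    module K = CommutativeRing K
    module G = CommutativeRing Γ-commutativeRing
    module OC = Convolution operatorRing
    open SemiringExp K.semiring using (_^_)
  open Convolution G.ring
  open import Relation.Binary.Reasoning.Setoid G.setoid

  apply-∑< : ∀ T u n → apply T (∑< n u) ≈ ∑< n (apply T ∘ u)
  apply-∑< T u n = ∑<-map G.ring G.ring (apply T) (apply-0 T) (additive T) u n

  apply-conv : ∀ T x n → apply T (conv x n) ≈ conv (λ i j → apply T (x i j)) n
  apply-conv T x n = conv-map G.ring G.ring (apply T) (additive T) x n

  conv-apply : ∀ x n f → apply (OC.conv x n) f ≈ conv (λ i j → apply (x i j) f) n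
  conv-apply x n f = conv-map operatorRing G.ring (λ T → apply T f) (λ _ _ → ≈-refl) x n

  -- The infinite sum at f, computed with any bound.
  ∑∞-bound : ∀ T fin f N → (∀ n → N ℕ.≤ n → apply (T n) f ≈ con K.0#) →
             apply (∑∞ T fin) f ≈ ∑< N (λ n → apply (T n) f)
  ∑∞-bound T fin f N e = sum-unique (λ n → apply (T n) f) (fin f .proj₁) N (fin f .proj₂) e

  ∑<-conv : ∀ (x : ℕ → ℕ → ℕ → Γ) N n →
            ∑< N (λ j → conv (λ k l → x k l j) n) ≈ conv (λ k l → ∑< N (x k l)) n
  ∑<-conv x N zero    = ≈-refl
  ∑<-conv x N (suc n) = ≈-trans
    (∑<-+ (x 0 (suc n)) (λ j → conv (λ k l → x (suc k) l j) n) N)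
    (⊕-cong ≈-refl (∑<-conv (x ∘ suc) N n))

  expA₂-split : ∀ r s a b → (expA₂ r s ⟨ a ∣ b ⟩) ≈ᵒ ((exp (A r) ⟨ a ⟩) ∘ᵒ (exp (A s) ⟨ b ⟩))
  expA₂-split r s (+ i) (+ j) =
    exp₂-split (λ _ → ≈-refl) (λ _ → ≈-refl) (A-commuting r r) (A-commuting r s) i j
  expA₂-split r s (+ i) -[1+ _ ] f = ≈-sym (apply-0 (exp (A r) i))
  expA₂-split r s -[1+ _ ] b f = ≈-refl

  expB₂-split : ∀ r s i j → expB₂ r s i j ≈ᵒ (exp (B r) i ∘ᵒ exp (B s) j)
  expB₂-split r s =
    exp₂-split (λ _ → ≈-refl) (λ _ → ≈-refl) (B-commuting r r) (B-commuting r s)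

  ⟨⟩-negative : ∀ g {m} → m ℤ.< + 0 → (g ⟨ m ⟩) ≈ᵒ 0ᵒ
  ⟨⟩-negative g (ℤ.-<+) f = ≈-refl
  ⟨⟩-negative g (ℤ.+<+ ()) f

  b-k+j<0 : ∀ b k j → ℤ.∣ b ∣ ℕ.+ j ℕ.< k → b ℤ.- + k ℤ.+ + j ℤ.< + 0
  b-k+j<0 b k j lt = ℤ.≤-<-trans
    (ℤ.+-monoˡ-≤ (+ j) (ℤ.+-monoˡ-≤ (ℤ.- + k) (i≤∣i∣ b)))
    (≡.subst (ℤ._< + 0) (≡.sym (≡.trans
        (≡.cong (ℤ._+ + j) (ℤ.+-comm (+ ℤ.∣ b ∣) (ℤ.- + k)))
        (ℤ.+-assoc (ℤ.- + k) (+ ℤ.∣ b ∣) (+ j))))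
      (ℤ.<-≤-trans (ℤ.+-monoʳ-< (ℤ.- + k) (ℤ.+<+ lt)) (ℤ.≤-reflexive (ℤ.+-inverseˡ (+ k)))))
    where
    i≤∣i∣ : ∀ i → i ℤ.≤ + ℤ.∣ i ∣
    i≤∣i∣ (+ n)    = ℤ.≤-refl
    i≤∣i∣ -[1+ n ] = ℤ.-≤+

  private module _ (r s : K.Carrier) (a b : ℤ) (f : Γ) where

    -- The coefficients of e^{A_r(z)} and e^{A_s(w)}
    Ar As : ℤ → Operator
    Ar m = exp (A r) ⟨ m ⟩
    As m = exp (A s) ⟨ m ⟩

    -- The coefficients of e^B of degree at least N vanish at f, and so do the
    -- contributions of the powers of w/z of degree at least N′.
    N N′ : ℕ
    N  = suc (degree f)
    N′ = suc (ℤ.∣ b ∣ ℕ.+ degree f)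

    z-degree w-degree : ℕ → ℕ → ℤ
    z-degree k l = (a ℤ.+ + k) ℤ.+ + l
    w-degree k j = (b ℤ.- + k) ℤ.+ + j

    -- The coefficient of z^a w^b in F_{r,s}(w/z) :𝒴(z;r) 𝒴(w;s):, applied to f, is the
    -- sum over k, l, j of F_k t k l j, where k is the exponent of w/z, and
    -- z^(-l) w^(-j) is the monomial from e^B.
    t : ℕ → ℕ → ℕ → Γ
    t k l j = apply (Ar (z-degree k l)) (apply (As (w-degree k j))
                (apply (exp (B r) l) (apply (exp (B s) j) f)))

    -- ∑_j F_k t k l j
    x : ℕ → ℕ → Γ
    x k l = ∑< N (λ j → con (F r s k) ⊗ t k l j)

    vanish : ∀ T {g} → g ≈ con K.0# → apply T g ≈ con K.0#
    vanish T e = ≈-trans (cong T e) (apply-0 T)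

    t-j≥N : ∀ k l j → N ℕ.≤ j → t k l j ≈ con K.0#
    t-j≥N k l j N≤j = vanish (Ar (z-degree k l)) (vanish (As (w-degree k j)) (vanish (exp (B r) l)
                        (expB-locallyFinite s f .proj₂ j N≤j)))

    t-l≥N : ∀ k l j → N ℕ.≤ l → t k l j ≈ con K.0#
    t-l≥N k l j N≤l = vanish (Ar (z-degree k l)) (vanish (As (w-degree k j))
      (≈-trans (≈-sym (expB₂-split r s l j f)) (expB₂-locallyFinite r s f .proj₂ l j (inj₁ N≤l))))

    t-k≥N′ : ∀ k l j → N′ ℕ.≤ k → t k l j ≈ con K.0#
    t-k≥N′ k l j N′≤k = by-cases (j ℕ.<? N)
      where
      by-cases : Dec (j ℕ.< N) → t k l j ≈ con K.0#
      by-cases (no  j≮N)       = t-j≥N k l j (ℕ.≮⇒≥ j≮N)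
      by-cases (yes (s≤s j≤d)) = vanish (Ar (z-degree k l)) (⟨⟩-negative (exp (A s))
        (b-k+j<0 b k j (ℕ.≤-trans (s≤s (ℕ.+-monoʳ-≤ ℤ.∣ b ∣ j≤d)) N′≤k))
        (apply (exp (B r) l) (apply (exp (B s) j) f)))

    x-zero : ∀ k l → N′ ℕ.≤ k ⊎ N ℕ.≤ l → x k l ≈ con K.0#
    x-zero k l e = ∑<-zero N λ j → ≈-trans (⊗-cong ≈-refl (t-zero j e)) (G.zeroʳ (con (F r s k)))
      where
      t-zero : ∀ j → N′ ℕ.≤ k ⊎ N ℕ.≤ l → t k l j ≈ con K.0#
      t-zero j (inj₁ N′≤k) = t-k≥N′ k l j N′≤k
      t-zero j (inj₂ N≤l)  = t-l≥N k l j N≤l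

    -- After e^{B_r(z)} is moved past e^{A_s(w)}, the summand of 𝒴(z;r) with z^(-i)
    -- from e^B is the sum of the x k l with k + l = i.
    left-summand : ∀ i → apply (Ar (a ℤ.+ + i) ∘ᵒ exp (B r) i) (apply (𝒴 s b) f) ≈ conv x i
    left-summand i = begin
      apply T (∑< N (λ j → apply (As (b ℤ.+ + j)) (apply (exp (B s) j) f)))
        ≈⟨ apply-∑< T (λ j → apply (As (b ℤ.+ + j)) (apply (exp (B s) j) f)) N ⟩
      ∑< N (λ j → apply T (apply (As (b ℤ.+ + j)) (apply (exp (B s) j) f)))
        ≈⟨ ∑<-cong N term ⟩
      ∑< N (λ j → conv (λ k l → con (F r s k) ⊗ t k l j) i)
        ≈⟨ ∑<-conv (λ k l j → con (F r s k) ⊗ t k l j) N i ⟩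
      conv x i ∎
      where
      T = Ar (a ℤ.+ + i) ∘ᵒ exp (B r) i

      moved : ℕ → ℕ → ℕ → Γ
      moved j k l = con (F r s k) ⊗ apply (As ((b ℤ.+ + j) ℤ.- + k))
                      (apply (exp (B r) l) (apply (exp (B s) j) f))

      index₁ : ∀ k l → a ℤ.+ + (k ℕ.+ l) ≡ (a ℤ.+ + k) ℤ.+ + l
      index₁ k l = ≡.sym (ℤ.+-assoc a (+ k) (+ l))

      index₂ : ∀ j k → (b ℤ.+ + j) ℤ.- + k ≡ (b ℤ.- + k) ℤ.+ + j
      index₂ j k = ≡.trans (ℤ.+-assoc b (+ j) (ℤ.- + k))
        (≡.trans (≡.cong (λ n → b ℤ.+ n) (ℤ.+-comm (+ j) (ℤ.- + k)))
          (≡.sym (ℤ.+-assoc b (ℤ.- + k) (+ j))))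

      term : ∀ j → apply T (apply (As (b ℤ.+ + j)) (apply (exp (B s) j) f)) ≈
                   conv (λ k l → con (F r s k) ⊗ t k l j) i
      term j = begin
        apply (Ar (a ℤ.+ + i)) (apply (exp (B r) i ∘ᵒ As (b ℤ.+ + j)) g)
          ≈⟨ cong (Ar (a ℤ.+ + i))
               (≈-trans (expB-expA r s i (b ℤ.+ + j) g) (conv-apply moved-operator i g)) ⟩
        apply (Ar (a ℤ.+ + i)) (conv (moved j) i)
          ≈⟨ apply-conv (Ar (a ℤ.+ + i)) (moved j) i ⟩
        conv (λ k l → apply (Ar (a ℤ.+ + i)) (moved j k l)) i
          ≈⟨ conv-cong i (λ { k l ≡.refl → ≈-trans (homogeneous (Ar (a ℤ.+ + i)) (F r s k)
                  (apply (As ((b ℤ.+ + j) ℤ.- + k)) (apply (exp (B r) l) g)))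
               (⊗-cong ≈-refl (G.reflexive (≡.cong₂
                 (λ m n → apply (Ar m) (apply (As n) (apply (exp (B r) l) g)))
                 (index₁ k l) (index₂ j k)))) }) ⟩
        conv (λ k l → con (F r s k) ⊗ t k l j) i ∎
        where
        g = apply (exp (B s) j) f
        moved-operator : ℕ → ℕ → Operator
        moved-operator k l = (scalar (F r s k) ∘ᵒ As ((b ℤ.+ + j) ℤ.- + k)) ∘ᵒ exp (B r) l

    left≈∑ : apply (𝒴 r a ∘ᵒ 𝒴 s b) f ≈ ∑< N′ (λ k → ∑< N (x k))
    left≈∑ = begin
      apply (𝒴 r a) g
        ≈⟨ ∑∞-bound (λ j → Ar (a ℤ.+ + j) ∘ᵒ exp (B r) j)
             (∘-locallyFinite (λ j → Ar (a ℤ.+ + j)) (exp (B r)) (expB-locallyFinite r))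
             g (N′ ℕ.+ N)
             (λ i N′+N≤i → ≈-trans (left-summand i) (conv-zero i λ k l k+l≡i →
               x-zero k l (large k l (≡.subst (N′ ℕ.+ N ℕ.≤_) (≡.sym k+l≡i) N′+N≤i)))) ⟩
      ∑< (N′ ℕ.+ N) (λ i → apply (Ar (a ℤ.+ + i) ∘ᵒ exp (B r) i) g)
        ≈⟨ ∑<-cong (N′ ℕ.+ N) left-summand ⟩
      ∑< (N′ ℕ.+ N) (conv x)
        ≈⟨ conv-rectangle x N′ N x-zero ⟩
      ∑< N′ (λ k → ∑< N (x k)) ∎
      where
      g = apply (𝒴 s b) f
      large : ∀ k l → N′ ℕ.+ N ℕ.≤ k ℕ.+ l → N′ ℕ.≤ k ⊎ N ℕ.≤ l
      large k l le with N′ ℕ.≤? k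
      ... | yes N′≤k = inj₁ N′≤k
      ... | no  N′≰k = inj₂ (ℕ.+-cancelˡ-≤ N′ N l
              (ℕ.≤-trans le (ℕ.+-monoˡ-≤ l (ℕ.<⇒≤ (ℕ.≰⇒> N′≰k)))))

    right≈∑ : ∀ c → (∀ k → F r s k K.≈ c k) →
              apply (scaleBy c (normalOrdered r s) (normalOrdered-summable r s) a b) f ≈
              ∑< N′ (λ k → ∑< N (x k))
    right≈∑ c F≈c = ∑<-cong N′ λ k → begin
      con (c k) ⊗ ∑< N (λ l → ∑< N (λ j →
        apply (expA₂ r s ⟨ z-degree k l ∣ w-degree k j ⟩) (apply (expB₂ r s l j) f)))
        ≈⟨ ⊗-cong (con-cong (K.sym (F≈c k))) (∑<-cong N λ l → ∑<-cong N λ j →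
             ≈-trans (expA₂-split r s (z-degree k l) (w-degree k j) (apply (expB₂ r s l j) f))
               (cong (Ar (z-degree k l) ∘ᵒ As (w-degree k j)) (expB₂-split r s l j f))) ⟩
      con (F r s k) ⊗ ∑< N (λ l → ∑< N (t k l))
        ≈⟨ apply-∑< (scalar (F r s k)) (λ l → ∑< N (t k l)) N ⟩
      ∑< N (λ l → con (F r s k) ⊗ ∑< N (t k l))
        ≈⟨ ∑<-cong N (λ l → apply-∑< (scalar (F r s k)) (t k l) N) ⟩
      ∑< N (x k) ∎

  -- 𝒴(z;r) 𝒴(w;s) = F_{r,s}(w/z) :𝒴(z;r) 𝒴(w;s):, for any c equal to F_{r,s}
  𝒴-𝒴 : ∀ r s c → (∀ k → F r s k K.≈ c k) →
    𝒴 r ⊙ 𝒴 s ≈ᵈ scaleBy c (normalOrdered r s) (normalOrdered-summable r s)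
  𝒴-𝒴 r s c F≈c a b f = ≈-trans (left≈∑ r s a b f) (≈-sym (right≈∑ r s a b f c F≈c))

  open ProductFormula K _⁻¹ ι alg using (factor)
  open Quotients K using (∏-cong)

  -- t is such that 1 - t^n is invertible for odd n, and _^′_ computes powers.
  factorization : ∀ (_^′_ : K.Carrier → ℕ → K.Carrier) → (∀ x n → x ^′ n ≡ x ^ n) →
    ∀ t → (∀ k → (K.1# K.- t ^ odd k) K.* (K.1# K.- t ^ odd k) ⁻¹ K.≈ K.1#) → ∀ M →
    Factorization Summable 𝒴 _⊙_ _≈ᵈ_ scaleBy normalOrdered normalOrdered-summable F _≈ᵘ_ ∏<
      pochhammer _÷_ _+ᵘ_ _-ᵘ_ _*ᵘ_ -ᵘ_ 1ᵘ u constant _^′_ t M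
  factorization _^′_ ^′≡^ t t-inverse M = record
    { commutation        = commutation
    ; F-product          = F-product
    ; product-pochhammer = product-pochhammer }
    where
    module P = ProductFormula K _⁻¹ ι alg

    -- (1 - t^j u) / (1 + t^j u)
    factors : ℕ → ScalarSeries
    factors j = (1ᵘ -ᵘ (constant (t ^′ j) *ᵘ u)) ÷ (1ᵘ +ᵘ (constant (t ^′ j) *ᵘ u))

    factors-≡ : ∀ j → factors j ≡ factor (t ^ j)
    factors-≡ j = ≡.cong factor (^′≡^ t j)

    factors-∏ : ∀ n → ∏< M factors n K.≈ ∏< M (λ j → factor (t ^ j)) n
    factors-∏ = ∏-cong M (λ j n → K.reflexive (≡.cong (λ f → f n) (factors-≡ j)))

    F-product : ∀ n → F t (t ^′ M) n K.≈ ∏< M factors n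
    F-product n = K.trans (K.reflexive (≡.cong (λ s → F t s n) (^′≡^ t M)))
      (K.trans (P.F-product t t-inverse M n) (K.sym (factors-∏ n)))

    product-pochhammer : ∀ n → ∏< M factors n K.≈ (pochhammer u t M ÷ pochhammer (-ᵘ u) t M) n
    product-pochhammer n = K.trans (factors-∏ n) (P.product-pochhammer t M n)

    F-pochhammer : ∀ n → F t (t ^′ M) n K.≈ (pochhammer u t M ÷ pochhammer (-ᵘ u) t M) n
    F-pochhammer n = K.trans (F-product n) (product-pochhammer n)

    commutation : 𝒴 t ⊙ 𝒴 (t ^′ M) ≈ᵈ scaleBy (pochhammer u t M ÷ pochhammer (-ᵘ u) t M)
                    (normalOrdered t (t ^′ M)) (normalOrdered-summable t (t ^′ M))
    commutation = 𝒴-𝒴 t (t ^′ M) _ F-pochhammer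

-- The field ℚ(t)

module FunctionField where

  open RationalFunctions
    using (ℚ⟨t⟩; t; fromℚ; _⁻¹ᶠ; ⁻¹ᶠ-inverseʳ; Fraction; polynomialRing; Polynomial)
  open Fraction
  open Polynomial
  private
    module Q = CommutativeRing ℚ⟨t⟩
    module P = CommutativeRing polynomialRing
    module S = CommutativePowerSeries ℚ.+-*-commutativeRing
    open SemiringExp Q.semiring using (_^_)

  open SeriesProperties (CommutativeRing.ring ℚ.+-*-commutativeRing) using (constant-*ˢ)

  -- Fractions with equal numerators and equal denominators are equal.
  ≈-fraction : ∀ {x y} → num x P.≈ num y → den x P.≈ den y → x Q.≈ y
  ≈-fraction {x} {y} e e′ =
    P.*-cong {num x} {num y} {den y} {den x} e (P.sym {den x} {den y} e′)

  fromℚ-ℚAlgebra : IsℚAlgebra Q.ring fromℚ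
  fromℚ-ℚAlgebra = record
    { ι-+     = λ p q → ≈-fraction {fromℚ (p ℚ.+ q)} {fromℚ p Q.+ fromℚ q} (num-+ p q) 1≈1*1
    ; ι-*     = λ p q → ≈-fraction {fromℚ (p ℚ.* q)} {fromℚ p Q.* fromℚ q} (num-* p q) 1≈1*1
    ; ι-1     = λ _ → ≡.refl
    ; central = λ q x → Q.*-comm (fromℚ q) x }
    where
    1≈1*1 : P.1# P.≈ P.1# P.* P.1#
    1≈1*1 = P.sym {P.1# P.* P.1#} {P.1#} (P.*-identityˡ P.1#)
    num-+ : ∀ p q → num (fromℚ (p ℚ.+ q)) P.≈ num (fromℚ p Q.+ fromℚ q)
    num-+ p q = P.trans {n (p ℚ.+ q)} {n p P.+ n q} {num (fromℚ p Q.+ fromℚ q)}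
      (λ { zero → ≡.refl ; (suc _) → ≡.refl })
      (P.sym {num (fromℚ p Q.+ fromℚ q)} {n p P.+ n q}
        (P.+-cong {n p P.* P.1#} {n p} {n q P.* P.1#} {n q}
          (P.*-identityʳ (n p)) (P.*-identityʳ (n q))))
      where
      n : ℚ → Polynomial
      n q = num (fromℚ q)
    num-* : ∀ p q → num (fromℚ (p ℚ.* q)) P.≈ num (fromℚ p Q.* fromℚ q)
    num-* p q zero    = ≡.refl
    num-* p q (suc n) = ≡.sym (≡.trans (constant-*ˢ p (S.constant q) (suc n)) (ℚ.*-zeroʳ p))

  -- The constant terms of the numerator and the denominator of t^m
  num-t^ : ∀ m → coeff (num (t ^ suc m)) 0 ≡ 0ℚ
  num-t^ m = ℚ.*-zeroˡ (coeff (num (t ^ m)) 0)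

  den-t^ : ∀ m → coeff (den (t ^ m)) 0 ≡ 1ℚ
  den-t^ zero    = ≡.refl
  den-t^ (suc m) = ≡.trans (ℚ.*-identityˡ _) (den-t^ m)

  -- At t = 0, 1 - t^m is 1 for m > 0.
  1-t^≉0 : ∀ m → ¬ (Q.1# Q.- t ^ suc m Q.≈ Q.0#)
  1-t^≉0 m e = refute (num-t^ m) (den-t^ (suc m)) (e 0)
    where
    -- The constant terms of the cross-multiplied equation
    refute : ∀ {n d} → n ≡ 0ℚ → d ≡ 1ℚ →
             ¬ ((1ℚ ℚ.* d ℚ.+ (ℚ.- n) ℚ.* 1ℚ) ℚ.* 1ℚ ≡ 0ℚ ℚ.* (1ℚ ℚ.* d))
    refute ≡.refl ≡.refl ()

  1-t^-inverse : ∀ m → (Q.1# Q.- t ^ suc m) Q.* ((Q.1# Q.- t ^ suc m) ⁻¹ᶠ) Q.≈ Q.1#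
  1-t^-inverse m = ⁻¹ᶠ-inverseʳ (Q.1# Q.- t ^ suc m) (1-t^≉0 m)

open import Defs
open import Data.Nat.Base using (ℕ; _≤_)
open import Data.Product.Base using (_×_)

theorem4p1 : (M : ℕ) → 1 ≤ M →
    (𝒴 t ⊙ 𝒴 (t ^ M)
    ≈ᵈ scaleBy (pochhammer u t M ÷ pochhammer (-ᵘ u) t M)
    (normalOrdered t (t ^ M)) (normalOrdered-summable t (t ^ M)))
    × (F t (t ^ M)
    ≈ᵘ ∏< M (λ j → (1ᵘ -ᵘ constant (t ^ j) *ᵘ u) ÷ (1ᵘ +ᵘ constant (t ^ j) *ᵘ u)))
    × (∏< M (λ j → (1ᵘ -ᵘ constant (t ^ j) *ᵘ u) ÷ (1ᵘ +ᵘ constant (t ^ j) *ᵘ u))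
    ≈ᵘ pochhammer u t M ÷ pochhammer (-ᵘ u) t M)
theorem4p1 M _ = commutation , F-product , product-pochhammer
  where
  open FunctionField using (fromℚ-ℚAlgebra; 1-t^-inverse)

  factorization : Factorization (VertexOperators.Summable ℚ⟨t⟩ _⁻¹ᶠ fromℚ) 𝒴 _⊙_ _≈ᵈ_ scaleBy
    normalOrdered normalOrdered-summable F _≈ᵘ_ ∏<
    pochhammer _÷_ _+ᵘ_ _-ᵘ_ _*ᵘ_ -ᵘ_ 1ᵘ u constant _^_ t M
  factorization = NormalOrdering.factorization ℚ⟨t⟩ _⁻¹ᶠ fromℚ fromℚ-ℚAlgebra
    _^_ (λ _ _ → ≡.refl) t (λ k → 1-t^-inverse (2 ℕ.* k)) M

  open Factorization factorization
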